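{- Let $G$ be an oriented graph with $n$ vertices and $m$ edges. 1. If $G$ is 3-edge-connected, then $G$ has at least $2^{(m-n)/3}$ nowhere-zero $\mathbb{Z}_6$-flows. 2. If $G$ is 4-edge-connected, then $G$ has at least $2^{n/3}$ nowhere-zero $\mathbb{Z}_2\times\mathbb{Z}_2$-flows.
   Context: Graphs are finite and may have loops and parallel edges. A graph is $k$-edge-connected if it has at least two vertices and remains connected after deleting any set of fewer than $k$ edges (an oriented graph is $k$-edge-connected if its underlying undirected graph is). For an oriented graph $G=(V,E)$ and $v\in V$, $\delta^+(v)$ is the set of edges with initial vertex $v$ and $\delta^-(v)$ the set of edges with terminal vertex $v$ (a loop at $v$ belongs to both). For an additive abelian group $\Gamma$, a $\Gamma$-flow is a function $\phi:E\to\Gamma$ with $\sum_{e\in\delta^+(v)}\phi(e)=\sum_{e\in\delta^-(v)}\phi(e)$ for every $v\in V$. It is nowhere-zero if $\phi(e)\neq 0$ for every $e\in E$. -}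

module Defs where

open import Algebra.Bundles using (AbelianGroup)
import Algebra.Construct.DirectProduct as DirectProduct
open import Algebra.Definitions.RawMonoid using (sum)
open import Algebra.Structures using (IsAbelianGroup)
open import Data.Bool.Base using (if_then_else_)
open import Data.Fin.Base using (Fin; toℕ)
open import Data.Fin.Properties using (_≟_; toℕ<n; toℕ-fromℕ<; toℕ-injective)
open import Data.Fin.Subset using (Subset; _∉_; ∣_∣)
open import Data.Nat.Base using (ℕ; _+_; _∸_; _≤_; _<_; _%_; NonZero; >-nonZero⁻¹)
open import Data.Nat.DivMod
  using (_mod_; m%n<n; m%n%n≡m%n; m<n⇒m%n≡m; n%n≡0; %-distribˡ-+)
open import Data.Nat.Properties using (+-comm; +-assoc; m∸n+n≡m; <⇒≤)
open import Data.Product.Base using (Σ-syntax; ∃-syntax; _×_; _,_; proj₁)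
open import Data.Vec.Base using (lookup; tabulate)
import Data.Vec.Functional.Relation.Binary.Equality.Setoid as VectorEquality
open import Function.Bundles using (Injection)
open import Level using (0ℓ; _⊔_)
open import Relation.Binary.Bundles using (Setoid)
open import Relation.Binary.Construct.Closure.Equivalence using (EqClosure)
import Relation.Binary.Construct.On as On
open import Relation.Binary.PropositionalEquality
  using (_≡_; refl; sym; trans; cong; cong₂; isEquivalence; setoid; module ≡-Reasoning)
open import Relation.Nullary using (¬_; does)

-- Loops and parallel edges are allowed.
record OrientedGraph (n m : ℕ) : Set where
  field
    initial  : Fin m → Fin n
    terminal : Fin m → Fin n

module _ {n m : ℕ} (G : OrientedGraph n m) where
  open OrientedGraph G

  δ⁺ δ⁻ : Fin n → Subset m
  δ⁺ v = tabulate λ e → does (initial e ≟ v)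
  δ⁻ v = tabulate λ e → does (terminal e ≟ v)

  EdgeAvoiding : Subset m → Fin n → Fin n → Set
  EdgeAvoiding S u v = ∃[ e ] e ∉ S × initial e ≡ u × terminal e ≡ v

  -- The equivalence closure is joinability by a walk that may traverse the
  -- edges outside S in either direction, so this is connectedness of the
  -- underlying undirected graph of G after deleting S.
  ConnectedAfterDeleting : Subset m → Set
  ConnectedAfterDeleting S = ∀ u v → EqClosure (EdgeAvoiding S) u v

  EdgeConnected : ℕ → Set
  EdgeConnected k = 2 ≤ n × (∀ S → ∣ S ∣ < k → ConnectedAfterDeleting S)

module _ {c ℓ n m} (Γ : AbelianGroup c ℓ) (G : OrientedGraph n m) where
  open AbelianGroup Γ using (Carrier; _≈_; rawMonoid) renaming (ε to 0#; setoid to Γ-setoid)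

  sumOver : Subset m → (Fin m → Carrier) → Carrier
  sumOver S φ = sum rawMonoid λ e → if lookup S e then φ e else 0#

  IsFlow : (Fin m → Carrier) → Set ℓ
  IsFlow φ = ∀ v → sumOver (δ⁺ G v) φ ≈ sumOver (δ⁻ G v) φ

  IsNowhereZero : (Fin m → Carrier) → Set ℓ
  IsNowhereZero φ = ∀ e → ¬ (φ e ≈ 0#)

  -- Two flows are identified when they agree on every edge; the proofs of the
  -- flow and nowhere-zero conditions are ignored, so that flows are counted as
  -- functions.
  NowhereZeroFlows : Setoid (c ⊔ ℓ) ℓ
  NowhereZeroFlows = On.setoid
    {B = Σ[ φ ∈ (Fin m → Carrier) ] IsFlow φ × IsNowhereZero φ}
    (VectorEquality.≋-setoid Γ-setoid m) proj₁

HasAtLeast : ∀ {a ℓ} → Setoid a ℓ → ℕ → Set (a ⊔ ℓ)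
HasAtLeast S N = Injection (setoid (Fin N)) S

module _ (n : ℕ) .{{_ : NonZero n}} where

  private
    _⊕_ : Fin n → Fin n → Fin n
    a ⊕ b = (toℕ a + toℕ b) mod n

    ⊝_ : Fin n → Fin n
    ⊝ a = (n ∸ toℕ a) mod n

    𝟘 : Fin n
    𝟘 = 0 mod n

    toℕ-mod : ∀ k → toℕ (k mod n) ≡ k % n
    toℕ-mod k = toℕ-fromℕ< (m%n<n k n)

    toℕ% : ∀ a → toℕ a % n ≡ toℕ a
    toℕ% a = m<n⇒m%n≡m (toℕ<n a)

    mod-cong : ∀ {j k} → j % n ≡ k % n → j mod n ≡ k mod n
    mod-cong {j} {k} eq = toℕ-injective (trans (toℕ-mod j) (trans eq (sym (toℕ-mod k))))

    mod-toℕ : ∀ a → toℕ a mod n ≡ a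
    mod-toℕ a = toℕ-injective (trans (toℕ-mod (toℕ a)) (toℕ% a))

    %-+ˡ : ∀ j k → (j % n + k) % n ≡ (j + k) % n
    %-+ˡ j k = begin
      (j % n + k) % n          ≡⟨ %-distribˡ-+ (j % n) k n ⟩
      (j % n % n + k % n) % n  ≡⟨ cong (λ x → (x + k % n) % n) (m%n%n≡m%n j n) ⟩
      (j % n + k % n) % n      ≡⟨ %-distribˡ-+ j k n ⟨
      (j + k) % n              ∎
      where open ≡-Reasoning

    mod-⊕ : ∀ j b → (j mod n) ⊕ b ≡ (j + toℕ b) mod n
    mod-⊕ j b = mod-cong (trans (cong (λ x → (x + toℕ b) % n) (toℕ-mod j)) (%-+ˡ j (toℕ b)))

    ⊕-comm : ∀ a b → a ⊕ b ≡ b ⊕ a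
    ⊕-comm a b = cong (_mod n) (+-comm (toℕ a) (toℕ b))

    ⊕-assoc : ∀ a b c → (a ⊕ b) ⊕ c ≡ a ⊕ (b ⊕ c)
    ⊕-assoc a b c = begin
      (a ⊕ b) ⊕ c                      ≡⟨ mod-⊕ (toℕ a + toℕ b) c ⟩
      (toℕ a + toℕ b + toℕ c) mod n    ≡⟨ cong (_mod n) (+-assoc (toℕ a) (toℕ b) (toℕ c)) ⟩
      (toℕ a + (toℕ b + toℕ c)) mod n  ≡⟨ cong (_mod n) (+-comm (toℕ a) _) ⟩
      (toℕ b + toℕ c + toℕ a) mod n    ≡⟨ mod-⊕ (toℕ b + toℕ c) a ⟨
      (b ⊕ c) ⊕ a                      ≡⟨ ⊕-comm (b ⊕ c) a ⟩
      a ⊕ (b ⊕ c)                      ∎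
      where open ≡-Reasoning

    ⊕-identityˡ : ∀ a → 𝟘 ⊕ a ≡ a
    ⊕-identityˡ a = trans (mod-⊕ 0 a) (mod-toℕ a)

    ⊕-inverseˡ : ∀ a → (⊝ a) ⊕ a ≡ 𝟘
    ⊕-inverseˡ a = begin
      (⊝ a) ⊕ a                    ≡⟨ mod-⊕ (n ∸ toℕ a) a ⟩
      (n ∸ toℕ a + toℕ a) mod n    ≡⟨ cong (_mod n) (m∸n+n≡m (<⇒≤ (toℕ<n a))) ⟩
      n mod n                      ≡⟨ mod-cong (trans (n%n≡0 n) (sym (m<n⇒m%n≡m (>-nonZero⁻¹ n)))) ⟩
      𝟘                            ∎
      where open ≡-Reasoning

    ⊕-isAbelianGroup : IsAbelianGroup _≡_ _⊕_ 𝟘 ⊝_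
    ⊕-isAbelianGroup = record
      { isGroup = record
        { isMonoid = record
          { isSemigroup = record
            { isMagma = record { isEquivalence = isEquivalence ; ∙-cong = cong₂ _⊕_ }
            ; assoc   = ⊕-assoc
            }
          ; identity = ⊕-identityˡ , λ a → trans (⊕-comm a 𝟘) (⊕-identityˡ a)
          }
        ; inverse = ⊕-inverseˡ , λ a → trans (⊕-comm a (⊝ a)) (⊕-inverseˡ a)
        ; ⁻¹-cong = cong ⊝_
        }
      ; comm = ⊕-comm
      }

  -- Residues 0, …, n ∸ 1 under addition modulo n.
  ℤ/_ : AbelianGroup 0ℓ 0ℓ
  ℤ/_ = record { isAbelianGroup = ⊕-isAbelianGroup }

ℤ₆ : AbelianGroup 0ℓ 0ℓ
ℤ₆ = ℤ/ 6

ℤ₂×ℤ₂ : AbelianGroup 0ℓ 0ℓ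
ℤ₂×ℤ₂ = DirectProduct.abelianGroup (ℤ/ 2) (ℤ/ 2)

{-# OPTIONS --safe #-}
module Submission where

-- Adding an element of order two along an even subgraph turns a nowhere-zero flow φ into
-- another one as long as it stays nonzero on the edges F where this is allowed, and F
-- contains at least 2^(|F| - n) even subgraphs. It remains to find φ with F large.
--
-- For ℤ₂×ℤ₂, two disjoint connected spanning edge sets B₁ and B₂ give φ: on each Bᵢ, the
-- constant 1 off Bᵢ is completed to a ℤ₂-flow. For a nonzero element a one may take
-- F = {φ ≠ a}; the three choices have total size 2m ≥ 4n. To find B₁ and B₂, note that an
-- inclusion-minimal dense vertex set spans, after pruning, a (2,2)-tight graph, which splits
-- into two trees by Henneberg's reductions; contract it and repeat.
--
-- For ℤ₆, Seymour's closure argument gives a flow ψ with values 0, ±1 and a flow h with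
-- 2h ≠ 0 off supp ψ. Then φ = 3ψ + 2(h + kψ) is nowhere-zero for k = 0, 1, 2, with
-- F = {2(h + kψ) ≠ 0}, and each edge of supp ψ is missing from F for exactly one k, so
-- 3|F| ≥ 3m - |supp ψ| for some k. The degrees of supp ψ are even and those of G are at
-- least 3, whence deg ψ ≤ 2 deg - 4 at each vertex, so |supp ψ| ≤ 2(m - n) and
-- |F| - n ≥ (m - n)/3. In the closure argument X grows by closed trails outside X that have
-- two edges to X; such a trail exists in a minimal B outside X sending at most one
-- edge to the rest of the complement of X, because B is then 2-edge-connected.

open import Defs
open import Algebra.Bundles using (AbelianGroup)
open import Algebra.Morphism.Structures using (module GroupMorphisms)
import Algebra.Properties.AbelianGroup as AbelianGroupProperties
import Algebra.Properties.CommutativeMonoid.Sum as Sum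
import Algebra.Properties.CommutativeSemigroup as CommutativeSemigroupProperties
open import Data.Bool.Base using (Bool; true; false; if_then_else_; not; _∧_; _∨_; _xor_)
open import Data.Bool.Properties using (¬-not; ∧-identityʳ; ∨-identityʳ; ∧-zeroʳ) renaming (_≟_ to _≟ᵇ_)
open import Data.Empty using (⊥; ⊥-elim)
open import Data.Fin.Base using (Fin; zero; suc)
open import Data.Fin.Patterns
open import Data.Fin.Properties using (_≟_; all?; any?)
open import Data.Fin.Subset using (Subset; ∣_∣) renaming (_∈_ to _∈ₛ_)
open import Data.Fin.Subset.Properties using (anySubset?)
open import Data.List.Base using (List; []; _∷_; _++_; map; filter; length; allFin)
open import Data.List.Properties using (length-map; length-++; length-tabulate)
open import Data.List.Membership.Propositional using (_∈_)
open import Data.List.Membership.Propositional.Properties using (∈-allFin; ∈-lookup; ∈-map⁻)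
open import Data.List.Relation.Unary.All as All using (All; []; _∷_)
import Data.List.Relation.Unary.All.Properties as All
open import Data.List.Relation.Unary.Unique.Propositional using (Unique; []; _∷_)
import Data.List.Relation.Unary.Unique.Propositional.Properties as Unique
open import Data.Nat.Base
open import Data.Nat.Induction using (<-wellFounded; Acc; acc)
open import Data.Nat.Properties renaming (_≟_ to _ℕ≟_)
open import Data.Nat.Tactic.RingSolver using (solve-∀)
open import Data.Product.Base using (Σ-syntax; ∃; ∃-syntax; _×_; _,_; proj₁; proj₂)
open import Data.Sum.Base using (_⊎_; inj₁; inj₂; [_,_]′)
open import Data.Vec.Base using (Vec; []; _∷_; lookup; tabulate; zipWith)
open import Data.Vec.Properties using (lookup∘tabulate; lookup-zipWith; lookup⇒[]=; ∷-injectiveʳ)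
open import Function.Base using (_∘_; id; case_of_)
import Level
open import Relation.Binary.Construct.Closure.Equivalence using (EqClosure)
open import Relation.Binary.Construct.Closure.ReflexiveTransitive using (_◅_) renaming (ε to [·])
open import Relation.Binary.Construct.Closure.Symmetric using (fwd; bwd)
open import Relation.Binary.PropositionalEquality
  using (_≡_; _≢_; _≗_; refl; sym; trans; cong; cong₂; subst; module ≡-Reasoning)
open import Relation.Nullary
open import Relation.Nullary.Decidable using (from-yes; _×-dec_; _⊎-dec_; _→-dec_; ¬?)

open GroupMorphisms using (IsGroupHomomorphism)

open Sum +-0-commutativeMonoid using ()
  renaming (sum to sumℕ; ∑-distrib-+ to sumℕ-distrib-+; ∑-comm to sumℕ-comm; sum-cong-≗ to sumℕ-cong)

private variable k : ℕ

-- Sets of vertices and of edges are Boolean-valued functions.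

-- Reduction modulo 2 and modulo 3 separates the two summands of φ over ℤ₆: 3ψ carries the residue
-- modulo 2 and 2(h + kψ) the residue modulo 3. An even subgraph changes only the former, so it is
-- harmless wherever the latter is nonzero. The flow ψ has values 0 and ±1, instead of being a mere
-- indicator modulo 2, because it also shifts the part modulo 3: on its support kψ then runs through
-- all three residues. The closure step asks for two edges from the new closed trail to X for the
-- following reason. A circuit through both has three multiples modulo 3; each of the two edges
-- rules out at most one of them, so one survives. The edges of the trail itself join supp ψ and
-- impose no condition. The values forbidden for 2h are arbitrary rather than 0, so that the new
-- edges can be settled first and the previous stage can then be asked to repair the old edges.

bit : Bool → ℕ
bit b = if b then 1 else 0

# : (Fin k → Bool) → ℕ
# f = sumℕ (bit ∘ f)

_==_ : Fin k → Fin k → Bool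
i == j = does (i ≟ j)

_∖_ : (Fin k → Bool) → Fin k → Fin k → Bool
(f ∖ i) j = f j ∧ not (i == j)

==-refl : (i : Fin k) → (i == i) ≡ true
==-refl i with i ≟ i
... | yes _ = refl
... | no i≢i = ⊥-elim (i≢i refl)

==⇒≡ : {i j : Fin k} → (i == j) ≡ true → i ≡ j
==⇒≡ {i = i} {j} eq with i ≟ j
... | yes i≡j = i≡j

≢⇒== : {i j : Fin k} → i ≢ j → (i == j) ≡ false
≢⇒== {i = i} {j} i≢j with i ≟ j
... | yes i≡j = ⊥-elim (i≢j i≡j)
... | no _ = refl

==⇒≢ : {i j : Fin k} → (i == j) ≡ false → i ≢ j
==⇒≢ {i = i} eq refl with () ← trans (sym eq) (==-refl i)

==-sym : (i j : Fin k) → (i == j) ≡ (j == i)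
==-sym i j with i ≟ j
... | yes refl = sym (==-refl i)
... | no i≢j = sym (≢⇒== (i≢j ∘ sym))

∖-removed : (f : Fin k → Bool) (i : Fin k) → (f ∖ i) i ≡ false
∖-removed f i rewrite ==-refl i with f i
... | true = refl
... | false = refl

∧-true : ∀ {a b} → a ≡ true → b ≡ true → a ∧ b ≡ true
∧-true refl refl = refl

∧-true⁻ : ∀ {a b} → a ∧ b ≡ true → a ≡ true × b ≡ true
∧-true⁻ {true} {true} _ = refl , refl

∨-true⁻ : ∀ {a b} → a ∨ b ≡ true → a ≡ true ⊎ b ≡ true
∨-true⁻ {true} _ = inj₁ refl
∨-true⁻ {false} {true} _ = inj₂ refl

∨-trueˡ : ∀ {a b} → a ≡ true → a ∨ b ≡ true
∨-trueˡ refl = refl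

∨-trueʳ : ∀ {a b} → b ≡ true → a ∨ b ≡ true
∨-trueʳ {true} refl = refl
∨-trueʳ {false} refl = refl

∨-false⁻ : ∀ {a b} → a ∨ b ≡ false → a ≡ false × b ≡ false
∨-false⁻ {false} {false} _ = refl , refl

nor⁻ : ∀ {a b} → not (a ∨ b) ≡ true → a ≡ false × b ≡ false
nor⁻ {false} {false} _ = refl , refl

false≢true : ∀ {a : Bool} {A : Set} → a ≡ false → a ≡ true → A
false≢true refl ()

∖⁻ : (f : Fin k → Bool) (i : Fin k) {j : Fin k} → (f ∖ i) j ≡ true → f j ≡ true × i ≢ j
∖⁻ f i {j} p with f j | i ≟ j
... | true | no i≢j = refl , i≢j

∖⁺ : (f : Fin k → Bool) {i j : Fin k} → f j ≡ true → i ≢ j → (f ∖ i) j ≡ true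
∖⁺ f p q = ∧-true p (cong not (≢⇒== q))

sumℕ-mono : {f g : Fin k → ℕ} → (∀ i → f i ≤ g i) → sumℕ f ≤ sumℕ g
sumℕ-mono {zero} f≤g = z≤n
sumℕ-mono {suc k} f≤g = +-mono-≤ (f≤g zero) (sumℕ-mono (f≤g ∘ suc))

sumℕ-const : ∀ k {c} → sumℕ {k} (λ _ → c) ≡ k * c
sumℕ-const zero = refl
sumℕ-const (suc k) = cong (_ +_) (sumℕ-const k)

sumℕ-*ˡ : ∀ c (f : Fin k → ℕ) → sumℕ (λ i → c * f i) ≡ c * sumℕ f
sumℕ-*ˡ {zero} c f = sym (*-zeroʳ c)
sumℕ-*ˡ {suc k} c f = trans (cong (c * f zero +_) (sumℕ-*ˡ c (f ∘ suc))) (sym (*-distribˡ-+ c (f zero) _))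

sumℕ-< : {f g : Fin k → ℕ} → sumℕ f < sumℕ g → ∃[ i ] f i < g i
sumℕ-< {f = f} {g} p with any? (λ i → f i <? g i)
... | yes q = q
... | no ¬q = ⊥-elim (<⇒≱ p (sumℕ-mono λ i → ≮⇒≥ λ r → ¬q (i , r)))

#-cong : {f g : Fin k → Bool} → f ≗ g → # f ≡ # g
#-cong f≗g = sumℕ-cong (cong bit ∘ f≗g)

bit-mono : ∀ {a b} → (a ≡ true → b ≡ true) → bit a ≤ bit b
bit-mono {false} _ = z≤n
bit-mono {true} h rewrite h refl = ≤-refl

#-mono : {f g : Fin k → Bool} → (∀ i → f i ≡ true → g i ≡ true) → # f ≤ # g
#-mono f⇒g = sumℕ-mono (bit-mono ∘ f⇒g)

#-all : (f : Fin k → Bool) → (∀ i → f i ≡ true) → # f ≡ k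
#-all {k} f h = trans (sumℕ-cong (cong bit ∘ h)) (trans (sumℕ-const k) (*-identityʳ k))

#-none : (f : Fin k → Bool) → (∀ i → f i ≡ false) → # f ≡ 0
#-none {k} f h = trans (sumℕ-cong (cong bit ∘ h)) (trans (sumℕ-const k) (*-zeroʳ k))

#-== : (i : Fin k) → # (i ==_) ≡ 1
#-== {suc k} zero = cong suc (#-none {k} (λ _ → false) λ _ → refl)
#-== (suc i) = #-== i

#-∖ : (f : Fin k → Bool) {i : Fin k} → f i ≡ true → # f ≡ suc (# (f ∖ i))
#-∖ f {i} p = begin
  # f                                             ≡⟨ sumℕ-cong pointwise ⟩
  sumℕ (λ j → bit (i == j) + bit ((f ∖ i) j))      ≡⟨ sumℕ-distrib-+ (bit ∘ (i ==_)) _ ⟩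
  # (i ==_) + # (f ∖ i)                           ≡⟨ cong (_+ # (f ∖ i)) (#-== i) ⟩
  suc (# (f ∖ i))                                 ∎
  where
  open ≡-Reasoning
  pointwise : ∀ j → bit (f j) ≡ bit (i == j) + bit ((f ∖ i) j)
  pointwise j with i ≟ j
  ... | yes refl rewrite p = refl
  ... | no _ = cong bit (sym (∧-identityʳ (f j)))

#-pick : (f : Fin k → Bool) {c : ℕ} → # f ≡ suc c → ∃[ i ] f i ≡ true × # (f ∖ i) ≡ c
#-pick f {c} eq with any? (λ i → f i ≟ᵇ true)
... | yes (i , p) = i , p , suc-injective (trans (sym (#-∖ f p)) eq)
... | no ¬p with () ← trans (sym eq) (#-none f λ i → ¬-not λ q → ¬p (i , q))

#-pos : (f : Fin k → Bool) → 1 ≤ # f → ∃[ i ] f i ≡ true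
#-pos f p with # f in eq
#-pos f (s≤s _) | suc _ = let (i , q , _) = #-pick f eq in i , q

#-pos⁻ : (f : Fin k → Bool) {i : Fin k} → f i ≡ true → 1 ≤ # f
#-pos⁻ f p = ≤-trans (s≤s z≤n) (≤-reflexive (sym (#-∖ f p)))

#-other : (f : Fin k → Bool) → 2 ≤ # f → (i : Fin k) → ∃[ j ] f j ≡ true × i ≢ j
#-other f p i with f i in eq
... | true = let (j , q) = #-pos (f ∖ i) (s≤s⁻¹ (≤-trans p (≤-reflexive (#-∖ f eq)))) ; (r , i≢j) = ∖⁻ f i q in j , r , i≢j
... | false = let (j , q) = #-pos f (≤-trans (n≤1+n 1) p) in j , q , λ { refl → false≢true eq q }

#-two : (f : Fin k → Bool) → 2 ≤ # f → ∃[ i ] ∃[ j ] f i ≡ true × f j ≡ true × i ≢ j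
#-two f p = let (i , q) = #-pos f (≤-trans (n≤1+n 1) p) ; (j , r , i≢j) = #-other f p i in i , j , q , r , i≢j

#-< : {f g : Fin k → Bool} → (∀ i → f i ≡ true → g i ≡ true) →
      (i : Fin k) → f i ≡ false → g i ≡ true → # f < # g
#-< {f = f} {g} f⇒g i p q = ≤-trans (s≤s (#-mono {f = f} λ j r → ∖⁺ g {i} (f⇒g j r) λ { refl → false≢true p r }))
  (≤-reflexive (sym (#-∖ g q)))

-- `anySubset?` ranges over vectors, and a Boolean function agrees with the table of its values only
-- pointwise; hence `P` has to respect `≗`.
search : ∀ {p} (P : (Fin k → Bool) → Set p) → (∀ f → Dec (P f)) → (∀ {f g} → f ≗ g → P f → P g) → Dec (∃ P)
search P P? ext with anySubset? (λ S → P? (lookup S))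
... | yes (S , p) = yes (lookup S , p)
... | no ¬p = no λ (f , q) → ¬p (tabulate f , ext (λ i → sym (lookup∘tabulate f i)) q)

#-+# : (f g : Fin k → Bool) → sumℕ (λ i → bit (f i) + bit (g i)) ≡ # f + # g
#-+# f g = sumℕ-distrib-+ (bit ∘ f) (bit ∘ g)

#+#≤#+# : (f g h j : Fin k → Bool) → (∀ i → bit (f i) + bit (g i) ≤ bit (h i) + bit (j i)) → # f + # g ≤ # h + # j
#+#≤#+# f g h j p = subst (_≤ # h + # j) (#-+# f g) (≤-trans (sumℕ-mono p) (≤-reflexive (#-+# h j)))

#≡#+# : (f h j : Fin k → Bool) → (∀ i → bit (f i) ≡ bit (h i) + bit (j i)) → # f ≡ # h + # j
#≡#+# f h j p = trans (sumℕ-cong p) (#-+# h j)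

infix 4 _⊆_
_⊆_ : (Fin k → Bool) → (Fin k → Bool) → Set
X ⊆ Y = ∀ v → X v ≡ true → Y v ≡ true

insert : Fin k → (Fin k → Bool) → Fin k → Bool
insert i X j = X j ∨ (i == j)

insert-self : (i : Fin k) (X : Fin k → Bool) → insert i X i ≡ true
insert-self i X = ∨-trueʳ (==-refl i)

insert⁻ : (i : Fin k) (X : Fin k → Bool) {j : Fin k} → insert i X j ≡ true → X j ≡ true ⊎ i ≡ j
insert⁻ i X {j} p with ∨-true⁻ {X j} p
... | inj₁ q = inj₁ q
... | inj₂ q = inj₂ (==⇒≡ q)

#-insert : (i : Fin k) (X : Fin k → Bool) → X i ≡ false → # (insert i X) ≡ suc (# X)
#-insert i X i∉X = trans (#≡#+# (insert i X) (i ==_) X pointwise) (cong (_+ # X) (#-== i))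
  where
  pointwise : ∀ j → bit (insert i X j) ≡ bit (i == j) + bit (X j)
  pointwise j with i ≟ j
  ... | yes refl rewrite i∉X = refl
  ... | no _ = cong bit (∨-identityʳ _)

#-modular : (X Z : Fin k → Bool) → # X + # Z ≡ # (λ v → X v ∨ Z v) + # (λ v → X v ∧ Z v)
#-modular X Z = trans (sym (#-+# X Z))
  (trans (sumℕ-cong λ v → pointwise (X v) (Z v)) (#-+# (λ v → X v ∨ Z v) (λ v → X v ∧ Z v)))
  where
  pointwise : ∀ a b → bit a + bit b ≡ bit (a ∨ b) + bit (a ∧ b)
  pointwise false b = sym (+-identityʳ _)
  pointwise true false = refl
  pointwise true true = refl

-- Least cardinality, reached by descent on a number, also covers minimality under inclusion.
minimal : ∀ {p} (P : (Fin k → Bool) → Set p) → (∀ f → Dec (P f)) → (∀ {f g} → f ≗ g → P f → P g) →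
          ∀ X → P X → ∃[ Z ] P Z × (∀ Z′ → P Z′ → # Z ≤ # Z′)
minimal P P? ext X pX = go X pX (<-wellFounded (# X))
  where
  go : ∀ X → P X → Acc _<_ (# X) → ∃[ Z ] P Z × (∀ Z′ → P Z′ → # Z ≤ # Z′)
  go X pX (acc rec) with search (λ Z → P Z × # Z < # X) (λ Z → P? Z ×-dec (# Z <? # X))
                           (λ f≗g (p , q) → ext f≗g p , subst (_< # X) (#-cong f≗g) q)
  ... | yes (Z , pZ , lt) = go Z pZ (rec lt)
  ... | no ¬p = X , pX , λ Z′ pZ′ → ≮⇒≥ λ lt → ¬p (Z′ , pZ′ , lt)

subsetOfSize : ∀ (F : Fin k → Bool) c d → # F ≡ c + d → ∃[ F′ ] F′ ⊆ F × # F′ ≡ d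
subsetOfSize F zero d eq = F , (λ _ p → p) , eq
subsetOfSize F (suc c) d eq =
  let (i , _ , eq′) = #-pick F eq
      (F′ , F′⊆ , eq″) = subsetOfSize (F ∖ i) c d eq′
  in F′ , (λ v p → proj₁ (∖⁻ F i (F′⊆ v p))) , eq″

-- Graphs, boundaries and flows

module Edges {n m : ℕ} (s t : Fin m → Fin n) where

  Joins : Fin m → Fin n → Fin n → Set
  Joins e u v = (s e ≡ u × t e ≡ v) ⊎ (s e ≡ v × t e ≡ u)

  Joins-sym : ∀ {e u v} → Joins e u v → Joins e v u
  Joins-sym (inj₁ p) = inj₂ p
  Joins-sym (inj₂ p) = inj₁ p

  data Connected (S : Fin m → Bool) : Fin n → Fin n → Set where
    here : ∀ {u} → Connected S u u
    step : ∀ {u v w} e → S e ≡ true → Joins e u v → Connected S v w → Connected S u w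

  infixr 5 _◅◅_
  _◅◅_ : ∀ {S u v w} → Connected S u v → Connected S v w → Connected S u w
  here ◅◅ q = q
  step e e∈S j p ◅◅ q = step e e∈S j (p ◅◅ q)

  edge : ∀ {S u v} e → S e ≡ true → Joins e u v → Connected S u v
  edge e e∈S j = step e e∈S j here

  reverse : ∀ {S u v} → Connected S u v → Connected S v u
  reverse here = here
  reverse (step e e∈S j p) = reverse p ◅◅ edge e e∈S (Joins-sym j)

  Connected-mono : ∀ {S S′ u v} → (∀ e → S e ≡ true → S′ e ≡ true) → Connected S u v → Connected S′ u v
  Connected-mono h here = here
  Connected-mono h (step e e∈S j p) = step e (h e e∈S) j (Connected-mono h p)

  inside : (Fin n → Bool) → Fin m → Bool
  inside X e = X (s e) ∧ X (t e)

  between : (Fin n → Bool) → (Fin n → Bool) → Fin m → Bool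
  between X Y e = (X (s e) ∧ Y (t e)) ∨ (Y (s e) ∧ X (t e))

  between⁻ : ∀ {X Y e} → between X Y e ≡ true → ∃[ x ] ∃[ y ] X x ≡ true × Y y ≡ true × Joins e x y
  between⁻ {X} {Y} {e} p with ∨-true⁻ {X (s e) ∧ Y (t e)} p
  ... | inj₁ q = let (a , b) = ∧-true⁻ {X (s e)} q in s e , t e , a , b , inj₁ (refl , refl)
  ... | inj₂ q = let (a , b) = ∧-true⁻ {Y (s e)} q in t e , s e , b , a , inj₂ (refl , refl)

  between⁺ : ∀ {X Y : Fin n → Bool} {e x y} → X x ≡ true → Y y ≡ true → Joins e x y → between X Y e ≡ true
  between⁺ p q (inj₁ (refl , refl)) = ∨-trueˡ (∧-true p q)
  between⁺ p q (inj₂ (refl , refl)) = ∨-trueʳ (∧-true q p)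

  inside⁺ : ∀ {X : Fin n → Bool} {e x y} → X x ≡ true → X y ≡ true → Joins e x y → inside X e ≡ true
  inside⁺ p q (inj₁ (refl , refl)) = ∧-true p q
  inside⁺ p q (inj₂ (refl , refl)) = ∧-true q p

  inside⁻ : ∀ {X : Fin n → Bool} {e x y} → Joins e x y → inside X e ≡ true → X x ≡ true × X y ≡ true
  inside⁻ (inj₁ (refl , refl)) p = ∧-true⁻ p
  inside⁻ {X} (inj₂ (refl , refl)) p = let (a , b) = ∧-true⁻ p in b , a

  degree : (Fin m → Bool) → Fin n → ℕ
  degree A v = sumℕ λ e → bit (A e ∧ (s e == v)) + bit (A e ∧ (t e == v))

  -- The handshake lemma: after exchanging the sums, every edge of `A` counts once at each end, a
  -- loop twice at its vertex.
  sum-degree : ∀ A → sumℕ (degree A) ≡ 2 * # A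
  sum-degree A = begin
    sumℕ (degree A)                                                          ≡⟨ sumℕ-comm (λ v e → bit (A e ∧ (s e == v)) + bit (A e ∧ (t e == v))) ⟩
    sumℕ (λ e → sumℕ λ v → bit (A e ∧ (s e == v)) + bit (A e ∧ (t e == v)))  ≡⟨ sumℕ-cong pointwise ⟩
    sumℕ (λ e → 2 * bit (A e))                                               ≡⟨ sumℕ-*ˡ 2 (bit ∘ A) ⟩
    2 * # A                                                                  ∎
    where
    open ≡-Reasoning
    one-end : ∀ b (x : Fin n) → # (λ v → b ∧ (x == v)) ≡ bit b
    one-end true x = #-== x
    one-end false x = #-none {n} _ λ _ → refl
    pointwise : ∀ e → sumℕ (λ v → bit (A e ∧ (s e == v)) + bit (A e ∧ (t e == v))) ≡ 2 * bit (A e)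
    pointwise e = trans (sumℕ-distrib-+ (λ v → bit (A e ∧ (s e == v))) _)
      (cong₂ _+_ (one-end (A e) (s e)) (trans (one-end (A e) (t e)) (sym (+-identityʳ _))))

  cut : (Fin n → Bool) → ℕ
  cut Y = # λ e → Y (s e) xor Y (t e)

  CutsAtLeast : ℕ → Set
  CutsAtLeast k = ∀ Y {u w} → Y u ≡ true → Y w ≡ false → k ≤ cut Y

module Boundary {c ℓ} (Γ : AbelianGroup c ℓ) {n m : ℕ} (s t : Fin m → Fin n) where
  open AbelianGroup Γ renaming (refl to ≈-refl; sym to ≈-sym; trans to ≈-trans; reflexive to ≈-reflexive)
  open AbelianGroupProperties Γ
  open CommutativeSemigroupProperties commutativeSemigroup using (interchange)
  open Sum commutativeMonoid
  open Edges s t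
  open import Relation.Binary.Reasoning.Setoid setoid

  at : Fin n → Carrier → Fin n → Carrier
  at u a v = if u == v then a else ε

  ends : Fin n → Fin n → Carrier → Fin n → Carrier
  ends u w a v = at u a v - at w a v

  -- A signed boundary, additive in `φ`, replaces the two one-sided sums of `IsFlow`: flows become
  -- its kernel, and walks have telescoping boundaries.
  ∂ : (Fin m → Carrier) → Fin n → Carrier
  ∂ φ v = sum λ e → ends (s e) (t e) (φ e) v

  -cong : ∀ {a b a′ b′} → a ≈ a′ → b ≈ b′ → a - b ≈ a′ - b′
  -cong p q = ∙-cong p (⁻¹-cong q)

  interchange- : ∀ a b a′ b′ → (a ∙ b) - (a′ ∙ b′) ≈ (a - a′) ∙ (b - b′)
  interchange- a b a′ b′ = ≈-trans (∙-congˡ (≈-sym (⁻¹-∙-comm a′ b′))) (interchange a b (a′ ⁻¹) (b′ ⁻¹))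

  ε-ε : ε - ε ≈ ε
  ε-ε = inverseʳ ε

  at-cong : ∀ u {a b} v → a ≈ b → at u a v ≈ at u b v
  at-cong u v p with u == v
  ... | true = p
  ... | false = ≈-refl

  at-∙ : ∀ u a b v → at u (a ∙ b) v ≈ at u a v ∙ at u b v
  at-∙ u a b v with u == v
  ... | true = ≈-refl
  ... | false = ≈-sym (identityˡ ε)

  at-ε : ∀ u v → at u ε v ≈ ε
  at-ε u v with u == v
  ... | true = ≈-refl
  ... | false = ≈-refl

  at-⁻¹ : ∀ u a v → at u (a ⁻¹) v ≈ at u a v ⁻¹
  at-⁻¹ u a v with u == v
  ... | true = ≈-refl
  ... | false = ≈-sym ε⁻¹≈ε

  ends-cong : ∀ u w {a b} v → a ≈ b → ends u w a v ≈ ends u w b v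
  ends-cong u w v p = -cong (at-cong u v p) (at-cong w v p)

  ends-∙ : ∀ u w a b v → ends u w (a ∙ b) v ≈ ends u w a v ∙ ends u w b v
  ends-∙ u w a b v = ≈-trans (-cong (at-∙ u a b v) (at-∙ w a b v)) (interchange- _ _ _ _)

  ends-ε : ∀ u w v → ends u w ε v ≈ ε
  ends-ε u w v = ≈-trans (-cong (at-ε u v) (at-ε w v)) ε-ε

  ends-self : ∀ u a v → ends u u a v ≈ ε
  ends-self u a v = inverseʳ _

  ends-trans : ∀ u w x a v → ends u w a v ∙ ends w x a v ≈ ends u x a v
  ends-trans u w x a v = begin
    (p - q) ∙ (q - r)        ≈⟨ assoc p (q ⁻¹) (q - r) ⟩
    p ∙ (q ⁻¹ ∙ (q - r))     ≈⟨ ∙-congˡ (≈-sym (assoc (q ⁻¹) q (r ⁻¹))) ⟩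
    p ∙ ((q ⁻¹ ∙ q) - r)     ≈⟨ ∙-congˡ (∙-congʳ (inverseˡ q)) ⟩
    p ∙ (ε - r)              ≈⟨ ∙-congˡ (identityˡ _) ⟩
    p - r                    ∎
    where
    p = at u a v
    q = at w a v
    r = at x a v

  ends-swap : ∀ u w a v → ends w u a v ≈ ends u w (a ⁻¹) v
  ends-swap u w a v = begin
    at w a v - at u a v                    ≈⟨ comm _ _ ⟩
    at u a v ⁻¹ ∙ at w a v                 ≈⟨ ∙-cong (at-⁻¹ u a v) (⁻¹-involutive _) ⟨
    at u (a ⁻¹) v ∙ (at w a v ⁻¹) ⁻¹       ≈⟨ ∙-congˡ (⁻¹-cong (at-⁻¹ w a v)) ⟨
    at u (a ⁻¹) v - at w (a ⁻¹) v          ∎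

  ∂-cong : ∀ {φ χ} → (∀ e → φ e ≈ χ e) → ∀ v → ∂ φ v ≈ ∂ χ v
  ∂-cong h v = sum-cong-≋ λ e → ends-cong (s e) (t e) v (h e)

  ∂-∙ : ∀ φ χ v → ∂ (λ e → φ e ∙ χ e) v ≈ ∂ φ v ∙ ∂ χ v
  ∂-∙ φ χ v = ≈-trans (sum-cong-≋ λ e → ends-∙ (s e) (t e) (φ e) (χ e) v) (∑-distrib-+ (λ e → ends (s e) (t e) (φ e) v) (λ e → ends (s e) (t e) (χ e) v))

  sum-ε : (f : Fin k → Carrier) → (∀ i → f i ≈ ε) → sum f ≈ ε
  sum-ε {k} f h = ≈-trans (sum-cong-≋ h) (sum-replicate-zero k)

  ∂-ε : ∀ v → ∂ (λ _ → ε) v ≈ ε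
  ∂-ε v = sum-ε _ λ e → ends-ε (s e) (t e) v

  ∂-sum : (f : Fin k → Fin m → Carrier) → ∀ v → ∂ (λ e → sum λ i → f i e) v ≈ sum (λ i → ∂ (f i) v)
  ∂-sum {zero} f v = ∂-ε v
  ∂-sum {suc k} f v = ≈-trans (∂-∙ _ _ v) (∙-congˡ (∂-sum (f ∘ suc) v))

  sum-one : (f : Fin k → Carrier) (i : Fin k) → (∀ j → i ≢ j → f j ≈ ε) → sum f ≈ f i
  sum-one f zero h = ≈-trans (∙-congˡ (sum-ε _ λ j → h (suc j) λ ())) (identityʳ _)
  sum-one f (suc i) h = ≈-trans (∙-cong (h zero λ ()) (sum-one (f ∘ suc) i λ j i≢j → h (suc j) λ { refl → i≢j refl })) (identityˡ _)

  one : Fin m → Carrier → Fin m → Carrier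
  one e a e′ = if e == e′ then a else ε

  one-≢ : ∀ {e e′ a} → e ≢ e′ → one e a e′ ≡ ε
  one-≢ {a = a} e≢e′ = cong (λ b → if b then a else ε) (≢⇒== e≢e′)

  one-self : ∀ e a → one e a e ≡ a
  one-self e a = cong (λ b → if b then a else ε) (==-refl e)

  ∂-one : ∀ e a v → ∂ (one e a) v ≈ ends (s e) (t e) a v
  ∂-one e a v = ≈-trans
    (sum-one _ e λ e′ e≢e′ → ≈-trans (ends-cong (s e′) (t e′) v (≈-reflexive (one-≢ e≢e′))) (ends-ε (s e′) (t e′) v))
    (ends-cong (s e) (t e) v (≈-reflexive (one-self e a)))

  ∂-⁻¹ : ∀ φ v → ∂ (λ e → φ e ⁻¹) v ≈ ∂ φ v ⁻¹
  ∂-⁻¹ φ v = inverseʳ-unique (∂ φ v) (∂ (λ e → φ e ⁻¹) v)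
    (≈-trans (≈-sym (∂-∙ φ (λ e → φ e ⁻¹) v)) (≈-trans (∂-cong (λ e → inverseʳ (φ e)) v) (∂-ε v)))

  Flow : (Fin m → Carrier) → Set ℓ
  Flow φ = ∀ v → ∂ φ v ≈ ε

  Flow-∙ : ∀ φ χ → Flow φ → Flow χ → Flow (λ e → φ e ∙ χ e)
  Flow-∙ φ χ p q v = ≈-trans (∂-∙ φ χ v) (≈-trans (∙-cong (p v) (q v)) (identityˡ ε))

  -- An edge traversed against its orientation carries the inverse value. Over ℤ₆ with `a = 1F`, the
  -- recorded alternative for `b` is exactly `Unit b`.
  Joins⇒∂ : ∀ {e u w} → Joins e u w → ∀ a →
            ∃[ b ] (b ≡ a ⊎ b ≡ a ⁻¹) × (∀ v → ∂ (one e b) v ≈ ends u w a v)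
  Joins⇒∂ {e} (inj₁ (refl , refl)) a = a , inj₁ refl , ∂-one e a
  Joins⇒∂ {e} (inj₂ (refl , refl)) a = a ⁻¹ , inj₂ refl , λ v →
    ≈-trans (∂-one e (a ⁻¹) v) (≈-sym (ends-swap (s e) (t e) a v))

  -- The value `a` is sent along the walk edge by edge; an edge met repeatedly accumulates its
  -- values, so the walk may repeat edges.
  route : ∀ {S u w} → Connected S u w → ∀ a →
          ∃[ f ] (∀ e → S e ≡ false → f e ≈ ε) × (∀ v → ∂ f v ≈ ends u w a v)
  route {u = u} here a = (λ _ → ε) , (λ _ _ → ≈-refl) , λ v → ≈-trans (∂-ε v) (≈-sym (ends-self u a v))
  route {S} {u} {w} (step {v = x} e e∈S j p) a =
    let (b , _ , ∂b) = Joins⇒∂ j a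
        (f , f-off , ∂f) = route p a
    in (λ e′ → one e b e′ ∙ f e′)
     , (λ e′ e′∉S → ≈-trans (∙-cong (≈-reflexive (one-≢ {e} {e′} λ { refl → false≢true e′∉S e∈S })) (f-off e′ e′∉S)) (identityˡ ε))
     , λ v → ≈-trans (∂-∙ (one e b) f v) (≈-trans (∙-cong (∂b v) (∂f v)) (ends-trans u x w a v))

  -- Every edge outside S is closed up to a cycle through S.
  complete : ∀ (S : Fin m → Bool) (g : Fin m → Carrier) →
             (∀ e → S e ≡ false → g e ≈ ε ⊎ Connected S (s e) (t e)) →
             ∃[ f ] Flow f × (∀ e → S e ≡ false → f e ≈ g e)
  complete S g h = (λ e → sum λ i → proj₁ (cycle i) e)
    , (λ v → ≈-trans (∂-sum (proj₁ ∘ cycle) v) (sum-ε _ λ i → proj₁ (proj₂ (cycle i)) v))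
    , λ e e∉S → ≈-trans (sum-one _ e λ i e≢i → proj₁ (proj₂ (proj₂ (cycle i))) e e∉S (e≢i ∘ sym)) (proj₂ (proj₂ (proj₂ (cycle e))) e∉S)
    where
    cycle : ∀ e → ∃[ f ] Flow f × (∀ e′ → S e′ ≡ false → e ≢ e′ → f e′ ≈ ε) × (S e ≡ false → f e ≈ g e)
    cycle e with S e in eq
    ... | true = (λ _ → ε) , ∂-ε , (λ _ _ _ → ≈-refl) , λ ()
    ... | false with h e eq
    ...   | inj₁ ge≈ε = (λ _ → ε) , ∂-ε , (λ _ _ _ → ≈-refl) , λ _ → ≈-sym ge≈ε
    ...   | inj₂ p =
      let (f , f-off , ∂f) = route (reverse p) (g e)
      in (λ e′ → one e (g e) e′ ∙ f e′)
       , (λ v → ≈-trans (∂-∙ (one e (g e)) f v)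
           (≈-trans (∙-cong (∂-one e (g e) v) (∂f v)) (≈-trans (ends-trans (s e) (t e) (s e) (g e) v) (ends-self (s e) (g e) v))))
       , (λ e′ e′∉S e≢e′ → ≈-trans (∙-cong (≈-reflexive (one-≢ e≢e′)) (f-off e′ e′∉S)) (identityˡ ε))
       , λ _ → ≈-trans (∙-cong (≈-reflexive (one-self e (g e))) (f-off e eq)) (identityʳ _)

module FlowsOf {c ℓ} (Γ : AbelianGroup c ℓ) {n m : ℕ} (G : OrientedGraph n m) where
  open OrientedGraph G
  open AbelianGroup Γ renaming (refl to ≈-refl; sym to ≈-sym; trans to ≈-trans; reflexive to ≈-reflexive)
  open AbelianGroupProperties Γ
  open Sum commutativeMonoid
  open Boundary Γ initial terminal public

  private
    sumOver≈ : (p : Fin m → Fin n) (φ : Fin m → Carrier) (v : Fin n) →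
               sumOver Γ G (tabulate λ e → does (p e ≟ v)) φ ≈ sum λ e → at (p e) (φ e) v
    sumOver≈ p φ v = ≈-reflexive (sum-cong-≗ λ e → cong (λ b → if b then φ e else ε) (lookup∘tabulate _ e))

    ∂≈ : ∀ φ v → ∂ φ v ∙ sumOver Γ G (δ⁻ G v) φ ≈ sumOver Γ G (δ⁺ G v) φ
    ∂≈ φ v = begin
      ∂ φ v ∙ sumOver Γ G (δ⁻ G v) φ                             ≈⟨ ∙-congˡ (sumOver≈ terminal φ v) ⟩
      ∂ φ v ∙ sum (λ e → at (terminal e) (φ e) v)                ≈⟨ ∑-distrib-+ (λ e → ends (initial e) (terminal e) (φ e) v) (λ e → at (terminal e) (φ e) v) ⟨
      sum (λ e → ends (initial e) (terminal e) (φ e) v ∙ at (terminal e) (φ e) v)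
                                                                 ≈⟨ sum-cong-≋ (λ e → //-rightDividesˡ (at (terminal e) (φ e) v) (at (initial e) (φ e) v)) ⟩
      sum (λ e → at (initial e) (φ e) v)                         ≈⟨ sumOver≈ initial φ v ⟨
      sumOver Γ G (δ⁺ G v) φ                                     ∎
      where open import Relation.Binary.Reasoning.Setoid setoid

  Flow⇒IsFlow : ∀ φ → Flow φ → IsFlow Γ G φ
  Flow⇒IsFlow φ p v = ≈-trans (≈-sym (∂≈ φ v)) (≈-trans (∙-congʳ (p v)) (identityˡ _))

module _ {c ℓ c′ ℓ′} (Γ : AbelianGroup c ℓ) (Δ : AbelianGroup c′ ℓ′)
  {f : AbelianGroup.Carrier Γ → AbelianGroup.Carrier Δ}
  (f-hom : IsGroupHomomorphism (AbelianGroup.rawGroup Γ) (AbelianGroup.rawGroup Δ) f) where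
  private
    module Γ = AbelianGroup Γ
    module Δ = AbelianGroup Δ
  open IsGroupHomomorphism f-hom
  open Sum using (sum)

  sum-hom : (g : Fin k → Γ.Carrier) → f (sum Γ.commutativeMonoid g) Δ.≈ sum Δ.commutativeMonoid (f ∘ g)
  sum-hom {zero} g = ε-homo
  sum-hom {suc k} g = Δ.trans (homo _ _) (Δ.∙-congˡ (sum-hom (g ∘ suc)))

  module _ {n m} (s t : Fin m → Fin n) where
    private
      module BΓ = Boundary Γ s t
      module BΔ = Boundary Δ s t

    at-hom : ∀ u a v → f (BΓ.at u a v) Δ.≈ BΔ.at u (f a) v
    at-hom u a v with u == v
    ... | true = Δ.refl
    ... | false = ε-homo

    ∂-hom : ∀ φ v → f (BΓ.∂ φ v) Δ.≈ BΔ.∂ (f ∘ φ) v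
    ∂-hom φ v = Δ.trans (sum-hom λ e → BΓ.ends (s e) (t e) (φ e) v) (Sum.sum-cong-≋ Δ.commutativeMonoid λ e →
      Δ.trans (homo _ _) (Δ.∙-cong (at-hom (s e) (φ e) v)
        (Δ.trans (⁻¹-homo _) (Δ.⁻¹-cong (at-hom (t e) (φ e) v)))))

    Flow-hom : ∀ φ → BΓ.Flow φ → BΔ.Flow (f ∘ φ)
    Flow-hom φ p v = Δ.trans (Δ.sym (∂-hom φ v)) (Δ.trans (⟦⟧-cong (p v)) ε-homo)

-- Counting even subgraphs

filter-split : ∀ {A : Set} {p} {P : A → Set p} (P? : ∀ x → Dec (P x)) (L : List A) →
               length L ≡ length (filter P? L) + length (filter (¬? ∘ P?) L)
filter-split P? [] = refl
filter-split P? (x ∷ L) with P? x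
... | yes _ = cong suc (filter-split P? L)
... | no _ = trans (cong suc (filter-split P? L)) (sym (+-suc _ _))

Unique⇒lookup-injective : ∀ {A : Set} {L : List A} → Unique L → ∀ i j →
                          Data.List.Base.lookup L i ≡ Data.List.Base.lookup L j → i ≡ j
Unique⇒lookup-injective (_ ∷ u) 0F 0F eq = refl
Unique⇒lookup-injective (x∉L ∷ u) 0F (suc j) eq = ⊥-elim (All.lookup x∉L (∈-lookup j) eq)
Unique⇒lookup-injective (x∉L ∷ u) (suc i) 0F eq = ⊥-elim (All.lookup x∉L (∈-lookup i) (sym eq))
Unique⇒lookup-injective (_ ∷ u) (suc i) (suc j) eq = cong suc (Unique⇒lookup-injective u i j eq)

ℤ₂ : AbelianGroup Level.0ℓ Level.0ℓ
ℤ₂ = ℤ/ 2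

module BinaryVectors where
  open AbelianGroup ℤ₂ using (_∙_)

  infixl 6 _⊕_
  _⊕_ : Vec (Fin 2) k → Vec (Fin 2) k → Vec (Fin 2) k
  _⊕_ = zipWith _∙_

  ∙-involutive : ∀ a b → a ∙ (a ∙ b) ≡ b
  ∙-involutive = from-yes (all? λ a → all? λ b → a ∙ (a ∙ b) ≟ b)

  ⊕-involutive : (x y : Vec (Fin 2) k) → x ⊕ (x ⊕ y) ≡ y
  ⊕-involutive [] [] = refl
  ⊕-involutive (a ∷ x) (b ∷ y) = cong₂ _∷_ (∙-involutive a b) (⊕-involutive x y)

  ≢0+≢0≡0 : ∀ a b → a ≢ 0F → b ≢ 0F → a ∙ b ≡ 0F
  ≢0+≢0≡0 0F _ p _ = ⊥-elim (p refl)
  ≢0+≢0≡0 1F 0F _ q = ⊥-elim (q refl)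
  ≢0+≢0≡0 1F 1F _ _ = refl

  SupportedIn : (Fin k → Bool) → Vec (Fin 2) k → Set
  SupportedIn F x = ∀ e → F e ≡ false → lookup x e ≡ 0F

  SupportedIn-⊕ : ∀ (F : Fin k → Bool) {x y} → SupportedIn F x → SupportedIn F y → SupportedIn F (x ⊕ y)
  SupportedIn-⊕ F {x} {y} p q e e∉F = trans (lookup-zipWith _∙_ e x y) (cong₂ _∙_ (p e e∉F) (q e e∉F))

  vectors : (F : Fin k → Bool) → ∃[ L ] Unique L × All (SupportedIn F) L × length L ≡ 2 ^ # F
  vectors {zero} F = ([] ∷ []) , ([] ∷ []) , ((λ ()) ∷ []) , refl
  vectors {suc k} F with F zero in eq | vectors (F ∘ suc)
  ... | false | L , u , a , len = map (0F ∷_) L , Unique.map⁺ ∷-injectiveʳ u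
      , All.map⁺ (All.map (λ h → λ { zero _ → refl ; (suc e) → h e }) a) , trans (length-map _ L) len
  ... | true | L , u , a , len = map (0F ∷_) L ++ map (1F ∷_) L
      , Unique.++⁺ (Unique.map⁺ ∷-injectiveʳ u) (Unique.map⁺ ∷-injectiveʳ u) disjoint
      , All.++⁺ (All.map⁺ (All.map (extend 0F) a)) (All.map⁺ (All.map (extend 1F) a))
      , trans (length-++ (map (0F ∷_) L)) (trans (cong₂ _+_ (trans (length-map _ L) len) (trans (length-map _ L) len))
          (cong (2 ^ # (F ∘ suc) +_) (sym (+-identityʳ _))))
      where
      disjoint : ∀ {x} → ¬ (x ∈ map (0F ∷_) L × x ∈ map (1F ∷_) L)
      disjoint (p , q) with ∈-map⁻ (0F ∷_) p | ∈-map⁻ (1F ∷_) q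
      ... | _ , _ , refl | _ , _ , ()
      extend : ∀ b {x} → SupportedIn (F ∘ suc) x → SupportedIn F (b ∷ x)
      extend b h zero e∉F = false≢true e∉F eq
      extend b h (suc e) = h e

  ker? : (ℓ : Vec (Fin 2) k → Fin 2) (x : Vec (Fin 2) k) → Dec (ℓ x ≡ 0F)
  ker? ℓ x = ℓ x ≟ 0F

  -- If most vectors have ℓ ≠ 0, translate those by one of them.
  halve : (Q : Vec (Fin 2) k → Set) → (∀ {x y} → Q x → Q y → Q (x ⊕ y)) →
          (ℓ : Vec (Fin 2) k → Fin 2) → (∀ x y → ℓ (x ⊕ y) ≡ ℓ x ∙ ℓ y) →
          ∀ L → Unique L → All Q L →
          ∃[ L′ ] Unique L′ × All (λ x → Q x × ℓ x ≡ 0F) L′ × length L ≤ 2 * length L′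
  halve {k} Q Q-⊕ ℓ ℓ-⊕ L u a with length (filter (¬? ∘ ker? ℓ) L) ≤? length (filter (ker? ℓ) L)
  ... | yes p = filter (ker? ℓ) L , Unique.filter⁺ (ker? ℓ) u
      , All.zip (All.filter⁺ (ker? ℓ) a , All.all-filter (ker? ℓ) L)
      , (begin
          length L                                                  ≡⟨ filter-split (ker? ℓ) L ⟩
          length (filter (ker? ℓ) L) + length (filter (¬? ∘ ker? ℓ) L)    ≤⟨ +-monoʳ-≤ _ p ⟩
          length (filter (ker? ℓ) L) + length (filter (ker? ℓ) L)           ≡⟨ cong (length (filter (ker? ℓ) L) +_) (+-identityʳ _) ⟨
          2 * length (filter (ker? ℓ) L)                                ∎)
    where open ≤-Reasoning
  ... | no ¬p with filter (¬? ∘ ker? ℓ) L in eq | All.filter⁺ (¬? ∘ ker? ℓ) a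
                 | All.all-filter (¬? ∘ ker? ℓ) L | Unique.filter⁺ (¬? ∘ ker? ℓ) u
  ...   | [] | _ | _ | _ = ⊥-elim (¬p z≤n)
  ...   | x₀ ∷ M | q₀ ∷ q | p₀ ∷ p | uM = map (x₀ ⊕_) (x₀ ∷ M)
        , Unique.map⁺ (λ {x} {y} e → trans (sym (⊕-involutive x₀ x)) (trans (cong (x₀ ⊕_) e) (⊕-involutive x₀ y))) uM
        , All.map⁺ (All.map (λ {x} (qx , px) → Q-⊕ q₀ qx , trans (ℓ-⊕ x₀ x) (≢0+≢0≡0 _ _ p₀ px)) (All.zip (q₀ ∷ q , p₀ ∷ p)))
        , (begin
          length L                                     ≡⟨ filter-split (ker? ℓ) L ⟩
          length (filter (ker? ℓ) L) + length (filter (¬? ∘ ker? ℓ) L)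
                                                       ≤⟨ +-monoˡ-≤ _ (≰⇒≥ ¬p) ⟩
          length (x₀ ∷ M) + length (filter (¬? ∘ ker? ℓ) L)
                                                       ≡⟨ cong (λ N → length (x₀ ∷ M) + length N) eq ⟩
          length (x₀ ∷ M) + length (x₀ ∷ M)            ≡⟨ cong (length (x₀ ∷ M) +_) (+-identityʳ _) ⟨
          2 * length (x₀ ∷ M)                          ≡⟨ cong (2 *_) (length-map (x₀ ⊕_) (x₀ ∷ M)) ⟨
          2 * length (map (x₀ ⊕_) (x₀ ∷ M))            ∎)
    where open ≤-Reasoning

  module _ {n m} (s t : Fin m → Fin n) where
    open Boundary ℤ₂ s t

    -- Each vertex condition is a ℤ₂-linear form and costs at most a factor 2 by `halve`; this
    -- yields the usual dimension bound without bases or ranks.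
    evenSubgraphs : (F : Fin m → Bool) (vs : List (Fin n)) →
      ∃[ L ] Unique L × All (λ x → SupportedIn F x × All (λ v → ∂ (lookup x) v ≡ 0F) vs) L
           × 2 ^ # F ≤ 2 ^ length vs * length L
    evenSubgraphs F [] = let (L , u , a , len) = vectors F in
      L , u , All.map (_, []) a , ≤-reflexive (trans (sym len) (sym (*-identityˡ _)))
    evenSubgraphs F (v ∷ vs) =
      let (L , u , a , len) = evenSubgraphs F vs
          (L′ , u′ , a′ , len′) = halve Q (λ {x} {y} → Q-⊕ {x} {y}) (λ x → ∂ (lookup x) v) (∂-⊕ v) L u a
      in L′ , u′ , All.map (λ ((p , q) , r) → p , r ∷ q) a′ , (begin
        2 ^ # F                                 ≤⟨ len ⟩
        2 ^ length vs * length L                ≤⟨ *-monoʳ-≤ (2 ^ length vs) len′ ⟩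
        2 ^ length vs * (2 * length L′)         ≡⟨ *-assoc (2 ^ length vs) 2 _ ⟨
        2 ^ length vs * 2 * length L′           ≡⟨ cong (_* length L′) (*-comm (2 ^ length vs) 2) ⟩
        2 ^ length (v ∷ vs) * length L′         ∎)
      where
      open ≤-Reasoning
      ∂-⊕ : ∀ v x y → ∂ (lookup (x ⊕ y)) v ≡ ∂ (lookup x) v ∙ ∂ (lookup y) v
      ∂-⊕ v x y = trans (∂-cong (λ e → lookup-zipWith _∙_ e x y) v) (∂-∙ (lookup x) (lookup y) v)
      Q : Vec (Fin 2) m → Set
      Q x = SupportedIn F x × All (λ v → ∂ (lookup x) v ≡ 0F) vs
      Q-⊕ : ∀ {x y} → Q x → Q y → Q (x ⊕ y)
      Q-⊕ {x} {y} (p , q) (p′ , q′) = SupportedIn-⊕ F {x} {y} p p′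
        , All.map (λ {v} (z , z′) → trans (∂-⊕ v x y) (cong₂ _∙_ z z′)) (All.zip (q , q′))

module _ {c ℓ} (Γ : AbelianGroup c ℓ) {n m} (G : OrientedGraph n m) where
  open OrientedGraph G
  open AbelianGroup Γ renaming (refl to ≈-refl; sym to ≈-sym; trans to ≈-trans)
  open AbelianGroupProperties Γ using (∙-cancelˡ)
  open FlowsOf Γ G

  -- `h` embeds ℤ₂ as a subgroup of order two, so even subgraphs become flows that can be added to
  -- `φ`. Cancelling `φ` and the injectivity of `h` keep the sums distinct; the factor `2 ^ n` pays
  -- for the `n` vertex conditions.
  manyFlows : (h : Fin 2 → Carrier) → IsGroupHomomorphism (AbelianGroup.rawGroup ℤ₂) rawGroup h →
              (∀ {a b} → h a ≈ h b → a ≡ b) →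
              (φ : Fin m → Carrier) → Flow φ → (F : Fin m → Bool) →
              (∀ e → F e ≡ true → ∀ a → ¬ (φ e ∙ h a ≈ ε)) →
              (∀ e → F e ≡ false → ¬ (φ e ≈ ε)) →
              ∃[ N ] 2 ^ # F ≤ N * 2 ^ n × HasAtLeast (NowhereZeroFlows Γ G) N
  manyFlows h h-hom h-injective φ φ-flow F nz∈ nz∉ =
    let (L , u , a , len) = BinaryVectors.evenSubgraphs initial terminal F (allFin n)
        even = λ i → All.lookup a (∈-lookup i)
    in length L
     , ≤-trans len (≤-reflexive (trans (cong (λ k → 2 ^ k * length L) (length-tabulate {n = n} id)) (*-comm (2 ^ n) (length L))))
     , record
       { to = λ i → let x = Data.List.Base.lookup L i in
             (λ e → φ e ∙ h (lookup x e))
           , Flow⇒IsFlow _ (Flow-∙ φ (h ∘ lookup x) φ-flow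
               (Flow-hom ℤ₂ Γ h-hom initial terminal (lookup x) λ v → All.lookup (proj₂ (even i)) (∈-allFin v)))
           , nonzero (lookup x) (proj₁ (even i))
       ; cong = λ { refl e → ≈-refl }
       ; injective = λ {i} {j} eq → Unique⇒lookup-injective u i j
           (lookup-ext λ e → h-injective (∙-cancelˡ (φ e) _ _ (eq e)))
       }
    where
    open IsGroupHomomorphism h-hom using (ε-homo)
    lookup-ext : ∀ {k} {x y : Vec (Fin 2) k} → (∀ e → lookup x e ≡ lookup y e) → x ≡ y
    lookup-ext {x = []} {[]} eq = refl
    lookup-ext {x = a ∷ x} {b ∷ y} eq = cong₂ _∷_ (eq zero) (lookup-ext (eq ∘ suc))
    nonzero : ∀ x → (∀ e → F e ≡ false → x e ≡ 0F) → ∀ e → ¬ (φ e ∙ h (x e) ≈ ε)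
    nonzero x x∉F e p with F e in eq
    ... | true = nz∈ e eq (x e) p
    ... | false = nz∉ e eq (≈-trans (≈-sym (identityʳ _)) (≈-trans (∙-congˡ (≈-sym ε-homo))
                    (subst (λ b → φ e ∙ h b ≈ ε) (x∉F e eq) p)))

-- Packing two connected spanning edge sets

module _ {n m : ℕ} where

  -- Splitting off and contraction both keep the edge set and change only the ends of edges; this
  -- carries walks back to the original ends.
  liftConnected : ∀ {s t s′ t′ : Fin m → Fin n} {B B′} →
                  (∀ e → B′ e ≡ true → Edges.Connected s t B (s′ e) (t′ e)) →
                  ∀ {u v} → Edges.Connected s′ t′ B′ u v → Edges.Connected s t B u v
  liftConnected h Edges.here = Edges.here
  liftConnected h (Edges.step e e∈B (inj₁ (refl , refl)) p) = Edges._◅◅_ _ _ (h e e∈B) (liftConnected h p)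
  liftConnected h (Edges.step e e∈B (inj₂ (refl , refl)) p) =
    Edges._◅◅_ _ _ (Edges.reverse _ _ (h e e∈B)) (liftConnected h p)

  Connects : (s t : Fin m → Fin n) → (Fin m → Bool) → (Fin n → Bool) → Set
  Connects s t B Y = ∀ {u w} → Y u ≡ true → Y w ≡ true → Edges.Connected s t B u w

  record Packing (s t : Fin m → Fin n) (A : Fin m → Bool) (Y : Fin n → Bool) : Set where
    field
      A₁ A₂ : Fin m → Bool
      A₁⊆A : A₁ ⊆ A
      A₂⊆A : A₂ ⊆ A
      disjoint : ∀ e → A₁ e ≡ true → A₂ e ≡ false
      connects₁ : Connects s t A₁ Y
      connects₂ : Connects s t A₂ Y

  Packing-swap : ∀ {s t A Y} → Packing s t A Y → Packing s t A Y
  Packing-swap P = record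
    { A₁ = A₂ ; A₂ = A₁ ; A₁⊆A = A₂⊆A ; A₂⊆A = A₁⊆A
    ; disjoint = λ e p → ¬-not λ q → false≢true (disjoint e q) p
    ; connects₁ = connects₂ ; connects₂ = connects₁ }
    where open Packing P

  module _ (s t : Fin m → Fin n) (A : Fin m → Bool) where
    open Edges s t

    ι : (Fin n → Bool) → ℕ
    ι X = # λ e → A e ∧ inside X e

    -- The (2,2)-sparsity count, required of nonempty sets only; on singletons it excludes loops.
    Sparse : (Fin n → Bool) → Set
    Sparse Y = ∀ X {u} → X ⊆ Y → X u ≡ true → 2 + ι X ≤ 2 * # X

    ι-cong : ∀ {X Z} → X ≗ Z → ι X ≡ ι Z
    ι-cong h = #-cong λ e → cong (A e ∧_) (cong₂ _∧_ (h (s e)) (h (t e)))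

    -- An edge inside `X` or `Z` is inside the union, and inside the intersection as well if it is
    -- inside both. Edges joining the two differences only help the right side.
    ι-submodular : ∀ X Z → ι X + ι Z ≤ ι (λ v → X v ∨ Z v) + ι (λ v → X v ∧ Z v)
    ι-submodular X Z = #+#≤#+# _ _ _ _ λ e → pointwise (A e) (X (s e)) (X (t e)) (Z (s e)) (Z (t e))
      where
      pointwise : ∀ a p q p′ q′ → bit (a ∧ (p ∧ q)) + bit (a ∧ (p′ ∧ q′))
                  ≤ bit (a ∧ ((p ∨ p′) ∧ (q ∨ q′))) + bit (a ∧ ((p ∧ p′) ∧ (q ∧ q′)))
      pointwise false _ _ _ _ = z≤n
      pointwise true false q false q′ = z≤n
      pointwise true false false true false = z≤n
      pointwise true false true true false = z≤n
      pointwise true false false true true = ≤-refl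
      pointwise true false true true true = ≤-refl
      pointwise true true false false q′ = z≤n
      pointwise true true true false false = ≤-refl
      pointwise true true true false true = ≤-refl
      pointwise true true false true false = z≤n
      pointwise true true false true true = ≤-refl
      pointwise true true true true false = ≤-refl
      pointwise true true true true true = ≤-refl

  extendConnects : ∀ {s t B Y v x} e → B e ≡ true → Edges.Joins s t e v x → (Y ∖ v) x ≡ true →
                   Connects s t B (Y ∖ v) → Connects s t B Y
  extendConnects {s} {t} {B} {Y} {v} {x} e e∈B j x∈Y c {u} {w} u∈Y w∈Y = toward u u∈Y ◅◅ reverse (toward w w∈Y)
    where
    open Edges s t
    toward : ∀ u → Y u ≡ true → Connected B u x
    toward u u∈Y with v ≟ u
    ... | yes refl = edge e e∈B j
    ... | no v≢u = c (∖⁺ Y u∈Y v≢u) x∈Y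

-- Henneberg's reductions of tight graphs

module _ {n m : ℕ} where

  module Star (s t : Fin m → Fin n) (A : Fin m → Bool) (Y : Fin n → Bool)
              (A⊆Y : A ⊆ Edges.inside s t Y) (sparse : Sparse s t A Y) (v : Fin n) (v∈Y : Y v ≡ true) where
    open Edges s t

    Y′ : Fin n → Bool
    Y′ = Y ∖ v

    star rest : Fin m → Bool
    star e = A e ∧ ((s e == v) ∨ (t e == v))
    rest e = A e ∧ not ((s e == v) ∨ (t e == v))

    Y′⊆Y : Y′ ⊆ Y
    Y′⊆Y w p = proj₁ (∖⁻ Y v p)

    -- A loop would give the singleton of `s e` an inside edge, where sparsity allows none.
    loopless : ∀ e → A e ≡ true → s e ≢ t e
    loopless e e∈A s≡t = <⇒≱ bound (sparse (s e ==_) (λ w p → subst (λ x → Y x ≡ true) (==⇒≡ p) (proj₁ (∧-true⁻ (A⊆Y e e∈A)))) (==-refl (s e)))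
      where
      bound : 2 * # (s e ==_) < 2 + ι s t A (s e ==_)
      bound = subst (λ c → 2 * c < 2 + ι s t A (s e ==_)) (sym (#-== (s e)))
        (s≤s (s≤s (#-pos⁻ _ {e} (∧-true e∈A (∧-true (==-refl (s e)) (subst (λ x → (s e == x) ≡ true) s≡t (==-refl (s e))))))))

    degree≡#star : degree A v ≡ # star
    degree≡#star = sumℕ-cong pointwise
      where
      pointwise : ∀ e → bit (A e ∧ (s e == v)) + bit (A e ∧ (t e == v)) ≡ bit (star e)
      pointwise e with A e in e∈A
      ... | false = refl
      ... | true with s e ≟ v | t e ≟ v
      ...   | yes p | yes q = ⊥-elim (loopless e e∈A (trans p (sym q)))
      ...   | yes p | no q = refl
      ...   | no p | yes q = refl
      ...   | no p | no q = refl

    #A≡ : # A ≡ # star + # rest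
    #A≡ = #≡#+# A star rest λ e → pointwise (A e) _
      where
      pointwise : ∀ a b → bit a ≡ bit (a ∧ b) + bit (a ∧ not b)
      pointwise false b = refl
      pointwise true false = refl
      pointwise true true = refl

    star⇒Joins : ∀ e → star e ≡ true → ∃[ x ] Joins e v x × Y′ x ≡ true
    star⇒Joins e p with ∧-true⁻ {A e} p
    ... | e∈A , q with ∧-true⁻ (A⊆Y e e∈A) | ∨-true⁻ {s e == v} q
    ...   | se , te | inj₁ r = t e , inj₁ (==⇒≡ r , refl) , ∖⁺ Y te λ w → loopless e e∈A (trans (==⇒≡ r) w)
    ...   | se , te | inj₂ r = s e , inj₂ (refl , ==⇒≡ r) , ∖⁺ Y se λ w → loopless e e∈A (trans (sym w) (sym (==⇒≡ r)))

    Joins⇒∉rest : ∀ {e x} → Joins e v x → rest e ≡ false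
    Joins⇒∉rest {e} (inj₁ (refl , _)) rewrite ==-refl v with A e
    ... | true = refl
    ... | false = refl
    Joins⇒∉rest {e} (inj₂ (_ , refl)) rewrite ==-refl v with A e | s e == v
    ... | true | true = refl
    ... | true | false = refl
    ... | false | _ = refl

    rest⊆A : rest ⊆ A
    rest⊆A e p = proj₁ (∧-true⁻ p)

    rest⊆Y′ : rest ⊆ inside Y′
    rest⊆Y′ e p =
      let (e∈A , q) = ∧-true⁻ {A e} p
          (se , te) = ∧-true⁻ (A⊆Y e e∈A)
          (s≢v , t≢v) = nor⁻ {s e == v} q
      in ∧-true (∖⁺ Y se (==⇒≢ s≢v ∘ sym)) (∖⁺ Y te (==⇒≢ t≢v ∘ sym))

    2+#rest≤ : ∀ {w} → Y′ w ≡ true → 2 + # rest ≤ 2 * # Y′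
    2+#rest≤ w∈Y′ = ≤-trans (+-monoʳ-≤ 2 (#-mono λ e p → ∧-true (rest⊆A e p) (rest⊆Y′ e p))) (sparse Y′ Y′⊆Y w∈Y′)

    -- The vertex `v` hangs as a leaf on both sets, by one edge each.
    attachTwo : ∀ {e₁ e₂} → star e₁ ≡ true → star e₂ ≡ true → e₁ ≢ e₂ → Packing s t rest Y′ → Packing s t A Y
    attachTwo {e₁} {e₂} p₁ p₂ e₁≢e₂ P =
      let (x₁ , j₁ , x₁∈) = star⇒Joins e₁ p₁
          (x₂ , j₂ , x₂∈) = star⇒Joins e₂ p₂
      in record
      { A₁ = insert e₁ A₁
      ; A₂ = insert e₂ A₂
      ; A₁⊆A = λ e p → [ (λ q → rest⊆A e (A₁⊆A e q)) , (λ { refl → proj₁ (∧-true⁻ p₁) }) ]′ (insert⁻ e₁ A₁ p)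
      ; A₂⊆A = λ e p → [ (λ q → rest⊆A e (A₂⊆A e q)) , (λ { refl → proj₁ (∧-true⁻ p₂) }) ]′ (insert⁻ e₂ A₂ p)
      ; disjoint = λ e p → ¬-not λ q → case insert⁻ e₁ A₁ p , insert⁻ e₂ A₂ q of λ
        { (inj₁ a , inj₁ b) → false≢true (disjoint e a) b
        ; (inj₁ a , inj₂ refl) → false≢true (Joins⇒∉rest j₂) (A₁⊆A e a)
        ; (inj₂ refl , inj₁ b) → false≢true (Joins⇒∉rest j₁) (A₂⊆A e b)
        ; (inj₂ refl , inj₂ refl) → e₁≢e₂ refl }
      ; connects₁ = extendConnects e₁ (insert-self e₁ A₁) j₁ x₁∈ (λ p q → Connected-mono (λ e → ∨-trueˡ) (connects₁ p q))
      ; connects₂ = extendConnects e₂ (insert-self e₂ A₂) j₂ x₂∈ (λ p q → Connected-mono (λ e → ∨-trueˡ) (connects₂ p q))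
      }
      where open Packing P

    module Split {e₁ e₂ e₃ a b} (p₁ : star e₁ ≡ true) (p₂ : star e₂ ≡ true) (p₃ : star e₃ ≡ true)
                 (e₁≢e₂ : e₁ ≢ e₂) (e₁≢e₃ : e₁ ≢ e₃) (e₂≢e₃ : e₂ ≢ e₃)
                 (j₁ : Joins e₁ v a) (j₂ : Joins e₂ v b) (a∈Y′ : Y′ a ≡ true) (b∈Y′ : Y′ b ≡ true) where

      -- Henneberg's reduction: v is removed, and e₁ redirected to join two of its neighbours.
      s′ t′ : Fin m → Fin n
      s′ e = if e₁ == e then a else s e
      t′ e = if e₁ == e then b else t e

      A′ : Fin m → Bool
      A′ = insert e₁ rest

      A′⊆Y′ : A′ ⊆ Edges.inside s′ t′ Y′
      A′⊆Y′ e p with e₁ ≟ e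
      ... | yes refl = ∧-true a∈Y′ b∈Y′
      ... | no _ = rest⊆Y′ e (trans (sym (∨-identityʳ _)) p)

      #A′ : # A′ ≡ suc (# rest)
      #A′ = #-insert e₁ rest (Joins⇒∉rest j₁)

      ι-split : ∀ X → ι s′ t′ A′ X ≤ bit (X a ∧ X b) + ι s t A X
      ι-split X = ≤-trans (≤-trans (sumℕ-mono pointwise) (≤-reflexive (#-+# (λ e → (e₁ == e) ∧ (X a ∧ X b)) (λ e → A e ∧ inside X e))))
                    (+-monoˡ-≤ _ (≤-reflexive (only (X a ∧ X b))))
        where
        only : ∀ c → # (λ e → (e₁ == e) ∧ c) ≡ bit c
        only true = trans (#-cong {f = λ e → (e₁ == e) ∧ true} λ e → ∧-identityʳ _) (#-== e₁)
        only false = #-none {m} _ λ e → ∧-zeroʳ _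
        pointwise : ∀ e → bit (A′ e ∧ Edges.inside s′ t′ X e) ≤ bit ((e₁ == e) ∧ (X a ∧ X b)) + bit (A e ∧ inside X e)
        pointwise e with e₁ ≟ e
        ... | yes refl = ≤-trans (bit-mono λ r → proj₂ (∧-true⁻ {rest e ∨ true} r)) (m≤m+n _ _)
        ... | no _ = bit-mono λ r → let (x , y) = ∧-true⁻ {rest e ∨ false} r in
                       ∧-true (rest⊆A e (trans (sym (∨-identityʳ _)) x)) y

      -- Only sets containing both `a` and `b` gain the redirected edge, so one unit of slack is
      -- asked of exactly these.
      sparse′ : (∀ X → X ⊆ Y′ → X a ≡ true → X b ≡ true → 3 + ι s t A X ≤ 2 * # X) → Sparse s′ t′ A′ Y′
      sparse′ open′ X X⊆Y′ x∈X with X a ∧ X b in eq | ι-split X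
      ... | false | le = ≤-trans (+-monoʳ-≤ 2 le) (sparse X (λ w → Y′⊆Y w ∘ X⊆Y′ w) x∈X)
      ... | true | le = let (p , q) = ∧-true⁻ eq in ≤-trans (+-monoʳ-≤ 2 le) (open′ X X⊆Y′ p q)

      -- The redirected `e₁` stands for the path from `a` over `v` to `b`. The set that may use it
      -- receives both `e₁` and `e₂`, and the other one reaches `v` through `e₃`. This also covers
      -- the case in which neither set uses the redirected edge.
      rebuild : (P : Packing s′ t′ A′ Y′) → Packing.A₂ P e₁ ≡ false → Packing s t A Y
      rebuild P e₁∉A₂ = let (x₃ , j₃ , x₃∈) = star⇒Joins e₃ p₃ in record
       { A₁ = B₁
       ; A₂ = B₂
       ; A₁⊆A = λ e p → case insert⁻ e₂ (insert e₁ A₁) p of λ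
           { (inj₂ refl) → proj₁ (∧-true⁻ p₂)
           ; (inj₁ q) → case insert⁻ e₁ A₁ q of λ
             { (inj₂ refl) → proj₁ (∧-true⁻ p₁)
             ; (inj₁ r) → old (A₁⊆A e r) } }
       ; A₂⊆A = λ e p → [ (λ r → old (A₂⊆A e r)) , (λ { refl → proj₁ (∧-true⁻ p₃) }) ]′ (insert⁻ e₃ A₂ p)
       ; disjoint = λ e p → ¬-not λ q → disj e (insert⁻ e₂ (insert e₁ A₁) p) (insert⁻ e₃ A₂ q) j₃
       ; connects₁ = extendConnects e₁ e₁∈B₁ j₁ a∈Y′ λ p q → liftConnected lift₁ (connects₁ p q)
       ; connects₂ = extendConnects e₃ (insert-self e₃ A₂) j₃ x₃∈ λ p q → liftConnected lift₂ (connects₂ p q)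
       }
       where
       open Packing P
       B₁ B₂ : Fin m → Bool
       B₁ = insert e₂ (insert e₁ A₁)
       B₂ = insert e₃ A₂
       e₁∈B₁ : B₁ e₁ ≡ true
       e₁∈B₁ = ∨-trueˡ (insert-self e₁ A₁)
       old : ∀ {e} → A′ e ≡ true → A e ≡ true
       old {e} p = [ rest⊆A e , (λ { refl → proj₁ (∧-true⁻ p₁) }) ]′ (insert⁻ e₁ rest p)
       notStar : ∀ {e x} → Joins e v x → e₁ ≢ e → A′ e ≡ true → ⊥
       notStar j e₁≢e p = [ false≢true (Joins⇒∉rest j) , e₁≢e ]′ (insert⁻ e₁ rest p)
       disj : ∀ e {x} → insert e₁ A₁ e ≡ true ⊎ e₂ ≡ e → A₂ e ≡ true ⊎ e₃ ≡ e → Joins e₃ v x → ⊥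
       disj e (inj₂ refl) (inj₂ refl) _ = e₂≢e₃ refl
       disj e (inj₂ refl) (inj₁ q) _ = notStar j₂ e₁≢e₂ (A₂⊆A e q)
       disj e (inj₁ p) q j₃ with insert⁻ e₁ A₁ p | q
       ... | inj₂ refl | inj₁ r = false≢true e₁∉A₂ r
       ... | inj₂ refl | inj₂ refl = e₁≢e₃ refl
       ... | inj₁ r | inj₁ r′ = false≢true (disjoint e r) r′
       ... | inj₁ r | inj₂ refl = notStar j₃ e₁≢e₃ (A₁⊆A e r)
       lift₁ : ∀ e → A₁ e ≡ true → Connected B₁ (s′ e) (t′ e)
       lift₁ e p with e₁ ≟ e
       ... | yes refl = step e₁ e₁∈B₁ (Joins-sym j₁) (edge e₂ (insert-self e₂ (insert e₁ A₁)) j₂)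
       ... | no _ = edge e (∨-trueˡ (∨-trueˡ p)) (inj₁ (refl , refl))
       lift₂ : ∀ e → A₂ e ≡ true → Connected B₂ (s′ e) (t′ e)
       lift₂ e p with e₁ ≟ e
       ... | yes refl = false≢true e₁∉A₂ p
       ... | no _ = edge e (∨-trueˡ p) (inj₁ (refl , refl))

      restore : Packing s′ t′ A′ Y′ → Packing s t A Y
      restore P with Packing.A₂ P e₁ in eq
      ... | false = rebuild P eq
      ... | true = rebuild (Packing-swap P) (¬-not λ q → false≢true (Packing.disjoint P e₁ q) eq)

    -- A tight set containing `a` and `b` leaves no room for a new edge between them. If `e₁` and
    -- `e₂` are parallel, so that `a = b`, the singleton of `a` is blocking, which prevents the
    -- creation of a loop.
    Blocked : Fin n → Fin n → (Fin n → Bool) → Set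
    Blocked a b X = X ⊆ Y′ × X a ≡ true × X b ≡ true × 2 * # X ≤ 2 + ι s t A X

    blocked? : ∀ a b → Dec (∃ (Blocked a b))
    blocked? a b = search (Blocked a b)
      (λ X → all? (λ w → (X w ≟ᵇ true) →-dec (Y′ w ≟ᵇ true)) ×-dec (X a ≟ᵇ true) ×-dec (X b ≟ᵇ true) ×-dec (2 * # X ≤? 2 + ι s t A X))
      λ {f} {g} f≗g (p , q , r , le) → (λ w x → p w (trans (f≗g w) x)) , trans (sym (f≗g a)) q , trans (sym (f≗g b)) r
        , (let open ≤-Reasoning in begin
            2 * # g           ≡⟨ cong (2 *_) (#-cong f≗g) ⟨
            2 * # f           ≤⟨ le ⟩
            2 + ι s t A f     ≡⟨ cong (2 +_) (ι-cong s t A f≗g) ⟩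
            2 + ι s t A g     ∎)

    unblocked : ∀ {a b} → ¬ ∃ (Blocked a b) → ∀ X → X ⊆ Y′ → X a ≡ true → X b ≡ true → 3 + ι s t A X ≤ 2 * # X
    unblocked ¬p X p q r = ≰⇒> λ le → ¬p (X , p , q , r , le)

    -- The union of two blocking sets, with v added, would span too many edges.
    notBothBlocked : ∀ {a b c} → # star ≡ 3 →
                     (∀ e → star e ≡ true → Joins e v a ⊎ Joins e v b ⊎ Joins e v c) →
                     ∃ (Blocked a b) → ¬ ∃ (Blocked a c)
    notBothBlocked {a} {b} {c} #star≡3 star⊆ (X , X⊆ , Xa , Xb , Xle) (Z , Z⊆ , Za , Zc , Zle) =
      <⇒≱ (s≤s ineq) (≤-trans (sparse (insert v U) U+v⊆Y (insert-self v U)) (≤-reflexive (cong (2 *_) #U+v)))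
      where
      U I : Fin n → Bool
      U w = X w ∨ Z w
      I w = X w ∧ Z w
      U⊆Y′ : U ⊆ Y′
      U⊆Y′ w p = [ X⊆ w , Z⊆ w ]′ (∨-true⁻ p)
      U+v⊆Y : insert v U ⊆ Y
      U+v⊆Y w p = [ (λ q → Y′⊆Y w (U⊆Y′ w q)) , (λ { refl → v∈Y }) ]′ (insert⁻ v U p)
      v∉U : U v ≡ false
      v∉U = ¬-not λ p → false≢true (∖-removed Y v) (U⊆Y′ v p)
      #U+v : # (insert v U) ≡ suc (# U)
      #U+v = #-insert v U v∉U
      otherEnd : ∀ e → star e ≡ true → ∃[ x ] Joins e v x × U x ≡ true
      otherEnd e p with star⊆ e p
      ... | inj₁ j = a , j , ∨-trueˡ Xa
      ... | inj₂ (inj₁ j) = b , j , ∨-trueˡ Xb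
      ... | inj₂ (inj₂ j) = c , j , ∨-trueʳ {X c} Zc
      ι-U+v : # star + ι s t A U ≤ ι s t A (insert v U)
      ι-U+v = ≤-trans (≤-reflexive (sym (#-+# star (λ e → A e ∧ inside U e)))) (sumℕ-mono pointwise)
        where
        grow : ∀ e → A e ∧ inside U e ≡ true → A e ∧ inside (insert v U) e ≡ true
        grow e p = let (e∈A , q) = ∧-true⁻ {A e} p ; (x , y) = ∧-true⁻ {U (s e)} q in ∧-true e∈A (∧-true (∨-trueˡ x) (∨-trueˡ y))
        apart : ∀ {e x} → Joins e v x → inside U e ≡ false
        apart {e} (inj₁ (refl , _)) rewrite v∉U = refl
        apart {e} (inj₂ (_ , refl)) rewrite v∉U = ∧-zeroʳ _
        pointwise : ∀ e → bit (star e) + bit (A e ∧ inside U e) ≤ bit (A e ∧ inside (insert v U) e)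
        pointwise e with star e in eq
        ... | false = bit-mono (grow e)
        ... | true with otherEnd e eq
        ...   | x , j , x∈U rewrite apart j | proj₁ (∧-true⁻ {A e} eq)
                | inside⁺ {insert v U} (insert-self v U) (∨-trueˡ x∈U) j = ≤-refl
      -- Both blocking sets contain `a`, so sparsity applies to their intersection, and
      -- submodularity makes the union tight. One more vertex leaves room for two more edges, but
      -- the star has three.
      ineq : 2 * suc (# U) ≤ 1 + ι s t A (insert v U)
      ineq = +-cancelʳ-≤ (2 * # I) _ _ (begin
        2 * suc (# U) + 2 * # I                ≡⟨ shape₁ (# U) (# I) ⟩
        2 + 2 * (# U + # I)                    ≡⟨ cong (λ x → 2 + 2 * x) (#-modular X Z) ⟨
        2 + 2 * (# X + # Z)                    ≡⟨ shape₂ (# X) (# Z) ⟩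
        2 + (2 * # X + 2 * # Z)                ≤⟨ +-monoʳ-≤ 2 (+-mono-≤ Xle Zle) ⟩
        2 + ((2 + ι s t A X) + (2 + ι s t A Z)) ≡⟨ shape₃ (ι s t A X) (ι s t A Z) ⟩
        6 + (ι s t A X + ι s t A Z)            ≤⟨ +-monoʳ-≤ 6 (ι-submodular s t A X Z) ⟩
        6 + (ι s t A U + ι s t A I)            ≡⟨ shape₄ (ι s t A U) (ι s t A I) ⟩
        1 + (3 + ι s t A U) + (2 + ι s t A I)  ≤⟨ +-mono-≤ (+-monoʳ-≤ 1 (subst (λ d → d + ι s t A U ≤ ι s t A (insert v U)) #star≡3 ι-U+v))
                                                    (sparse I (λ w p → Y′⊆Y w (X⊆ w (proj₁ (∧-true⁻ p)))) (∧-true Xa Za)) ⟩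
        1 + ι s t A (insert v U) + 2 * # I     ∎)
        where
        open ≤-Reasoning
        shape₁ : ∀ u i → 2 * suc u + 2 * i ≡ 2 + 2 * (u + i)
        shape₁ = solve-∀
        shape₂ : ∀ x z → 2 + 2 * (x + z) ≡ 2 + (2 * x + 2 * z)
        shape₂ = solve-∀
        shape₃ : ∀ x z → 2 + ((2 + x) + (2 + z)) ≡ 6 + (x + z)
        shape₃ = solve-∀
        shape₄ : ∀ u i → 6 + (u + i) ≡ 1 + (3 + u) + (2 + i)
        shape₄ = solve-∀

module _ {n m : ℕ} where

  TightPacking : ℕ → Set
  TightPacking k = ∀ (s t : Fin m → Fin n) A Y → A ⊆ Edges.inside s t Y → Sparse s t A Y →
                   # A + 2 ≡ 2 * # Y → # Y ≡ suc k → Packing s t A Y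

  module _ {k} (smaller : TightPacking k) (s t : Fin m → Fin n) (A : Fin m → Bool) (Y : Fin n → Bool)
           (A⊆Y : A ⊆ Edges.inside s t Y) (sparse : Sparse s t A Y) (tight : # A + 2 ≡ 2 * # Y)
           (#Y≡ : # Y ≡ suc (suc k)) (v : Fin n) (v∈Y : Y v ≡ true) where
    open Star s t A Y A⊆Y sparse v v∈Y
    open Edges s t

    #Y′ : # Y′ ≡ suc k
    #Y′ = suc-injective (trans (sym (#-∖ Y v∈Y)) #Y≡)

    star+rest : # star + # rest ≡ 2 * # Y′
    star+rest = +-cancelʳ-≡ 2 _ _ (begin
      # star + # rest + 2   ≡⟨ cong (_+ 2) #A≡ ⟨
      # A + 2               ≡⟨ tight ⟩
      2 * # Y               ≡⟨ cong (2 *_) (#-∖ Y v∈Y) ⟩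
      2 * suc (# Y′)        ≡⟨ *-suc 2 (# Y′) ⟩
      2 + 2 * # Y′          ≡⟨ +-comm 2 _ ⟩
      2 * # Y′ + 2          ∎)
      where open ≡-Reasoning

    -- By sparsity `rest` has at most 2|Y′| - 2 edges, while `star` and `rest` together have 2|Y′|.
    2≤#star : 2 ≤ # star
    2≤#star = let (w , w∈Y′) = #-pos Y′ (subst (1 ≤_) (sym #Y′) (s≤s z≤n)) in
      +-cancelʳ-≤ (# rest) 2 (# star) (≤-trans (2+#rest≤ w∈Y′) (≤-reflexive (sym star+rest)))

    restSparse : Sparse s t rest Y′
    restSparse X X⊆ x∈X = ≤-trans
      (+-monoʳ-≤ 2 (#-mono λ e p → let (q , r) = ∧-true⁻ {rest e} p in ∧-true (rest⊆A e q) r))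
      (sparse X (λ w → Y′⊆Y w ∘ X⊆ w) x∈X)

    reduce : ∀ d → # star ≡ d → d ≤ 3 → Packing s t A Y
    reduce 0 eq _ = ⊥-elim (<⇒≱ (s≤s z≤n) (subst (2 ≤_) eq 2≤#star))
    reduce 1 eq _ = ⊥-elim (<⇒≱ (s≤s (s≤s z≤n)) (subst (2 ≤_) eq 2≤#star))
    reduce 2 eq _ =
      let (e₁ , e₂ , p₁ , p₂ , e₁≢e₂) = #-two star 2≤#star
      in attachTwo p₁ p₂ e₁≢e₂ (smaller s t rest Y′ rest⊆Y′ restSparse
           (trans (+-comm (# rest) 2) (trans (cong (_+ # rest) (sym eq)) star+rest)) #Y′)
    reduce 3 eq _ =
      let (e₁ , p₁ , eq₁) = #-pick star eq
          (e₂ , q₂ , eq₂) = #-pick (star ∖ e₁) eq₁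
          (e₃ , q₃ , eq₃) = #-pick ((star ∖ e₁) ∖ e₂) eq₂
          (p₂ , e₁≢e₂) = ∖⁻ star e₁ q₂
          (q₃′ , e₂≢e₃) = ∖⁻ (star ∖ e₁) e₂ q₃
          (p₃ , e₁≢e₃) = ∖⁻ star e₁ q₃′
          (a , j₁ , a∈) = star⇒Joins e₁ p₁
          (b , j₂ , b∈) = star⇒Joins e₂ p₂
          (c , j₃ , c∈) = star⇒Joins e₃ p₃
          module S₁₂ = Split p₁ p₂ p₃ e₁≢e₂ e₁≢e₃ e₂≢e₃ j₁ j₂ a∈ b∈
          module S₁₃ = Split p₁ p₃ p₂ e₁≢e₃ e₁≢e₂ (e₂≢e₃ ∘ sym) j₁ j₃ a∈ c∈
          starJoins : ∀ e → star e ≡ true → Joins e v a ⊎ Joins e v b ⊎ Joins e v c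
          starJoins e p = case e₁ ≟ e of λ
            { (yes refl) → inj₁ j₁
            ; (no ≢₁) → case e₂ ≟ e of λ
              { (yes refl) → inj₂ (inj₁ j₂)
              ; (no ≢₂) → case e₃ ≟ e of λ
                { (yes refl) → inj₂ (inj₂ j₃)
                ; (no ≢₃) → ⊥-elim (<⇒≱ (#-pos⁻ (((star ∖ e₁) ∖ e₂) ∖ e₃)
                    (∖⁺ ((star ∖ e₁) ∖ e₂) (∖⁺ (star ∖ e₁) (∖⁺ star p ≢₁) ≢₂) ≢₃)) (≤-reflexive eq₃)) } } }
          tight′ : ∀ {x} → x ≡ suc (# rest) → x + 2 ≡ 2 * # Y′
          tight′ {x} x≡ = trans (cong (_+ 2) x≡) (trans (+-comm (suc (# rest)) 2) (trans (cong (_+ # rest) (sym eq)) star+rest))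
      -- If `a` and `b` are blocked, then `a` and `c` are not, so one of the two redirections of
      -- `e₁` keeps sparsity.
      in case blocked? a b of λ
        { (no ¬ab) → S₁₂.restore (smaller S₁₂.s′ S₁₂.t′ S₁₂.A′ Y′ S₁₂.A′⊆Y′ (S₁₂.sparse′ (unblocked ¬ab)) (tight′ S₁₂.#A′) #Y′)
        ; (yes ab) → S₁₃.restore (smaller S₁₃.s′ S₁₃.t′ S₁₃.A′ Y′ S₁₃.A′⊆Y′
                       (S₁₃.sparse′ (unblocked (notBothBlocked eq starJoins ab))) (tight′ S₁₃.#A′) #Y′) }
    reduce (suc (suc (suc (suc d)))) _ (s≤s (s≤s (s≤s ())))

  -- The degrees add up to 2|A| = 4|Y| - 4, less than 4 per vertex of `Y`. A vertex outside `Y`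
  -- cannot be the one found, as its degree would have to be below 0.
  lowDegree : ∀ (s t : Fin m → Fin n) A Y → # A + 2 ≡ 2 * # Y → ∃[ v ] Y v ≡ true × Edges.degree s t A v ≤ 3
  lowDegree s t A Y tight with sumℕ-< {f = Edges.degree s t A} {λ v → 4 * bit (Y v)} (begin-strict
      sumℕ (Edges.degree s t A)     ≡⟨ Edges.sum-degree s t A ⟩
      2 * # A                       <⟨ m<m+n (2 * # A) (s≤s (z≤n {3})) ⟩
      2 * # A + 4                   ≡⟨ *-distribˡ-+ 2 (# A) 2 ⟨
      2 * (# A + 2)                 ≡⟨ cong (2 *_) tight ⟩
      2 * (2 * # Y)                 ≡⟨ *-assoc 2 2 (# Y) ⟨
      4 * # Y                       ≡⟨ sumℕ-*ˡ 4 (bit ∘ Y) ⟨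
      sumℕ (λ v → 4 * bit (Y v))    ∎)
    where open ≤-Reasoning
  ... | v , lt with Y v in eq
  ...   | true = v , eq , s≤s⁻¹ lt

  tightPacking : ∀ k → TightPacking k
  tightPacking zero s t A Y A⊆Y sparse tight #Y≡1 = record
    { A₁ = λ _ → false ; A₂ = λ _ → false ; A₁⊆A = λ _ () ; A₂⊆A = λ _ () ; disjoint = λ _ ()
    ; connects₁ = trivial ; connects₂ = trivial }
    where
    trivial : Connects s t (λ _ → false) Y
    trivial {u} {w} u∈Y w∈Y with u ≟ w
    ... | yes refl = Edges.here
    ... | no u≢w = ⊥-elim (<⇒≱ (#-pos⁻ (Y ∖ u) (∖⁺ Y w∈Y u≢w)) (≤-reflexive (suc-injective (trans (sym (#-∖ Y u∈Y)) #Y≡1))))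
  tightPacking (suc k) s t A Y A⊆Y sparse tight #Y≡ =
    let (v , v∈Y , d≤3) = lowDegree s t A Y tight
    in reduce (tightPacking k) s t A Y A⊆Y sparse tight #Y≡ v v∈Y _ refl
         (subst (_≤ 3) (Star.degree≡#star s t A Y A⊆Y sparse v v∈Y) d≤3)

  -- Contracting packed vertex sets until one vertex remains

  module _ (s t : Fin m → Fin n) (cuts : Edges.CutsAtLeast s t 4) where

    -- The state of the packing after contracting along ρ; the fixed points of ρ are the vertices left.
    record Contraction : Set where
      field
        ρ : Fin n → Fin n
        idempotent : ∀ v → ρ (ρ v) ≡ ρ v
        B₁ B₂ : Fin m → Bool
        disjoint : ∀ e → B₁ e ≡ true → B₂ e ≡ false
        B₁-contracted : ∀ e → B₁ e ≡ true → ρ (s e) ≡ ρ (t e)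
        B₂-contracted : ∀ e → B₂ e ≡ true → ρ (s e) ≡ ρ (t e)
        connected₁ : ∀ v → Edges.Connected s t B₁ v (ρ v)
        connected₂ : ∀ v → Edges.Connected s t B₂ v (ρ v)

      Y : Fin n → Bool
      Y v = ρ v == v

      ρ∈Y : ∀ v → Y (ρ v) ≡ true
      ρ∈Y v = subst (λ x → (x == ρ v) ≡ true) (sym (idempotent v)) (==-refl (ρ v))

    module _ (C : Contraction) (2≤#Y : 2 ≤ # (Contraction.Y C)) where
      open Contraction C

      s′ t′ : Fin m → Fin n
      s′ = ρ ∘ s
      t′ = ρ ∘ t

      links : Fin m → Bool
      links e = not (s′ e == t′ e)

      -- The class of `v` under `ρ` is not everything, because `Y` has another element, so its cut
      -- has at least 4 edges; each of them is a link at `v`.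
      degree≥4 : ∀ v → 4 * bit (Y v) ≤ Edges.degree s′ t′ links v
      degree≥4 v with Y v in v∈Y
      ... | false = z≤n
      ... | true = let (w , w∈Y , v≢w) = #-other Y 2≤#Y v in
        ≤-trans (cuts (λ x → v == ρ x) {v} {w} (trans (==-sym v (ρ v)) v∈Y) (≢⇒== λ v≡ → v≢w (trans v≡ (==⇒≡ w∈Y))))
          (sumℕ-mono λ e → pointwise e)
        where
        pointwise : ∀ e → bit ((v == s′ e) xor (v == t′ e)) ≤ bit (links e ∧ (s′ e == v)) + bit (links e ∧ (t′ e == v))
        pointwise e rewrite ==-sym (s′ e) v | ==-sym (t′ e) v with s′ e ≟ t′ e
        ... | yes p rewrite p with v == t′ e
        ...   | true = z≤n
        ...   | false = z≤n
        pointwise e | no _ with v == s′ e | v == t′ e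
        ...   | true | true = z≤n
        ...   | true | false = ≤-refl
        ...   | false | true = ≤-refl
        ...   | false | false = z≤n

      #links : 2 * # Y ≤ # links
      #links = *-cancelˡ-≤ 2 (begin
        2 * (2 * # Y)                        ≡⟨ *-assoc 2 2 (# Y) ⟨
        4 * # Y                              ≡⟨ sumℕ-*ˡ 4 (bit ∘ Y) ⟨
        sumℕ (λ v → 4 * bit (Y v))           ≤⟨ sumℕ-mono degree≥4 ⟩
        sumℕ (Edges.degree s′ t′ links)      ≡⟨ Edges.sum-degree s′ t′ links ⟩
        2 * # links                          ∎)
        where open ≤-Reasoning

      -- The bound `2 ≤ # X` leaves out singletons, for which the inequality is trivial. `Y` is
      -- dense since every vertex of the contracted graph has degree at least 4.
      Dense : (Fin n → Bool) → Set
      Dense X = X ⊆ Y × 2 ≤ # X × 2 * # X ≤ 2 + ι s′ t′ links X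

      Dense? : ∀ X → Dec (Dense X)
      Dense? X = all? (λ w → (X w ≟ᵇ true) →-dec (Y w ≟ᵇ true)) ×-dec (2 ≤? # X) ×-dec (2 * # X ≤? 2 + ι s′ t′ links X)

      Dense-cong : ∀ {X Z} → X ≗ Z → Dense X → Dense Z
      Dense-cong {X} {Z} X≗Z (p , q , r) = (λ w z → p w (trans (X≗Z w) z)) , subst (2 ≤_) (#-cong X≗Z) q , (begin
        2 * # Z                    ≡⟨ cong (2 *_) (#-cong X≗Z) ⟨
        2 * # X                    ≤⟨ r ⟩
        2 + ι s′ t′ links X        ≡⟨ cong (2 +_) (ι-cong s′ t′ links X≗Z) ⟩
        2 + ι s′ t′ links Z        ∎)
        where open ≤-Reasoning

      Dense-Y : Dense Y
      Dense-Y = (λ _ p → p) , 2≤#Y , ≤-trans #links (≤-trans (#-mono λ e p → ∧-true p (∧-true (ρ∈Y (s e)) (ρ∈Y (t e)))) (m≤n+m _ 2))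

      packable : ∃[ X ] X ⊆ Y × 2 ≤ # X × Packing s′ t′ (λ e → links e ∧ Edges.inside s′ t′ X e) X
      packable with minimal Dense Dense? Dense-cong Y Dense-Y
      ... | X , (X⊆Y , 2≤#X , dense) , least = X , X⊆Y , 2≤#X , record
          { A₁ = A₁ ; A₂ = A₂ ; A₁⊆A = λ e p → A⊆F e (A₁⊆A e p) ; A₂⊆A = λ e p → A⊆F e (A₂⊆A e p)
          ; disjoint = disj ; connects₁ = connects₁ ; connects₂ = connects₂ }
        where
        F : Fin m → Bool
        F e = links e ∧ Edges.inside s′ t′ X e
        d≤ : 2 * # X ∸ 2 ≤ # F
        d≤ = ≤-trans (∸-monoˡ-≤ 2 dense) (≤-reflexive (m+n∸m≡n 2 _))
        -- Keeping exactly 2|X| - 2 links gives tightness. For sparsity, sets as large as `X` are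
        -- bounded by this total, smaller ones with at least two elements by the minimality of `X`,
        -- and singletons by the absence of loops among links.
        chosen : ∃[ A ] A ⊆ F × # A ≡ 2 * # X ∸ 2
        chosen = subsetOfSize F (# F ∸ (2 * # X ∸ 2)) _ (sym (m∸n+n≡m d≤))
        A = proj₁ chosen
        A⊆F = proj₁ (proj₂ chosen)
        tight : # A + 2 ≡ 2 * # X
        tight = trans (cong (_+ 2) (proj₂ (proj₂ chosen))) (m∸n+n≡m (≤-trans 2≤#X (m≤m+n _ _)))
        ι≤ : ∀ Z → ι s′ t′ A Z ≤ ι s′ t′ links Z
        ι≤ Z = #-mono λ e p → let (q , r) = ∧-true⁻ {A e} p in ∧-true (proj₁ (∧-true⁻ {links e} (A⊆F e q))) r
        single : ∀ Z {u} → Z u ≡ true → # Z ≤ 1 → ι s′ t′ A Z ≡ 0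
        single Z u∈Z #Z≤1 = #-none _ λ e → ¬-not λ p → let (q , r) = ∧-true⁻ {A e} p ; (x , y) = ∧-true⁻ {Z (s′ e)} r in
          case s′ e ≟ t′ e of λ
            { (yes eq) → false≢true (cong not (subst (λ w → (s′ e == w) ≡ true) eq (==-refl (s′ e)))) (proj₁ (∧-true⁻ {links e} (A⊆F e q)))
            ; (no ≢) → <⇒≱ (s≤s (#-pos⁻ (Z ∖ s′ e) (∖⁺ Z y ≢))) (subst (_≤ 1) (#-∖ Z x) #Z≤1) }
        sparse : Sparse s′ t′ A X
        sparse Z {u} Z⊆X u∈Z with 2 ≤? # Z
        ... | no ≱ = ≤-trans (≤-reflexive (cong (2 +_) (single Z u∈Z (s≤s⁻¹ (≰⇒> ≱))))) (*-monoʳ-≤ 2 (#-pos⁻ Z u∈Z))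
        ... | yes 2≤#Z with # Z <? # X
        ...   | yes lt = ≤-trans (+-monoʳ-≤ 2 (ι≤ Z)) (<⇒≤ (≰⇒> λ d → <⇒≱ lt (least Z ((λ w p → X⊆Y w (Z⊆X w p)) , 2≤#Z , d))))
        ...   | no ≮ = ≤-trans (+-monoʳ-≤ 2 (#-mono λ e p → proj₁ (∧-true⁻ {A e} p)))
                         (≤-trans (≤-reflexive (trans (+-comm 2 (# A)) tight)) (*-monoʳ-≤ 2 (≮⇒≥ ≮)))
        open Packing (tightPacking (# X ∸ 1) s′ t′ A X (λ e p → proj₂ (∧-true⁻ {links e} (A⊆F e p))) sparse tight
                (sym (m+[n∸m]≡n {1} (≤-trans (s≤s z≤n) 2≤#X)))) renaming (disjoint to disj)

      module Contract {X : Fin n → Bool} (X⊆Y : X ⊆ Y) (P : Packing s′ t′ (λ e → links e ∧ Edges.inside s′ t′ X e) X)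
                      {x₀ x₁} (x₀∈X : X x₀ ≡ true) (x₁∈X : X x₁ ≡ true) (x₀≢x₁ : x₀ ≢ x₁) where
        open Packing P renaming (disjoint to disjointᴬ)
        κ : Fin n → Fin n
        κ v = if X v then x₀ else v
        κ-inside : ∀ {v} → X v ≡ true → κ v ≡ x₀
        κ-inside p rewrite p = refl
        κ-outside : ∀ {v} → X v ≡ false → κ v ≡ v
        κ-outside p rewrite p = refl
        ρx : ∀ {x} → X x ≡ true → ρ x ≡ x
        ρx p = ==⇒≡ (X⊆Y _ p)
        ρ′-idempotent : ∀ v → κ (ρ (κ (ρ v))) ≡ κ (ρ v)
        ρ′-idempotent v with X (ρ v) in eq
        ... | true = trans (cong κ (ρx x₀∈X)) (κ-inside x₀∈X)
        ... | false = trans (cong κ (idempotent v)) (κ-outside eq)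
        inside⇒ : ∀ e → (links e ∧ Edges.inside s′ t′ X e) ≡ true → κ (s′ e) ≡ κ (t′ e)
        inside⇒ e p = let (a , b) = ∧-true⁻ {X (s′ e)} (proj₂ (∧-true⁻ {links e} p)) in trans (κ-inside a) (sym (κ-inside b))
        link⇒≢ : ∀ e → (links e ∧ Edges.inside s′ t′ X e) ≡ true → s′ e ≢ t′ e
        link⇒≢ e p eq = false≢true (cong not (subst (λ w → (s′ e == w) ≡ true) eq (==-refl (s′ e)))) (proj₁ (∧-true⁻ {links e} p))
        contracted : ∀ {B A′ : Fin m → Bool} → (∀ e → B e ≡ true → s′ e ≡ t′ e) → A′ ⊆ (λ e → links e ∧ Edges.inside s′ t′ X e) →
                     ∀ e → B e ∨ A′ e ≡ true → κ (s′ e) ≡ κ (t′ e)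
        contracted {B} h A′⊆ e p = [ (λ q → cong κ (h e q)) , (λ q → inside⇒ e (A′⊆ e q)) ]′ (∨-true⁻ {B e} p)
        -- A link of the contracted graph lifts to a walk from `ρ (s e)` to `s e`, across `e`, and
        -- from `t e` to `ρ (t e)`. Both detours stay in the old set `B`, so the two connectors
        -- never borrow edges from each other.
        connected : ∀ {B A′ : Fin m → Bool} → (∀ v → Edges.Connected s t B v (ρ v)) → Connects s′ t′ A′ X →
                    ∀ v → Edges.Connected s t (λ e → B e ∨ A′ e) v (κ (ρ v))
        connected {B} {A′} cB cA v with X (ρ v) in eq
        ... | false = Edges.Connected-mono s t (λ e → ∨-trueˡ) (cB v)
        ... | true = cBv ◅◅ liftConnected through (cA eq x₀∈X)
          where
          open Edges s t
          cBv = Connected-mono (λ e → ∨-trueˡ {B e} {A′ e}) (cB v)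
          through : ∀ e → A′ e ≡ true → Connected (λ e → B e ∨ A′ e) (s′ e) (t′ e)
          through e p = reverse (Connected-mono (λ e → ∨-trueˡ) (cB (s e))) ◅◅
            step e (∨-trueʳ p) (inj₁ (refl , refl)) (Connected-mono (λ e → ∨-trueˡ) (cB (t e)))
        C′ : Contraction
        C′ = record
          { ρ = κ ∘ ρ
          ; idempotent = ρ′-idempotent
          ; B₁ = λ e → B₁ e ∨ A₁ e
          ; B₂ = λ e → B₂ e ∨ A₂ e
          -- An edge used earlier lies within one class and a link joins two classes, so old and new
          -- edges cannot coincide.
          ; disjoint = λ e p → ¬-not λ q → case ∨-true⁻ {B₁ e} p , ∨-true⁻ {B₂ e} q of λ
              { (inj₁ a , inj₁ b) → false≢true (disjoint e a) b
              ; (inj₁ a , inj₂ b) → link⇒≢ e (A₂⊆A e b) (B₁-contracted e a)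
              ; (inj₂ a , inj₁ b) → link⇒≢ e (A₁⊆A e a) (B₂-contracted e b)
              ; (inj₂ a , inj₂ b) → false≢true (disjointᴬ e a) b }
          ; B₁-contracted = contracted {B₁} B₁-contracted A₁⊆A
          ; B₂-contracted = contracted {B₂} B₂-contracted A₂⊆A
          ; connected₁ = connected {B₁} connected₁ connects₁
          ; connected₂ = connected {B₂} connected₂ connects₂
          }
        Y′⊆Y : Contraction.Y C′ ⊆ Y
        Y′⊆Y v p with X (ρ v) in eq
        ... | false = p
        ... | true = subst (λ w → (ρ w == w) ≡ true) (==⇒≡ p) (X⊆Y x₀ x₀∈X)
        x₁∉Y′ : Contraction.Y C′ x₁ ≡ false
        x₁∉Y′ = ≢⇒== λ eq → x₀≢x₁ (trans (sym (trans (cong κ (ρx x₁∈X)) (κ-inside x₁∈X))) eq)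

        smaller-Y : # (Contraction.Y C′) < # Y
        smaller-Y = #-< {f = Contraction.Y C′} {Y} Y′⊆Y x₁ x₁∉Y′ (X⊆Y x₁ x₁∈X)

      contractMore : ∃[ C′ ] # (Contraction.Y C′) < # Y
      contractMore = contract packable
        where
        contract : ∃[ X ] X ⊆ Y × 2 ≤ # X × Packing s′ t′ (λ e → links e ∧ Edges.inside s′ t′ X e) X →
                   ∃[ C′ ] # (Contraction.Y C′) < # Y
        contract (X , X⊆Y , 2≤#X , P) =
          let (x₀ , x₁ , x₀∈X , x₁∈X , x₀≢x₁) = #-two X 2≤#X
          in Contract.C′ X⊆Y P x₀∈X x₁∈X x₀≢x₁ , Contract.smaller-Y X⊆Y P x₀∈X x₁∈X x₀≢x₁

    twoConnectors : ∃[ B₁ ] ∃[ B₂ ] (∀ e → B₁ e ≡ true → B₂ e ≡ false)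
                    × (∀ u w → Edges.Connected s t B₁ u w) × (∀ u w → Edges.Connected s t B₂ u w)
    twoConnectors = go discrete (<-wellFounded _)
      where
      discrete : Contraction
      discrete = record
        { ρ = id ; idempotent = λ _ → refl ; B₁ = λ _ → false ; B₂ = λ _ → false ; disjoint = λ _ ()
        ; B₁-contracted = λ _ () ; B₂-contracted = λ _ () ; connected₁ = λ _ → Edges.here ; connected₂ = λ _ → Edges.here }
      go : (C : Contraction) → Acc _<_ (# (Contraction.Y C)) →
           ∃[ B₁ ] ∃[ B₂ ] (∀ e → B₁ e ≡ true → B₂ e ≡ false)
           × (∀ u w → Edges.Connected s t B₁ u w) × (∀ u w → Edges.Connected s t B₂ u w)
      go C (acc rec) with 2 ≤? # (Contraction.Y C)
      ... | yes 2≤#Y = let (C′ , lt) = contractMore C 2≤#Y in go C′ (rec lt)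
      ... | no ≱ = B₁ , B₂ , disjoint , all connected₁ , all connected₂
        where
        open Contraction C
        open Edges s t
        same : ∀ u w → ρ u ≡ ρ w
        same u w with ρ u ≟ ρ w
        ... | yes eq = eq
        ... | no ≢ = ⊥-elim (≱ (subst (2 ≤_) (sym (#-∖ Y (ρ∈Y u))) (s≤s (#-pos⁻ (Y ∖ ρ u) (∖⁺ Y (ρ∈Y w) ≢)))))
        all : ∀ {B} → (∀ v → Connected B v (ρ v)) → ∀ u w → Connected B u w
        all c u w = c u ◅◅ subst (λ x → Connected _ x w) (same w u) (reverse (c w))

-- Flows over ℤ₂×ℤ₂

∣tabulate∣ : (f : Fin k → Bool) → ∣ tabulate f ∣ ≡ # f
∣tabulate∣ {zero} f = refl
∣tabulate∣ {suc k} f with f zero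
... | true = cong suc (∣tabulate∣ (f ∘ suc))
... | false = ∣tabulate∣ (f ∘ suc)

module _ {n m : ℕ} (G : OrientedGraph n m) where
  open OrientedGraph G renaming (initial to s; terminal to t)
  open Edges s t

  -- After deleting a cut, membership in `Y` is constant along every remaining walk; if the cut were
  -- small, such a walk would still lead from `u` to `w`.
  EdgeConnected⇒CutsAtLeast : ∀ {k} → EdgeConnected G k → CutsAtLeast k
  EdgeConnected⇒CutsAtLeast {k} (_ , connected) Y {u} {w} u∈Y w∉Y with k ≤? cut Y
  ... | yes p = p
  ... | no ¬p = false≢true w∉Y (along (connected S (subst (_< k) (sym (∣tabulate∣ crosses)) (≰⇒> ¬p)) u w) u∈Y)
    where
    crosses : Fin m → Bool
    crosses e = Y (s e) xor Y (t e)
    S : Subset m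
    S = tabulate crosses
    same : ∀ e → ¬ (e ∈ₛ S) → Y (s e) ≡ Y (t e)
    same e e∉S with Y (s e) in p | Y (t e) in q
    ... | true | true = refl
    ... | false | false = refl
    ... | true | false = ⊥-elim (e∉S (lookup⇒[]= e S (trans (lookup∘tabulate crosses e) (cong₂ _xor_ p q))))
    ... | false | true = ⊥-elim (e∉S (lookup⇒[]= e S (trans (lookup∘tabulate crosses e) (cong₂ _xor_ p q))))
    along : ∀ {u w} → EqClosure (EdgeAvoiding G S) u w → Y u ≡ true → Y w ≡ true
    along [·] p = p
    along (fwd (e , e∉S , refl , refl) ◅ q) p = along q (trans (sym (same e e∉S)) p)
    along (bwd (e , e∉S , refl , refl) ◅ q) p = along q (trans (same e e∉S) p)

  everything : Fin m → Bool
  everything _ = true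

  cut≤degree : ∀ v → cut (v ==_) ≤ degree everything v
  cut≤degree v = sumℕ-mono pointwise
    where
    pointwise : ∀ e → bit ((v == s e) xor (v == t e)) ≤ bit (s e == v) + bit (t e == v)
    pointwise e rewrite ==-sym (s e) v | ==-sym (t e) v with v == s e | v == t e
    ... | true | true = z≤n
    ... | true | false = ≤-refl
    ... | false | true = ≤-refl
    ... | false | false = ≤-refl

  minDegree : ∀ {k} → 2 ≤ n → CutsAtLeast k → ∀ v → k ≤ degree everything v
  minDegree 2≤n cuts v =
    let (w , _ , v≢w) = #-other (λ _ → true) (subst (2 ≤_) (sym (#-all {n} (λ _ → true) λ _ → refl)) 2≤n) v
    in ≤-trans (cuts (v ==_) (==-refl v) (≢⇒== v≢w)) (cut≤degree v)

-- Cubing removes the cube root from the bound, and cancelling `2 ^ i` replaces subtraction in the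
-- exponent. The triple `(c , j , i)` is `(n , 0 , 3n)` over ℤ₂×ℤ₂ and `(m , n , 2n)` over ℤ₆.
cubeBound : ∀ f N n c j i → 2 ^ f ≤ N * 2 ^ n → c + i ≤ 3 * f → j + i ≡ 3 * n → 2 ^ c ≤ N ^ 3 * 2 ^ j
cubeBound f N n c j i le c+i≤ j+i≡ = *-cancelʳ-≤ (2 ^ c) (N ^ 3 * 2 ^ j) (2 ^ i) {{m^n≢0 2 i}} (begin
  2 ^ c * 2 ^ i              ≡⟨ ^-distribˡ-+-* 2 c i ⟨
  2 ^ (c + i)                ≤⟨ ^-monoʳ-≤ 2 c+i≤ ⟩
  2 ^ (3 * f)                ≡⟨ cong (2 ^_) (*-comm 3 f) ⟩
  2 ^ (f * 3)                ≡⟨ ^-*-assoc 2 f 3 ⟨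
  (2 ^ f) ^ 3                ≤⟨ ^-monoˡ-≤ 3 le ⟩
  (N * 2 ^ n) ^ 3            ≡⟨ cube-* N (2 ^ n) ⟩
  N ^ 3 * (2 ^ n) ^ 3        ≡⟨ cong (N ^ 3 *_) (^-*-assoc 2 n 3) ⟩
  N ^ 3 * 2 ^ (n * 3)        ≡⟨ cong (λ x → N ^ 3 * 2 ^ x) (trans (*-comm n 3) (sym j+i≡)) ⟩
  N ^ 3 * 2 ^ (j + i)        ≡⟨ cong (N ^ 3 *_) (^-distribˡ-+-* 2 j i) ⟩
  N ^ 3 * (2 ^ j * 2 ^ i)    ≡⟨ *-assoc (N ^ 3) _ _ ⟨
  N ^ 3 * 2 ^ j * 2 ^ i      ∎)
  where
  open ≤-Reasoning
  cube-* : ∀ a b → a * b * (a * b * (a * b * 1)) ≡ a * (a * (a * 1)) * (b * (b * (b * 1)))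
  cube-* = solve-∀

largest : ∀ (g : Fin 3 → ℕ) c → c ≤ g 0F + (g 1F + g 2F) → ∃[ i ] c ≤ 3 * g i
largest g c le with any? (λ i → c ≤? 3 * g i)
... | yes p = p
... | no ¬p = ⊥-elim (<⇒≱ (+-mono-< (lt 0F) (+-mono-< (lt 1F) (lt 2F))) (begin
  c + (c + c)                                ≡⟨ cong (λ x → c + (c + x)) (+-identityʳ c) ⟨
  3 * c                                      ≤⟨ *-monoʳ-≤ 3 le ⟩
  3 * (g 0F + (g 1F + g 2F))                 ≡⟨ *-distribˡ-+ 3 (g 0F) _ ⟩
  3 * g 0F + 3 * (g 1F + g 2F)               ≡⟨ cong (3 * g 0F +_) (*-distribˡ-+ 3 (g 1F) _) ⟩
  3 * g 0F + (3 * g 1F + 3 * g 2F)           ∎))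
  where
  open ≤-Reasoning
  lt : ∀ i → 3 * g i < c
  lt i = ≰⇒> λ p → ¬p (i , p)

module _ {c ℓ c′ ℓ′} (Γ : AbelianGroup c ℓ) (Δ : AbelianGroup c′ ℓ′) where
  private
    module Γ = AbelianGroup Γ
    module Δ = AbelianGroup Δ

  isHomomorphism : (f : Γ.Carrier → Δ.Carrier) → (∀ {a b} → a Γ.≈ b → f a Δ.≈ f b) →
                   (∀ a b → f (a Γ.∙ b) Δ.≈ f a Δ.∙ f b) → f Γ.ε Δ.≈ Δ.ε → (∀ a → f (a Γ.⁻¹) Δ.≈ (f a) Δ.⁻¹) →
                   IsGroupHomomorphism Γ.rawGroup Δ.rawGroup f
  isHomomorphism f f-cong f-∙ f-ε f-⁻¹ = record
    { isMonoidHomomorphism = record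
      { isMagmaHomomorphism = record { isRelHomomorphism = record { cong = f-cong } ; homo = f-∙ }
      ; ε-homo = f-ε }
    ; ⁻¹-homo = f-⁻¹ }

module FourFlows where
  open AbelianGroup ℤ₂×ℤ₂ using (Carrier; _≈_; _∙_; ε; _⁻¹; rawGroup)

  -- The images are the three subgroups of order two.
  multiple : Fin 3 → Fin 2 → Carrier
  multiple 0F x = x , 0F
  multiple 1F x = 0F , x
  multiple 2F x = x , x

  _≈?_ : ∀ a b → Dec (a ≈ b)
  (a , b) ≈? (a′ , b′) = (a ≟ a′) ×-dec (b ≟ b′)

  multiple-hom : ∀ i → IsGroupHomomorphism (AbelianGroup.rawGroup ℤ₂) rawGroup (multiple i)
  multiple-hom i = isHomomorphism ℤ₂ ℤ₂×ℤ₂ (multiple i) (λ { refl → AbelianGroup.refl ℤ₂×ℤ₂ })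
    (from-yes (all? λ i → all? λ a → all? λ b → multiple i (AbelianGroup._∙_ ℤ₂ a b) ≈? (multiple i a ∙ multiple i b)) i)
    (from-yes (all? λ i → multiple i 0F ≈? ε) i)
    (from-yes (all? λ i → all? λ a → multiple i (AbelianGroup._⁻¹ ℤ₂ a) ≈? (multiple i a ⁻¹)) i)

  multiple-injective : ∀ i {a b} → multiple i a ≈ multiple i b → a ≡ b
  multiple-injective i {a} {b} = from-yes (all? λ i → all? λ a → all? λ b → (multiple i a ≈? multiple i b) →-dec (a ≟ b)) i a b

  different : Fin 3 → Carrier → Bool
  different i a = not (does (a ≈? multiple i 1F))

  different-translate : ∀ i a → ¬ (a ≈ ε) → different i a ≡ true → ∀ b → ¬ (a ∙ multiple i b ≈ ε)
  different-translate i (x , y) = from-yes (all? λ i → all? λ x → all? λ y → ¬? ((x , y) ≈? ε) →-dec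
    ((different i (x , y) ≟ᵇ true) →-dec all? λ b → ¬? (((x , y) ∙ multiple i b) ≈? ε))) i x y

  different-two : ∀ a → ¬ (a ≈ ε) → bit (different 0F a) + (bit (different 1F a) + bit (different 2F a)) ≡ 2
  different-two (x , y) = from-yes (all? λ x → all? λ y → ¬? ((x , y) ≈? ε) →-dec
    ((bit (different 0F (x , y)) + (bit (different 1F (x , y)) + bit (different 2F (x , y)))) ℕ≟ 2)) x y

  module _ {n m : ℕ} (G : OrientedGraph n m) (4-connected : EdgeConnected G 4) where
    open OrientedGraph G renaming (initial to s; terminal to t)
    open FlowsOf ℤ₂×ℤ₂ G
    open Edges s t

    nowhereZero : ∃[ φ ] Flow φ × (∀ e → ¬ (φ e ≈ ε))
    nowhereZero =
      let (B₁ , B₂ , disjoint , connected₁ , connected₂) = twoConnectors s t (EdgeConnected⇒CutsAtLeast G 4-connected)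
          (f₁ , f₁-flow , f₁-off) = Boundary.complete ℤ₂ s t B₁ (λ _ → 1F) (λ e _ → inj₂ (connected₁ (s e) (t e)))
          (f₂ , f₂-flow , f₂-off) = Boundary.complete ℤ₂ s t B₂ (λ _ → 1F) (λ e _ → inj₂ (connected₂ (s e) (t e)))
      in (λ e → multiple 0F (f₁ e) ∙ multiple 1F (f₂ e))
       , Flow-∙ (multiple 0F ∘ f₁) (multiple 1F ∘ f₂)
           (Flow-hom ℤ₂ ℤ₂×ℤ₂ (multiple-hom 0F) s t f₁ f₁-flow) (Flow-hom ℤ₂ ℤ₂×ℤ₂ (multiple-hom 1F) s t f₂ f₂-flow)
       -- An edge of `B₁` lies outside `B₂`, where `f₂` is 1; any other edge lies outside `B₁`,
       -- where `f₁` is 1.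
       , λ e z → nonzero (f₁ e) (f₂ e) z (case B₁ e ≟ᵇ true of λ
           { (yes p) → inj₂ (f₂-off e (disjoint e p))
           ; (no ¬p) → inj₁ (f₁-off e (¬-not ¬p)) })
      where
      nonzero : ∀ x y → multiple 0F x ∙ multiple 1F y ≈ ε → ¬ (x ≡ 1F ⊎ y ≡ 1F)
      nonzero = from-yes (all? λ x → all? λ y → ((multiple 0F x ∙ multiple 1F y) ≈? ε) →-dec ¬? ((x ≟ 1F) ⊎-dec (y ≟ 1F)))

    2n≤m : 2 * n ≤ m
    2n≤m = *-cancelˡ-≤ 2 (begin
      2 * (2 * n)                          ≡⟨ *-assoc 2 2 n ⟨
      4 * n                                ≡⟨ *-comm 4 n ⟩
      n * 4                                ≡⟨ sumℕ-const n ⟨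
      sumℕ {n} (λ _ → 4)                   ≤⟨ sumℕ-mono {n} {λ _ → 4} {degree (everything G)} (minDegree G (proj₁ 4-connected) (EdgeConnected⇒CutsAtLeast G 4-connected)) ⟩
      sumℕ (degree (everything G))         ≡⟨ sum-degree (everything G) ⟩
      2 * # (everything G)                 ≡⟨ cong (2 *_) (#-all (everything G) λ _ → refl) ⟩
      2 * m                                ∎)
      where open ≤-Reasoning

    #different : ∀ φ → (∀ e → ¬ (φ e ≈ ε)) →
                 # (different 0F ∘ φ) + (# (different 1F ∘ φ) + # (different 2F ∘ φ)) ≡ 2 * m
    #different φ nz = begin
      # (different 0F ∘ φ) + (# (different 1F ∘ φ) + # (different 2F ∘ φ))
        ≡⟨ cong (# (different 0F ∘ φ) +_) (#-+# (different 1F ∘ φ) (different 2F ∘ φ)) ⟨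
      # (different 0F ∘ φ) + sumℕ (λ e → bit (different 1F (φ e)) + bit (different 2F (φ e)))
        ≡⟨ sumℕ-distrib-+ (bit ∘ different 0F ∘ φ) (λ e → bit (different 1F (φ e)) + bit (different 2F (φ e))) ⟨
      sumℕ (λ e → bit (different 0F (φ e)) + (bit (different 1F (φ e)) + bit (different 2F (φ e))))
        ≡⟨ sumℕ-cong {m} (λ e → different-two (φ e) (nz e)) ⟩
      sumℕ {m} (λ _ → 2)    ≡⟨ sumℕ-const m ⟩
      m * 2                 ≡⟨ *-comm m 2 ⟩
      2 * m                 ∎
      where open ≡-Reasoning

    manyFourFlows : ∃[ N ] 2 ^ n ≤ N ^ 3 × HasAtLeast (NowhereZeroFlows ℤ₂×ℤ₂ G) N
    manyFourFlows =
      let (φ , φ-flow , nz) = nowhereZero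
          (i , le) = largest (λ i → # (different i ∘ φ)) (2 * m) (≤-reflexive (sym (#different φ nz)))
      in conclude (# (different i ∘ φ)) le (manyFlows ℤ₂×ℤ₂ G (multiple i) (multiple-hom i) (multiple-injective i) φ φ-flow
            (different i ∘ φ) (λ e p a → different-translate i (φ e) (nz e) p a) (λ e _ → nz e))
      where
      shape : ∀ n → n + 3 * n ≡ 2 * (2 * n)
      shape = solve-∀
      conclude : ∀ f → 2 * m ≤ 3 * f → ∃[ N ] 2 ^ f ≤ N * 2 ^ n × HasAtLeast (NowhereZeroFlows ℤ₂×ℤ₂ G) N →
                 ∃[ N ] 2 ^ n ≤ N ^ 3 × HasAtLeast (NowhereZeroFlows ℤ₂×ℤ₂ G) N
      -- The chain is n + 3n = 4n ≤ 2m ≤ 3f, in which the 3n is what three times the `n` vertex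
      -- conditions cost.
      conclude f le (N , bound , flows) = N , subst (2 ^ n ≤_) (*-identityʳ (N ^ 3)) (cubeBound f N n n 0 (3 * n) bound
             (≤-trans (≤-reflexive (shape n)) (≤-trans (*-monoʳ-≤ 2 2n≤m) le)) refl) , flows

-- Closed trails

nonzero : Fin 6 → Bool
nonzero a = not (does (a ≟ 0F))

supp : (Fin k → Fin 6) → Fin k → Bool
supp ψ e = nonzero (ψ e)

-- In ℤ₆ the element 5 is -1.
Unit : Fin 6 → Set
Unit a = a ≡ 1F ⊎ a ≡ 5F

Sign : Fin 6 → Set
Sign a = a ≡ 0F ⊎ Unit a

module Z₆ = AbelianGroup ℤ₆
open Z₆ using (_∙_; _⁻¹)

Sign? : ∀ a → Dec (Sign a)
Sign? a = (a ≟ 0F) ⊎-dec ((a ≟ 1F) ⊎-dec (a ≟ 5F))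

Sign-⁻¹ : ∀ a → Sign a → Sign (a ⁻¹)
Sign-⁻¹ = from-yes (all? λ a → Sign? a →-dec Sign? (a ⁻¹))

-- Disjoint supports are essential: two equal units would add up to ±2.
Sign-∙ : ∀ a b → a ≡ 0F ⊎ b ≡ 0F → Sign a → Sign b → Sign (a ∙ b)
Sign-∙ = from-yes (all? λ a → all? λ b → ((a ≟ 0F) ⊎-dec (b ≟ 0F)) →-dec (Sign? a →-dec (Sign? b →-dec Sign? (a ∙ b))))

nonzero-⁻¹ : ∀ a → nonzero (a ⁻¹) ≡ nonzero a
nonzero-⁻¹ = from-yes (all? λ a → nonzero (a ⁻¹) ≟ᵇ nonzero a)

nonzero-∙ : ∀ a b → a ≡ 0F ⊎ b ≡ 0F → nonzero (a ∙ b) ≡ nonzero a ∨ nonzero b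
nonzero-∙ = from-yes (all? λ a → all? λ b → ((a ≟ 0F) ⊎-dec (b ≟ 0F)) →-dec (nonzero (a ∙ b) ≟ᵇ (nonzero a ∨ nonzero b)))

nonzero-false : ∀ a → nonzero a ≡ false → a ≡ 0F
nonzero-false = from-yes (all? λ a → (nonzero a ≟ᵇ false) →-dec (a ≟ 0F))

Apart : (Fin k → Fin 6) → (Fin k → Fin 6) → Set
Apart ψ χ = ∀ e → ψ e ≡ 0F ⊎ χ e ≡ 0F

Apart-sym : {ψ χ : Fin k → Fin 6} → Apart ψ χ → Apart χ ψ
Apart-sym d e = [ inj₂ , inj₁ ]′ (d e)

Apart-∙ : (ψ χ ω : Fin k → Fin 6) → Apart ψ χ → Apart ψ ω → Apart ψ (λ e → χ e ∙ ω e)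
Apart-∙ ψ χ ω d d′ e with d e | d′ e
... | inj₁ p | _ = inj₁ p
... | inj₂ _ | inj₁ p = inj₁ p
... | inj₂ p | inj₂ q = inj₂ (cong₂ _∙_ p q)

Apart-⁻¹ : (ψ χ : Fin k → Fin 6) → Apart ψ χ → Apart ψ (λ e → χ e ⁻¹)
Apart-⁻¹ ψ χ d e = [ inj₁ , (λ p → inj₂ (cong _⁻¹ p)) ]′ (d e)

Apart⁺ : (ψ χ : Fin k → Fin 6) → (∀ e → supp ψ e ≡ true → supp χ e ≡ true → ⊥) → Apart ψ χ
Apart⁺ ψ χ h e with supp ψ e in p | supp χ e in q
... | false | _ = inj₁ (nonzero-false _ p)
... | true | false = inj₂ (nonzero-false _ q)
... | true | true = ⊥-elim (h e p q)

module Trails {n m : ℕ} (s t : Fin m → Fin n) where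
  open Boundary ℤ₆ s t
  open Edges s t

  supp-∙ : ∀ {ψ χ : Fin m → Fin 6} → Apart ψ χ → ∀ e → supp (λ e → ψ e ∙ χ e) e ≡ supp ψ e ∨ supp χ e
  supp-∙ {ψ} {χ} d e = nonzero-∙ (ψ e) (χ e) (d e)

  supp-one : ∀ {e b e′} → supp (one e b) e′ ≡ true → e ≡ e′
  supp-one {e} {b} {e′} p with e ≟ e′
  ... | yes eq = eq

  -- A trail from u to w, kept as its vertex set N and the signed indicator ψ of its edges.
  record Trail (u w : Fin n) : Set where
    field
      ψ : Fin m → Fin 6
      signs : ∀ e → Sign (ψ e)
      ∂ψ : ∀ v → ∂ ψ v ≡ ends u w 1F v
      N : Fin n → Bool
      start∈N : N u ≡ true
      end∈N : N w ≡ true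
      supp⊆N : supp ψ ⊆ inside N
      connected : ∀ {y} → N y ≡ true → Connected (supp ψ) u y
  open Trail public

  stay : ∀ u → Trail u u
  stay u = record
    { ψ = λ _ → 0F ; signs = λ _ → inj₁ refl ; ∂ψ = λ v → trans (∂-ε v) (sym (ends-self u 1F v))
    ; N = u ==_ ; start∈N = ==-refl u ; end∈N = ==-refl u ; supp⊆N = λ _ ()
    ; connected = λ {y} p → case ==⇒≡ {i = u} {y} p of λ { refl → here } }

  module _ {e u w} (j : Joins e u w) where
    private
      value = Joins⇒∂ j 1F
      b = proj₁ value

    along : Trail u w
    along = record
      { ψ = one e b
      ; signs = λ e′ → sign e′
      ; ∂ψ = proj₂ (proj₂ value)
      ; N = insert w (u ==_)
      ; start∈N = ∨-trueˡ (==-refl u)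
      ; end∈N = insert-self w (u ==_)
      ; supp⊆N = λ e′ p → case supp-one {e} {b} p of λ { refl → inside⁺ {insert w (u ==_)} (∨-trueˡ (==-refl u)) (insert-self w (u ==_)) j }
      ; connected = λ {y} p → case insert⁻ w (u ==_) p of λ
          { (inj₁ q) → case ==⇒≡ {i = u} {y} q of λ { refl → here }
          ; (inj₂ refl) → edge e nz j }
      }
      where
      b-unit : Unit b
      b-unit = proj₁ (proj₂ value)
      sign : ∀ e′ → Sign (one e b e′)
      sign e′ with e == e′
      ... | true = inj₂ b-unit
      ... | false = inj₁ refl
      nz : supp (one e b) e ≡ true
      nz = trans (cong nonzero (one-self e b)) ([ cong nonzero , cong nonzero ]′ b-unit)

    supp-along : ∀ {e′} → supp (ψ along) e′ ≡ true → e ≡ e′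
    supp-along = supp-one {e} {b}

  join : ∀ {u v w} (p : Trail u v) (q : Trail v w) → Apart (ψ p) (ψ q) → Trail u w
  join {u} {v} {w} p q d = record
    { ψ = λ e → ψ p e ∙ ψ q e
    ; signs = λ e → Sign-∙ _ _ (d e) (signs p e) (signs q e)
    ; ∂ψ = λ x → trans (∂-∙ (ψ p) (ψ q) x) (trans (cong₂ _∙_ (∂ψ p x) (∂ψ q x)) (ends-trans u v w 1F x))
    ; N = λ y → N p y ∨ N q y
    ; start∈N = ∨-trueˡ (start∈N p)
    ; end∈N = ∨-trueʳ (end∈N q)
    ; supp⊆N = λ e r → case ∨-true⁻ {supp (ψ p) e} (trans (sym (supp-∙ d e)) r) of λ
        { (inj₁ r) → let (x , y) = ∧-true⁻ {N p (s e)} (supp⊆N p e r) in ∧-true (∨-trueˡ {N p (s e)} x) (∨-trueˡ {N p (t e)} y)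
        ; (inj₂ r) → let (x , y) = ∧-true⁻ {N q (s e)} (supp⊆N q e r) in ∧-true (∨-trueʳ {N p (s e)} x) (∨-trueʳ {N p (t e)} y) }
    ; connected = λ {y} r → case ∨-true⁻ {N p y} r of λ
        { (inj₁ r) → Connected-mono left (connected p r)
        ; (inj₂ r) → Connected-mono left (connected p (end∈N p)) ◅◅ Connected-mono right (connected q r) }
    }
    where
    left : ∀ e → supp (ψ p) e ≡ true → supp (λ e → ψ p e ∙ ψ q e) e ≡ true
    left e r = trans (supp-∙ d e) (∨-trueˡ r)
    right : ∀ e → supp (ψ q) e ≡ true → supp (λ e → ψ p e ∙ ψ q e) e ≡ true
    right e r = trans (supp-∙ d e) (∨-trueʳ r)

  back : ∀ {u w} → Trail u w → Trail w u
  back {u} {w} p = record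
    { ψ = λ e → ψ p e ⁻¹
    ; signs = λ e → Sign-⁻¹ _ (signs p e)
    ; ∂ψ = λ v → trans (∂-⁻¹ (ψ p) v) (trans (cong _⁻¹ (∂ψ p v)) (⁻¹-anti-homo‿- (at u 1F v) (at w 1F v)))
    ; N = N p
    ; start∈N = end∈N p
    ; end∈N = start∈N p
    ; supp⊆N = λ e r → supp⊆N p e (trans (sym (nonzero-⁻¹ (ψ p e))) r)
    ; connected = λ r → Connected-mono same (reverse (connected p (end∈N p)) ◅◅ connected p r)
    }
    where
    open AbelianGroupProperties ℤ₆ using (⁻¹-anti-homo‿-)
    same : ∀ e → supp (ψ p) e ≡ true → supp (λ e → ψ p e ⁻¹) e ≡ true
    same e r = trans (nonzero-⁻¹ (ψ p e)) r

  supp⇒ends : ∀ {u w e x y} (p : Trail u w) → Joins e x y → supp (ψ p) e ≡ true → N p x ≡ true × N p y ≡ true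
  supp⇒ends p j r = inside⁻ {N p} j (supp⊆N p _ r)

  -- For `a = b` this is a closed trail through `a` and `x`, the case finally used. Arbitrary ends
  -- are allowed so that an ear attached to `T` at two vertices can be completed inside `T`.
  TrailsThrough : Fin n → (Fin n → Bool) → Set
  TrailsThrough x T = ∀ {a b} → T a ≡ true → T b ≡ true → Σ[ p ∈ Trail a b ] N p ⊆ T × N p x ≡ true

  module Ears (T : Fin n → Bool) {t₁ u₁ e₁} (j₁ : Joins e₁ t₁ u₁) (t₁∈T : T t₁ ≡ true) (u₁∉T : T u₁ ≡ false) where

    -- With `a` not after `b` on the ear, `p` is the piece before `a` and `q` the piece after `b`.
    -- By `p-off` the piece `p` shares no edge with a trail inside `T`, since `e₁` ends at `u₁`,
    -- outside `T`.
    record Split (U : Fin n → Bool) (a b z : Fin n) : Set where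
      field
        p : Trail t₁ a
        q : Trail b z
        p-near : ∀ y → N p y ≡ true → U y ≡ true ⊎ t₁ ≡ y
        q-near : N q ⊆ U
        p-off : ∀ e → supp (ψ p) e ≡ true → e₁ ≡ e ⊎ (T (s e) ≡ false × T (t e) ≡ false)
        apart : Apart (ψ p) (ψ q)

    -- A path from t₁ through e₁ to z with vertex set U outside T, given by how any
    -- two of its vertices, in their order along the path, split it.
    record Ear (R : Fin n → Bool) (z : Fin n) : Set where
      field
        U : Fin n → Bool
        U⊆R : U ⊆ R
        z∈U : U z ≡ true
        split : ∀ {a b} → U a ≡ true → U b ≡ true → Split U a b z ⊎ Split U b a z

      to : ∀ {a} → U a ≡ true → Split U a a z
      to a∈U = [ id , id ]′ (split a∈U a∈U)

    firstEar : Ear (u₁ ==_) u₁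
    firstEar = record { U = u₁ ==_ ; U⊆R = λ _ r → r ; z∈U = ==-refl u₁ ; split = λ r r′ → inj₁ (split′ r r′) }
      where
      split′ : ∀ {a b} → (u₁ == a) ≡ true → (u₁ == b) ≡ true → Split (u₁ ==_) a b u₁
      split′ {a} {b} r r′ with ==⇒≡ {i = u₁} {a} r | ==⇒≡ {i = u₁} {b} r′
      ... | refl | refl = record
        { p = along j₁ ; q = stay u₁
        ; p-near = λ y r → [ (λ q → inj₂ (==⇒≡ q)) , (λ { refl → inj₁ (==-refl u₁) }) ]′ (insert⁻ u₁ (t₁ ==_) r)
        ; q-near = λ _ r → r
        ; p-off = λ e r → inj₁ (supp-along j₁ r)
        ; apart = λ _ → inj₂ refl }

    module _ {R : Fin n → Bool} (R∩T : ∀ v → R v ≡ true → T v ≡ false) where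

      -- The vertex `z′` is outside `U` and, being outside `T`, different from `t₁`; hence `f` is
      -- new to every piece and can be appended. In the order along the ear `z′` comes last.
      extendEar : ∀ {z z′ f} → Joins f z z′ → R z′ ≡ false → T z′ ≡ false → Ear R z → Ear (insert z′ R) z′
      extendEar {z} {z′} {f} j z′∉R z′∉T E = record
        { U = U′
        ; U⊆R = λ v r → [ (λ r → ∨-trueˡ (U⊆R v r)) , (λ { refl → insert-self z′ R }) ]′ (insert⁻ z′ U r)
        ; z∈U = insert-self z′ U
        ; split = λ {a} {b} r r′ → split′ (insert⁻ z′ U r) (insert⁻ z′ U r′)
        }
        where
        open Ear E
        U′ : Fin n → Bool
        U′ = insert z′ U
        last : Trail z z′
        last = along j
        z′∉U : U z′ ≡ true → ⊥
        z′∉U r = false≢true z′∉R (U⊆R z′ r)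
        last⊆U′ : N last ⊆ U′
        last⊆U′ y r with insert⁻ z′ (z ==_) r
        ... | inj₁ q = ∨-trueˡ (subst (λ x → U x ≡ true) (==⇒≡ q) z∈U)
        ... | inj₂ refl = insert-self z′ U
        p-avoids : ∀ {a b} (S : Split U a b z) → Apart (ψ (Split.p S)) (ψ last)
        p-avoids S = Apart⁺ _ _ λ e r r′ → case supp-along j r′ of λ
          { refl → [ z′∉U , (λ { refl → false≢true z′∉T t₁∈T }) ]′ (p-near z′ (proj₂ (supp⇒ends p j r))) }
          where open Split S
        q-avoids : ∀ {a b} (S : Split U a b z) → Apart (ψ (Split.q S)) (ψ last)
        q-avoids S = Apart⁺ _ _ λ e r r′ → case supp-along j r′ of λ
          { refl → z′∉U (q-near z′ (proj₂ (supp⇒ends q j r))) }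
          where open Split S
        both-old : ∀ {a b} → Split U a b z → Split U′ a b z′
        both-old S = record
          { p = p ; q = join q last (q-avoids S)
          ; p-near = λ y r → [ (λ r → inj₁ (∨-trueˡ r)) , inj₂ ]′ (p-near y r)
          ; q-near = λ y r → [ (λ r → ∨-trueˡ (q-near y r)) , last⊆U′ y ]′ (∨-true⁻ {N q y} r)
          ; p-off = p-off
          ; apart = Apart-∙ _ _ _ apart (p-avoids S) }
          where open Split S
        one-old : ∀ {a} → U a ≡ true → Split U′ a z′ z′
        one-old a∈U = record
          { p = p ; q = stay z′
          ; p-near = λ y r → [ (λ r → inj₁ (∨-trueˡ r)) , inj₂ ]′ (p-near y r)
          ; q-near = λ y r → subst (λ x → U′ x ≡ true) (==⇒≡ r) (insert-self z′ U)
          ; p-off = p-off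
          ; apart = λ _ → inj₂ refl }
          where open Split (to a∈U)
        none-old : Split U′ z′ z′ z′
        none-old = record
          { p = join p last (p-avoids S) ; q = stay z′
          ; p-near = λ y r → [ (λ r → [ (λ r → inj₁ (∨-trueˡ r)) , inj₂ ]′ (p-near y r)) , (λ r → inj₁ (last⊆U′ y r)) ]′ (∨-true⁻ {N p y} r)
          ; q-near = λ y r → subst (λ x → U′ x ≡ true) (==⇒≡ r) (insert-self z′ U)
          ; p-off = λ e r → case ∨-true⁻ {supp (ψ p) e} (trans (sym (supp-∙ (p-avoids S) e)) r) of λ
              { (inj₁ r) → p-off e r
              ; (inj₂ r) → case supp-along j r of λ { refl → inj₂ (off-T j) } }
          ; apart = λ _ → inj₂ refl }
          where
          S : Split U z z z
          S = to z∈U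
          open Split S
          off-T : ∀ {f} → Joins f z z′ → T (s f) ≡ false × T (t f) ≡ false
          off-T (inj₁ (refl , refl)) = R∩T z (U⊆R z z∈U) , z′∉T
          off-T (inj₂ (refl , refl)) = z′∉T , R∩T z (U⊆R z z∈U)
        split′ : ∀ {a b} → U a ≡ true ⊎ z′ ≡ a → U b ≡ true ⊎ z′ ≡ b → Split U′ a b z′ ⊎ Split U′ b a z′
        split′ (inj₁ r) (inj₁ r′) = [ (λ S → inj₁ (both-old S)) , (λ S → inj₂ (both-old S)) ]′ (split r r′)
        split′ (inj₁ r) (inj₂ refl) = inj₁ (one-old r)
        split′ (inj₂ refl) (inj₁ r′) = inj₂ (one-old r′)
        split′ (inj₂ refl) (inj₂ refl) = inj₁ none-old

      -- For `a` before `b` on the ear, the trail goes from `a` back to `t₁`, through `T` by way of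
      -- `x` to `t₂`, and back over `z` to `b`. The only edge of the first piece that touches `T` is
      -- `e₁`, so `e₁ ≢ e₂` keeps it apart from the closing edge.
      closeEar : ∀ {x z t₂ e₂} → TrailsThrough x T → (E : Ear R z) → Joins e₂ z t₂ → T t₂ ≡ true → e₁ ≢ e₂ →
                 TrailsThrough x (λ v → T v ∨ Ear.U E v)
      closeEar {x} {z} {t₂} {e₂} through E j₂ t₂∈T e₁≢e₂ {a} {b} r r′ = find (∨-true⁻ r) (∨-true⁻ r′)
        where
        open Ear E
        T′ : Fin n → Bool
        T′ v = T v ∨ U v
        U∩T : ∀ {v} {A : Set} → U v ≡ true → T v ≡ true → A
        U∩T {v} r r′ = false≢true (R∩T v (U⊆R v r)) r′
        T⊆ : ∀ {f : Fin n → Bool} → f ⊆ T → f ⊆ T′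
        T⊆ h y r = ∨-trueˡ (h y r)
        p⊆T′ : ∀ {a b} (S : Split U a b z) → N (Split.p S) ⊆ T′
        p⊆T′ S y r = [ ∨-trueʳ , (λ { refl → ∨-trueˡ t₁∈T }) ]′ (Split.p-near S y r)
        p-apart : ∀ {a b c d} (S : Split U a b z) (q : Trail c d) → N q ⊆ T → Apart (ψ (Split.p S)) (ψ q)
        p-apart S q q⊆T = Apart⁺ _ _ λ e r r′ →
          let (x , y) = ∧-true⁻ {N q (s e)} (supp⊆N q e r′) in case Split.p-off S e r of λ
          { (inj₁ refl) → false≢true u₁∉T (q⊆T u₁ (proj₂ (supp⇒ends q j₁ r′)))
          ; (inj₂ (x′ , _)) → false≢true x′ (q⊆T _ x) }
        close : Trail z t₂
        close = along j₂
        q-close : ∀ {a b} (S : Split U a b z) → Apart (ψ (Split.q S)) (ψ close)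
        q-close S = Apart⁺ _ _ λ e r r′ → case supp-along j₂ r′ of λ
          { refl → U∩T (Split.q-near S t₂ (proj₂ (supp⇒ends (Split.q S) j₂ r))) t₂∈T }
        T-false : ∀ {e} → Joins e z t₂ → T (s e) ≡ false → T (t e) ≡ false → ⊥
        T-false (inj₁ (refl , refl)) _ r = false≢true r t₂∈T
        T-false (inj₂ (refl , refl)) r _ = false≢true r t₂∈T
        p-close : ∀ {a b} (S : Split U a b z) → Apart (ψ (Split.p S)) (ψ close)
        p-close S = Apart⁺ _ _ λ e r r′ → case supp-along j₂ r′ of λ
          { refl → [ e₁≢e₂ , (λ (x , y) → T-false j₂ x y) ]′ (Split.p-off S e r) }
        close-apart : ∀ {c d} (r : Trail c d) → N r ⊆ T → Apart (ψ r) (ψ close)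
        close-apart r r⊆T = Apart⁺ _ _ λ e y y′ → case supp-along j₂ y′ of λ
          { refl → U∩T z∈U (r⊆T z (proj₁ (supp⇒ends r j₂ y))) }
        q-apart : ∀ {a b c d} (S : Split U a b z) (r : Trail c d) → N r ⊆ T → Apart (ψ r) (ψ (Split.q S))
        q-apart S r r⊆T = Apart⁺ _ _ λ e y y′ →
          U∩T (Split.q-near S (s e) (proj₁ (∧-true⁻ (supp⊆N (Split.q S) e y′)))) (r⊆T (s e) (proj₁ (∧-true⁻ (supp⊆N r e y))))
        around : ∀ {a b} → Split U a b z → Σ[ p ∈ Trail a b ] N p ⊆ T′ × N p x ≡ true
        around S =
          let (r , r⊆T , x∈r) = through t₁∈T t₂∈T
              q̂ = join q close (q-close S)
              d₁ = Apart-sym {ψ = ψ r} (Apart-⁻¹ _ (ψ p) (Apart-sym {ψ = ψ p} (p-apart S r r⊆T)))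
              d₂ = Apart-∙ (ψ p) (ψ q) (ψ close) apart (p-close S)
              d₃ = Apart-∙ (ψ r) (ψ q) (ψ close) (q-apart S r r⊆T) (close-apart r r⊆T)
              d₄ = Apart-sym {ψ = ψ (back q̂)} (Apart-∙ _ (ψ (back p)) (ψ r)
                     (Apart-⁻¹ _ (ψ p) (Apart-sym {ψ = ψ p} (Apart-⁻¹ _ (ψ q̂) d₂)))
                     (Apart-sym {ψ = ψ r} (Apart-⁻¹ _ (ψ q̂) d₃)))
          in join (join (back p) r d₁) (back q̂) d₄
           , (λ y i → case ∨-true⁻ {N p y ∨ N r y} i of λ
               { (inj₁ i) → [ p⊆T′ S y , (λ i → ∨-trueˡ (r⊆T y i)) ]′ (∨-true⁻ {N p y} i)
               ; (inj₂ i) → [ (λ i → ∨-trueʳ (q-near y i)) , close⊆ y ]′ (∨-true⁻ {N q y} i) })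
           , ∨-trueˡ (∨-trueʳ {N p x} x∈r)
          where
          open Split S
          close⊆ : N close ⊆ T′
          close⊆ y i with insert⁻ t₂ (z ==_) i
          ... | inj₁ k = ∨-trueʳ (subst (λ v → U v ≡ true) (==⇒≡ k) z∈U)
          ... | inj₂ refl = ∨-trueˡ t₂∈T
        hang : ∀ {a b} → T a ≡ true → U b ≡ true → Σ[ p ∈ Trail a b ] N p ⊆ T′ × N p x ≡ true
        hang a∈T b∈U =
          let S = to b∈U
              (r , r⊆T , x∈r) = through a∈T t₁∈T
          in join r (Split.p S) (Apart-sym {ψ = ψ (Split.p S)} (p-apart S r r⊆T))
           , (λ y i → [ (λ i → ∨-trueˡ (r⊆T y i)) , p⊆T′ S y ]′ (∨-true⁻ {N r y} i))
           , ∨-trueˡ x∈r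
        backward : ∀ {a b} → Σ[ p ∈ Trail a b ] N p ⊆ T′ × N p x ≡ true → Σ[ p ∈ Trail b a ] N p ⊆ T′ × N p x ≡ true
        backward (p , p⊆ , x∈) = back p , p⊆ , x∈
        find : T a ≡ true ⊎ U a ≡ true → T b ≡ true ⊎ U b ≡ true → Σ[ p ∈ Trail a b ] N p ⊆ T′ × N p x ≡ true
        find (inj₁ r) (inj₁ r′) = let (p , p⊆ , x∈) = through r r′ in p , T⊆ p⊆ , x∈
        find (inj₁ r) (inj₂ r′) = hang r r′
        find (inj₂ r) (inj₁ r′) = backward (hang r′ r)
        find (inj₂ r) (inj₂ r′) = [ around , (λ S → backward (around S)) ]′ (split r r′)

allᵇ? : ∀ {p} {P : Bool → Set p} → (∀ b → Dec (P b)) → Dec (∀ b → P b)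
allᵇ? P? with P? true | P? false
... | yes p | yes q = yes λ { true → p ; false → q }
... | no ¬p | _ = no λ h → ¬p (h true)
... | yes _ | no ¬q = no λ h → ¬q (h false)

-- Ear decompositions and attached closed trails

module _ {n m : ℕ} (s t : Fin m → Fin n) where
  open Edges s t
  open Trails s t

  _without_ : (Fin n → Bool) → (Fin n → Bool) → Fin n → Bool
  (X without Y) v = X v ∧ not (Y v)

  without⁺ : ∀ {X Y : Fin n → Bool} {v} → X v ≡ true → Y v ≡ false → (X without Y) v ≡ true
  without⁺ p q = ∧-true p (cong not q)

  without⁻ : ∀ (X Y : Fin n → Bool) {v} → (X without Y) v ≡ true → X v ≡ true × Y v ≡ false
  without⁻ X Y {v} r with X v | Y v
  ... | true | false = refl , refl

  TwoEdgeConnected : (Fin n → Bool) → Set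
  TwoEdgeConnected B = ∀ K → K ⊆ B → ∀ {k w} → K k ≡ true → B w ≡ true → K w ≡ false → 2 ≤ # (between K (B without K))

  module _ (B : Fin n → Bool) (two : TwoEdgeConnected B) (x : Fin n) where

    Larger : (Fin n → Bool) → Set
    Larger T = Σ[ T′ ∈ (Fin n → Bool) ] T′ ⊆ B × T ⊆ T′ × TrailsThrough x T′ × ∃[ v ] T v ≡ false × T′ v ≡ true

    module _ {T : Fin n → Bool} (T⊆B : T ⊆ B) (through : TrailsThrough x T)
             {t₁ u₁ e₁} (j₁ : Joins e₁ t₁ u₁) (t₁∈T : T t₁ ≡ true) (u₁∉T : T u₁ ≡ false) where
      open Ears T j₁ t₁∈T u₁∉T

      Ear-mono : ∀ {R R′ z} → R ⊆ R′ → Ear R z → Ear R′ z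
      Ear-mono R⊆R′ E = record { U = U ; U⊆R = λ v r → R⊆R′ v (U⊆R v r) ; z∈U = z∈U ; split = split }
        where open Ear E

      -- `R` is the part of `B` outside `T` reached so far from `u₁`, each vertex with its ear. Once
      -- no edge leads from `R` to the rest of `B` outside `T`, 2-edge-connectedness supplies an
      -- edge other than `e₁` leaving `R` within `B`, and it can only end in `T`.
      addEar : ∀ R → R u₁ ≡ true → R ⊆ B → (∀ v → R v ≡ true → T v ≡ false) → (∀ {z} → R z ≡ true → Ear R z) →
               Acc _<_ (# (B without (λ v → T v ∨ R v))) → Larger T
      addEar R u₁∈R R⊆B R∩T ears (acc rec) with any? (λ e → between R (B without (λ v → T v ∨ R v)) e ≟ᵇ true)
      ... | yes (f , p) =
        let (z , z′ , z∈R , z′∈ , j) = between⁻ {R} {B without (λ v → T v ∨ R v)} p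
            (z′∈B , z′∉) = without⁻ B (λ v → T v ∨ R v) z′∈
            (z′∉T , z′∉R) = ∨-false⁻ z′∉
            R′ = insert z′ R
        in addEar R′ (∨-trueˡ u₁∈R)
             (λ v r → [ R⊆B v , (λ { refl → z′∈B }) ]′ (insert⁻ z′ R r))
             (λ v r → [ R∩T v , (λ { refl → z′∉T }) ]′ (insert⁻ z′ R r))
             (λ r → [ (λ r → Ear-mono (λ v → ∨-trueˡ) (ears r)) , (λ { refl → extendEar R∩T j z′∉R z′∉T (ears z∈R) }) ]′ (insert⁻ z′ R r))
             (rec (#-< {f = B without (λ v → T v ∨ R′ v)} {B without (λ v → T v ∨ R v)}
               (λ v r → let (a , b) = without⁻ B (λ v → T v ∨ R′ v) r ; (c , d) = ∨-false⁻ {T v} b in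
                 without⁺ {B} {λ v → T v ∨ R v} a (cong₂ _∨_ c (proj₁ (∨-false⁻ d))))
               z′ (¬-not λ r → false≢true (proj₂ (without⁻ B (λ v → T v ∨ R′ v) r)) (∨-trueʳ {T z′} (insert-self z′ R))) z′∈))
      ... | no closed =
        let (e₂ , p , e₁≢e₂) = #-other (between R (B without R)) (two R R⊆B u₁∈R (T⊆B t₁ t₁∈T) (¬-not λ r → false≢true (R∩T t₁ r) t₁∈T)) e₁
            (z , t₂ , z∈R , t₂∈ , j₂) = between⁻ {R} {B without R} p
            (t₂∈B , t₂∉R) = without⁻ B R t₂∈
            E = ears z∈R
        in (λ v → T v ∨ Ear.U E v)
         , (λ v r → [ T⊆B v , (λ r → R⊆B v (Ear.U⊆R E v r)) ]′ (∨-true⁻ {T v} r))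
         , (λ v → ∨-trueˡ)
         , closeEar R∩T through E j₂ (T-end z∈R t₂∈B t₂∉R j₂) e₁≢e₂
         , z , R∩T z z∈R , ∨-trueʳ (Ear.z∈U E)
        where
        T-end : ∀ {z t₂ e₂} → R z ≡ true → B t₂ ≡ true → R t₂ ≡ false → Joins e₂ z t₂ → T t₂ ≡ true
        T-end {z} {t₂} {e₂} z∈R t₂∈B t₂∉R j₂ with T t₂ in eq
        ... | true = refl
        ... | false = ⊥-elim (closed (e₂ , between⁺ {R} {B without (λ v → T v ∨ R v)} z∈R
                        (without⁺ {B} {λ v → T v ∨ R v} t₂∈B (cong₂ _∨_ eq t₂∉R)) j₂))

    -- An ear decomposition of `B` grown from the single vertex `x`; every ear adds at least one
    -- vertex.
    trailsThrough : B x ≡ true → TrailsThrough x B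
    trailsThrough x∈B = go (x ==_) (λ v r → subst (λ w → B w ≡ true) (==⇒≡ r) x∈B) (==-refl x) start (<-wellFounded _)
      where
      start : TrailsThrough x (x ==_)
      start {a} {b} r r′ with ==⇒≡ {i = x} {a} r | ==⇒≡ {i = x} {b} r′
      ... | refl | refl = stay x , (λ _ i → i) , ==-refl x
      go : ∀ T → T ⊆ B → T x ≡ true → TrailsThrough x T → Acc _<_ (# (B without T)) → TrailsThrough x B
      go T T⊆B x∈T through (acc rec) with any? (λ v → (B without T) v ≟ᵇ true)
      ... | no full = λ r r′ → let (p , p⊆T , x∈p) = through (B⊆T r) (B⊆T r′) in p , (λ v i → T⊆B v (p⊆T v i)) , x∈p
        where
        B⊆T : ∀ {v} → B v ≡ true → T v ≡ true
        B⊆T {v} r with T v in eq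
        ... | true = refl
        ... | false = ⊥-elim (full (v , without⁺ {B} {T} r eq))
      ... | yes (w , w∈) =
        let (w∈B , w∉T) = without⁻ B T w∈
            (e₁ , _ , p , _) = #-two (between T (B without T)) (two T T⊆B x∈T w∈B w∉T)
            (t₁ , u₁ , t₁∈T , u₁∈ , j₁) = between⁻ {T} {B without T} p
            (u₁∈B , u₁∉T) = without⁻ B T u₁∈
            (T′ , T′⊆B , T⊆T′ , through′ , v , v∉T , v∈T′) = addEar T⊆B through j₁ t₁∈T u₁∉T (u₁ ==_) (==-refl u₁)
              (λ v r → subst (λ w → B w ≡ true) (==⇒≡ r) u₁∈B) (λ v r → subst (λ w → T w ≡ false) (==⇒≡ r) u₁∉T)
              (λ {z} r → subst (Ears.Ear T j₁ t₁∈T u₁∉T (u₁ ==_)) (==⇒≡ {i = u₁} {z} r) (Ears.firstEar T j₁ t₁∈T u₁∉T))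
              (<-wellFounded _)
        in go T′ T′⊆B (T⊆T′ x x∈T) through′ (rec (#-< {f = B without T′} {B without T}
             (λ y r → let (a , b) = without⁻ B T′ r in without⁺ {B} {T} a (¬-not λ c → false≢true b (T⊆T′ y c)))
             v (¬-not λ r → false≢true (proj₂ (without⁻ B T′ r)) v∈T′) (without⁺ {B} {T} (T′⊆B v v∈T′) v∉T)))

  -- Only the two edges have to differ: `x₁` and `x₂`, or `u₁` and `u₂`, may coincide, and `closed`
  -- may be the trivial trail at a single vertex.
  record Attached (X : Fin n → Bool) : Set where
    field
      {x₁ x₂ u₁ u₂} : Fin n
      {e₁ e₂} : Fin m
      j₁ : Joins e₁ x₁ u₁
      j₂ : Joins e₂ x₂ u₂
      x₁∈X : X x₁ ≡ true
      x₂∈X : X x₂ ≡ true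
      e₁≢e₂ : e₁ ≢ e₂
      closed : Trail u₂ u₂
      u₁∈N : N closed u₁ ≡ true
      N∩X : ∀ v → N closed v ≡ true → X v ≡ false

  module _ (cuts : CutsAtLeast 3) (X : Fin n → Bool) {r w} (r∈X : X r ≡ true) (w∉X : X w ≡ false) where

    W : Fin n → Bool
    W v = not (X v)

    Loose : (Fin n → Bool) → Set
    Loose B = (∃[ b ] B b ≡ true) × B ⊆ W × # (between B (W without B)) ≤ 1

    Loose? : ∀ B → Dec (Loose B)
    Loose? B = any? (λ b → B b ≟ᵇ true) ×-dec all? (λ v → (B v ≟ᵇ true) →-dec (W v ≟ᵇ true)) ×-dec (# (between B (W without B)) ≤? 1)

    between-cong : ∀ {A A′ C C′} → A ≗ A′ → C ≗ C′ → between A C ≗ between A′ C′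
    between-cong p q e = cong₂ _∨_ (cong₂ _∧_ (p (s e)) (q (t e))) (cong₂ _∧_ (q (s e)) (p (t e)))

    Loose-cong : ∀ {B C} → B ≗ C → Loose B → Loose C
    Loose-cong {B} {C} B≗C ((b , b∈) , B⊆W , le) = (b , trans (sym (B≗C b)) b∈) , (λ v c → B⊆W v (trans (B≗C v) c))
      , ≤-trans (≤-reflexive (sym (#-cong (between-cong {B} {C} {W without B} {W without C} B≗C λ v → cong (λ c → W v ∧ not c) (B≗C v))))) le

    Loose-W : Loose W
    Loose-W = (w , cong not w∉X) , (λ _ p → p) , ≤-trans (≤-reflexive (#-none _ λ e → none (W (s e)) (W (t e)))) z≤n
      where
      none : ∀ a b → (a ∧ (b ∧ not b)) ∨ ((a ∧ not a) ∧ b) ≡ false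
      none = from-yes (allᵇ? λ a → allᵇ? λ b → ((a ∧ (b ∧ not b)) ∨ ((a ∧ not a) ∧ b)) ≟ᵇ false)

    _⇒_ : Bool → Bool → Bool
    a ⇒ b = not a ∨ b

    ⇒-true : ∀ {a b} → (a ≡ true → b ≡ true) → (a ⇒ b) ≡ true
    ⇒-true {true} h = h refl
    ⇒-true {false} h = refl

    -- An edge between `K` and the rest of `B` is counted at both parts, an edge leaving `B` within
    -- `W` at just one. The comparison is edgewise and is checked on all truth values.
    uncross : ∀ {K B} → K ⊆ B → B ⊆ W →
              # (between K (W without K)) + # (between (B without K) (W without (B without K)))
              ≤ 2 * # (between K (B without K)) + # (between B (W without B))
    uncross {K} {B} K⊆B B⊆W = begin
      # (between K (W without K)) + # (between L (W without L))
        ≡⟨ #-+# (between K (W without K)) (between L (W without L)) ⟨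
      sumℕ (λ e → bit (between K (W without K) e) + bit (between L (W without L) e))
        ≤⟨ sumℕ-mono (λ e → pointwise (K (s e)) (B (s e)) (W (s e)) (⇒-true (K⊆B _)) (⇒-true (B⊆W _))
                                      (K (t e)) (B (t e)) (W (t e)) (⇒-true (K⊆B _)) (⇒-true (B⊆W _))) ⟩
      sumℕ (λ e → 2 * bit (between K (B without K) e) + bit (between B (W without B) e))
        ≡⟨ sumℕ-distrib-+ (λ e → 2 * bit (between K (B without K) e)) (bit ∘ between B (W without B)) ⟩
      sumℕ (λ e → 2 * bit (between K (B without K) e)) + # (between B (W without B))
        ≡⟨ cong (_+ # (between B (W without B))) (sumℕ-*ˡ 2 (bit ∘ between K (B without K))) ⟩
      2 * # (between K (B without K)) + # (between B (W without B)) ∎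
      where
      open ≤-Reasoning
      L = B without K
      Bound : (k b w k′ b′ w′ : Bool) → Set
      Bound k b w k′ b′ w′ =
        bit ((k ∧ (w′ ∧ not k′)) ∨ ((w ∧ not k) ∧ k′))
        + bit (((b ∧ not k) ∧ (w′ ∧ not (b′ ∧ not k′))) ∨ ((w ∧ not (b ∧ not k)) ∧ (b′ ∧ not k′)))
        ≤ 2 * bit ((k ∧ (b′ ∧ not k′)) ∨ ((b ∧ not k) ∧ k′)) + bit ((b ∧ (w′ ∧ not b′)) ∨ ((w ∧ not b) ∧ b′))
      Bound? : ∀ k b w k′ b′ w′ → Dec (Bound k b w k′ b′ w′)
      Bound? k b w k′ b′ w′ = _ ≤? _
      pointwise : ∀ k b w → (k ⇒ b) ≡ true → (b ⇒ w) ≡ true → ∀ k′ b′ w′ → (k′ ⇒ b′) ≡ true → (b′ ⇒ w′) ≡ true →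
        Bound k b w k′ b′ w′
      pointwise = from-yes (allᵇ? λ k → allᵇ? λ b → allᵇ? λ w → ((k ⇒ b) ≟ᵇ true) →-dec (((b ⇒ w) ≟ᵇ true) →-dec
        allᵇ? λ k′ → allᵇ? λ b′ → allᵇ? λ w′ → ((k′ ⇒ b′) ≟ᵇ true) →-dec (((b′ ⇒ w′) ≟ᵇ true) →-dec Bound? k b w k′ b′ w′)))

    cut-split : ∀ {B} → B ⊆ W → cut B ≤ # (between B X) + # (between B (W without B))
    cut-split {B} B⊆W = ≤-trans (sumℕ-mono λ e → pointwise (B (s e)) (X (s e)) (⇒-true (B⊆W _)) (B (t e)) (X (t e)) (⇒-true (B⊆W _)))
                          (≤-reflexive (#-+# (between B X) (between B (W without B))))
      where
      Bound : (b x b′ x′ : Bool) → Set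
      Bound b x b′ x′ = bit (b xor b′) ≤ bit ((b ∧ x′) ∨ (x ∧ b′)) + bit ((b ∧ (not x′ ∧ not b′)) ∨ ((not x ∧ not b) ∧ b′))
      Bound? : ∀ b x b′ x′ → Dec (Bound b x b′ x′)
      Bound? b x b′ x′ = _ ≤? _
      pointwise : ∀ b x → (b ⇒ not x) ≡ true → ∀ b′ x′ → (b′ ⇒ not x′) ≡ true → Bound b x b′ x′
      pointwise = from-yes (allᵇ? λ b → allᵇ? λ x → ((b ⇒ not x) ≟ᵇ true) →-dec
        allᵇ? λ b′ → allᵇ? λ x′ → ((b′ ⇒ not x′) ≟ᵇ true) →-dec Bound? b x b′ x′)

    attach : ∃[ B ] Loose B × (∀ C → Loose C → # B ≤ # C) → Attached X
    attach (B , ((b , b∈B) , B⊆W , le) , least) =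
      let (e₁ , e₂ , p₁ , p₂ , e₁≢e₂) = #-two (between B X) linked
          (u₁ , x₁ , u₁∈B , x₁∈X , j₁) = between⁻ {B} {X} p₁
          (u₂ , x₂ , u₂∈B , x₂∈X , j₂) = between⁻ {B} {X} p₂
          (p , p⊆B , u₁∈p) = trailsThrough B two u₁ u₁∈B u₂∈B u₂∈B
      in record { j₁ = Joins-sym j₁ ; j₂ = Joins-sym j₂ ; x₁∈X = x₁∈X ; x₂∈X = x₂∈X ; e₁≢e₂ = e₁≢e₂
                ; closed = p ; u₁∈N = u₁∈p ; N∩X = λ v r → outside (p⊆B v r) }
      where
      outside : ∀ {v} → B v ≡ true → X v ≡ false
      outside {v} v∈B with X v | B⊆W v v∈B
      ... | false | _ = refl
      -- The cut of `B` has at least 3 edges, and at most one of them stays inside `W`.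
      linked : 2 ≤ # (between B X)
      linked = +-cancelʳ-≤ 1 2 _ (≤-trans (cuts B b∈B (¬-not λ p → false≢true (outside p) r∈X))
                 (≤-trans (cut-split B⊆W) (+-monoʳ-≤ _ le)))
      strict : ∀ {C c d} → C ⊆ B → C c ≡ true → B d ≡ true → C d ≡ false → 2 ≤ # (between C (W without C))
      strict {C} {c} {d} C⊆B c∈C d∈B d∉C = ≰⇒> λ le′ →
        <⇒≱ (#-< C⊆B d d∉C d∈B) (least C ((c , c∈C) , (λ v p → B⊆W v (C⊆B v p)) , le′))
      -- Both `K` and the rest of `B` are smaller than `B`, hence not loose, and together they send
      -- out at least 2 + 2 edges; with at most one edge between them `uncross` would allow only 2 ·
      -- 1 + 1.
      two : TwoEdgeConnected B
      two K K⊆B {k} {w} k∈K w∈B w∉K = ≰⇒> λ few → <⇒≱ {3} {4} ≤-refl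
        (≤-trans (≤-trans (+-mono-≤ (strict K⊆B k∈K w∈B w∉K)
             (strict {B without K} (λ v p → proj₁ (without⁻ B K p)) (without⁺ {B} {K} w∈B w∉K) (K⊆B k k∈K)
               (¬-not λ p → false≢true (proj₂ (without⁻ B K p)) k∈K)))
           (uncross K⊆B B⊆W)) (+-mono-≤ (*-monoʳ-≤ 2 few) le))

    attached : Attached X
    attached = attach (minimal Loose Loose? Loose-cong W Loose-W)

-- Seymour's closure

double : Fin 6 → Fin 6
double a = a ∙ a

times : Fin 3 → Fin 6 → Fin 6
times 0F a = 0F
times 1F a = a
times 2F a = a ∙ a

-- The value 0 serves unless 0 is the forbidden double; in that case 1 serves, as 2 ≠ 0.
avoid : Fin 6 → Fin 6
avoid 0F = 1F
avoid (suc _) = 0F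

double-avoid : ∀ b → double (avoid b) ≢ b
double-avoid = from-yes (all? λ b → ¬? (double (avoid b) ≟ b))

Unit? : ∀ a → Dec (Unit a)
Unit? a = (a ≟ 1F) ⊎-dec (a ≟ 5F)

-- The double of a unit has order 3, so the three doubles are distinct and at most one equals `b`.
oneBad : ∀ b y c → Unit c → ∃[ j ] ∀ k → k ≢ j → double (y ∙ times k c) ≢ b
oneBad = from-yes (all? λ b → all? λ y → all? λ c → Unit? c →-dec
  any? λ j → all? λ k → ¬? (k ≟ j) →-dec ¬? (double (y ∙ times k c) ≟ b))

avoidBoth : ∀ b₁ b₂ y₁ y₂ c₁ c₂ → Unit c₁ → Unit c₂ →
            ∃[ k ] double (y₁ ∙ times k c₁) ≢ b₁ × double (y₂ ∙ times k c₂) ≢ b₂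
avoidBoth b₁ b₂ y₁ y₂ c₁ c₂ u₁ u₂ =
  let (j₁ , good₁) = oneBad b₁ y₁ c₁ u₁
      (j₂ , good₂) = oneBad b₂ y₂ c₂ u₂
      (k , k≢j₁ , k≢j₂) = third j₁ j₂
  in k , good₁ k k≢j₁ , good₂ k k≢j₂
  where
  third : ∀ (j₁ j₂ : Fin 3) → ∃[ k ] k ≢ j₁ × k ≢ j₂
  third = from-yes (all? λ (j₁ : Fin 3) → all? λ (j₂ : Fin 3) → any? λ (k : Fin 3) → ¬? (k ≟ j₁) ×-dec ¬? (k ≟ j₂))

double-shift : ∀ b x y → double (x ∙ y) ≡ b → double y ≡ b ∙ (double x) ⁻¹
double-shift = from-yes (all? λ b → all? λ x → all? λ y → (double (x ∙ y) ≟ b) →-dec (double y ≟ (b ∙ (double x) ⁻¹)))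

∙-identityʳ : ∀ a → a ∙ 0F ≡ a
∙-identityʳ = Z₆.identityʳ

times-zero : ∀ k → times k 0F ≡ 0F
times-zero = from-yes (all? λ k → times k 0F ≟ 0F)

module Centers {n m : ℕ} (s t : Fin m → Fin n) where
  open Boundary ℤ₆ s t
  open Edges s t
  open Trails s t using (Trail; module Trail; supp-one)

  Flow-times : ∀ k φ → Flow φ → Flow (λ e → times k (φ e))
  Flow-times 0F φ p = ∂-ε
  Flow-times 1F φ p = p
  Flow-times 2F φ p = Flow-∙ φ φ p p

  -- Seymour's closure: off the support of ψ, any forbidden values of 2 h can be avoided.
  record Center (X : Fin n → Bool) : Set where
    field
      {root} : Fin n
      root∈X : X root ≡ true
      ψ : Fin m → Fin 6
      signs : ∀ e → Sign (ψ e)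
      ψ-flow : Flow ψ
      supp⊆X : supp ψ ⊆ inside X
      connected : ∀ {u} → X u ≡ true → Connected (inside X) u root
      solve : ∀ (b : Fin m → Fin 6) → ∃[ h ] Flow h × (∀ e → inside X e ≡ false → h e ≡ 0F)
              × (∀ e → inside X e ≡ true → ψ e ≡ 0F → double (h e) ≢ b e)

  -- All edges inside are loops, and a loop is a cycle by itself, so their values can be chosen
  -- independently and completed with the empty set.
  singleton : ∀ r → Center (r ==_)
  singleton r = record
    { root∈X = ==-refl r ; ψ = λ _ → 0F ; signs = λ _ → inj₁ refl ; ψ-flow = ∂-ε ; supp⊆X = λ _ ()
    ; connected = λ {u} p → case ==⇒≡ {i = r} {u} p of λ { refl → here }
    ; solve = solve }
    where
    solve : ∀ (b : Fin m → Fin 6) → ∃[ h ] Flow h × (∀ e → inside (r ==_) e ≡ false → h e ≡ 0F)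
            × (∀ e → inside (r ==_) e ≡ true → 0F ≡ 0F → double (h e) ≢ b e)
    solve b =
      let (h , h-flow , h≡g) = complete (λ _ → false) g loop
      in h , h-flow , (λ e p → trans (h≡g e refl) (cong (λ c → if c then avoid (b e) else 0F) p))
       , λ e p _ q → double-avoid (b e) (trans (cong double (sym (trans (h≡g e refl) (cong (λ c → if c then avoid (b e) else 0F) p)))) q)
      where
      g : Fin m → Fin 6
      g e = if inside (r ==_) e then avoid (b e) else 0F
      loop : ∀ e → false ≡ false → g e ≡ 0F ⊎ Connected (λ _ → false) (s e) (t e)
      loop e _ with inside (r ==_) e in eq
      ... | false = inj₁ refl
      ... | true = let (p , q) = ∧-true⁻ {r == s e} eq in
        inj₂ (subst (Connected (λ _ → false) (s e)) (trans (sym (==⇒≡ {i = r} {s e} p)) (==⇒≡ {i = r} {t e} q)) here)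

  module Enlarge {X : Fin n → Bool} (C : Center X) (A : Attached s t X) where
    open Center C
    open Attached A
    open Trail closed using (N) renaming (ψ to χ)

    X′ : Fin n → Bool
    X′ v = X v ∨ N v

    -- `S` connects `X′` and consists of the edges to be settled by other means: those inside `X` by
    -- the previous stage, those of the trail by `χ` being nonzero, and `e₂` by a multiple of the
    -- circuit. All other edges inside `X′`, `e₁` included, can be prescribed at will.
    S : Fin m → Bool
    S e = inside X e ∨ (supp χ e ∨ (e₂ == e))

    insideX⇒X′ : ∀ e → inside X e ≡ true → inside X′ e ≡ true
    insideX⇒X′ e p = let (x , y) = ∧-true⁻ {X (s e)} p in ∧-true (∨-trueˡ x) (∨-trueˡ y)

    insideN⇒X′ : ∀ e → inside N e ≡ true → inside X′ e ≡ true
    insideN⇒X′ e p = let (x , y) = ∧-true⁻ {N (s e)} p in ∧-true (∨-trueʳ {X (s e)} x) (∨-trueʳ {X (t e)} y)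

    inside-X-N : ∀ {e} → inside X e ≡ true → inside N e ≡ true → ⊥
    inside-X-N {e} p q = false≢true (N∩X (s e) (proj₁ (∧-true⁻ q))) (proj₁ (∧-true⁻ p))

    cross∈X′ : ∀ {e x u} → Joins e x u → X x ≡ true → N u ≡ true → inside X′ e ≡ true
    cross∈X′ j x∈X u∈N = inside⁺ {X′} (∨-trueˡ x∈X) (∨-trueʳ u∈N) j

    cross∉X : ∀ {e x u} → Joins e x u → N u ≡ true → inside X e ≡ false
    cross∉X j u∈N = ¬-not λ p → false≢true (N∩X _ u∈N) (proj₂ (inside⁻ {X} j p))

    cross∉χ : ∀ {e x u} → Joins e x u → X x ≡ true → supp χ e ≡ false
    cross∉χ j x∈X = ¬-not λ p → false≢true (N∩X _ (proj₁ (inside⁻ {N} j (Trail.supp⊆N closed _ p)))) x∈X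

    u₂∈N : N u₂ ≡ true
    u₂∈N = Trail.start∈N closed

    off-X′⇒off-S : ∀ e → inside X′ e ≡ false → S e ≡ false
    off-X′⇒off-S e p = ¬-not λ q → case ∨-true⁻ {inside X e} q of λ
      { (inj₁ q) → false≢true p (insideX⇒X′ e q)
      ; (inj₂ q) → case ∨-true⁻ {supp χ e} q of λ
        { (inj₁ q) → false≢true p (insideN⇒X′ e (Trail.supp⊆N closed e q))
        ; (inj₂ q) → case ==⇒≡ {i = e₂} {e} q of λ { refl → false≢true p (cross∈X′ j₂ x₂∈X u₂∈N) } } }

    toRoot : ∀ {B} → (∀ e → S e ≡ true → B e ≡ true) → ∀ {u} → X′ u ≡ true → Connected B u root
    toRoot S⊆B {u} p with ∨-true⁻ {X u} p
    ... | inj₁ x = Connected-mono (λ e q → S⊆B e (∨-trueˡ q)) (connected x)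
    ... | inj₂ y = Connected-mono (λ e q → S⊆B e (∨-trueʳ {inside X e} (∨-trueˡ q))) (reverse (Trail.connected closed y))
        ◅◅ step e₂ (S⊆B e₂ (∨-trueʳ {inside X e₂} (∨-trueʳ {supp χ e₂} (==-refl e₂)))) (Joins-sym j₂)
             (Connected-mono (λ e q → S⊆B e (∨-trueˡ q)) (connected x₂∈X))

    S⊆X′ : ∀ e → S e ≡ true → inside X′ e ≡ true
    S⊆X′ e p with inside X′ e in eq
    ... | true = refl
    ... | false = false≢true (off-X′⇒off-S e eq) p

    apart : Apart ψ χ
    apart = Apart⁺ ψ χ λ e p q → inside-X-N (supp⊆X e p) (Trail.supp⊆N closed e q)

    -- The circuit runs over `e₁`, along the trail to `u₂`, over `e₂` and back through `X`. Neither
    -- route meets `e₁` or `e₂`, so the values there stay units.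
    circuit : ∃[ q ] Flow q × Unit (q e₁) × Unit (q e₂) × (∀ e → e₁ ≢ e → S e ≡ false → q e ≡ 0F)
    circuit =
      let (b₁ , unit₁ , ∂b₁) = Joins⇒∂ j₁ 1F
          (b₂ , unit₂ , ∂b₂) = Joins⇒∂ (Joins-sym j₂) 1F
          (f₁ , f₁-off , ∂f₁) = route (reverse (Trail.connected closed u₁∈N)) 1F
          (f₂ , f₂-off , ∂f₂) = route (connected x₂∈X ◅◅ reverse (connected x₁∈X)) 1F
          q = λ e → (one e₁ b₁ e ∙ f₁ e) ∙ (one e₂ b₂ e ∙ f₂ e)
          q₁ : q e₁ ≡ b₁
          q₁ = trans (cong₂ _∙_ (cong₂ _∙_ (one-self e₁ b₁) (f₁-off e₁ (cross∉χ j₁ x₁∈X)))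
                                (cong₂ _∙_ (one-≢ {e₂} {e₁} {b₂} (e₁≢e₂ ∘ sym)) (f₂-off e₁ (cross∉X j₁ u₁∈N))))
                     (trans (∙-identityʳ _) (∙-identityʳ _))
          q₂ : q e₂ ≡ b₂
          q₂ = trans (cong₂ _∙_ (cong₂ _∙_ (one-≢ {e₁} {e₂} {b₁} e₁≢e₂) (f₁-off e₂ (cross∉χ j₂ x₂∈X)))
                                (cong₂ _∙_ (one-self e₂ b₂) (f₂-off e₂ (cross∉X j₂ u₂∈N))))
                     (trans (Z₆.identityˡ _) (∙-identityʳ _))
      in q
       , (λ v → trans (∂-∙ (λ e → one e₁ b₁ e ∙ f₁ e) (λ e → one e₂ b₂ e ∙ f₂ e) v)
           (trans (cong₂ _∙_ (trans (∂-∙ (one e₁ b₁) f₁ v) (trans (cong₂ _∙_ (∂b₁ v) (∂f₁ v)) (ends-trans x₁ u₁ u₂ 1F v)))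
                             (trans (∂-∙ (one e₂ b₂) f₂ v) (trans (cong₂ _∙_ (∂b₂ v) (∂f₂ v)) (ends-trans u₂ x₂ x₁ 1F v))))
             (trans (ends-trans x₁ u₂ x₁ 1F v) (ends-self x₁ 1F v))))
       , subst Unit (sym q₁) unit₁
       , subst Unit (sym q₂) unit₂
       , λ e e₁≢e e∉S → let (e∉X , rest) = ∨-false⁻ {inside X e} e∉S ; (e∉χ , e₂≠e) = ∨-false⁻ {supp χ e} rest in
           cong₂ _∙_ (cong₂ _∙_ (one-≢ {e₁} {e} {b₁} e₁≢e) (f₁-off e e∉χ))
                     (cong₂ _∙_ (one-≢ {e₂} {e} {b₂} (==⇒≢ e₂≠e)) (f₂-off e e∉X))

    Solution : (Fin m → Fin 6) → Set
    Solution b = ∃[ h ] Flow h × (∀ e → inside X′ e ≡ false → h e ≡ 0F)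
                 × (∀ e → inside X′ e ≡ true → ψ e ∙ χ e ≡ 0F → double (h e) ≢ b e)

    module _ (b : Fin m → Fin 6) where

      g : Fin m → Fin 6
      g e = if inside X′ e then avoid (b e) else 0F

      completed : ∃[ g′ ] Flow g′ × (∀ e → S e ≡ false → g′ e ≡ g e)
      completed = complete S g close
        where
        close : ∀ e → S e ≡ false → g e ≡ 0F ⊎ Connected S (s e) (t e)
        close e _ with inside X′ e in eq
        ... | false = inj₁ refl
        ... | true = let (p , q) = ∧-true⁻ {X′ (s e)} eq in inj₂ (toRoot (λ _ r → r) p ◅◅ reverse (toRoot (λ _ r → r) q))

      module Combine {g′} (g′-flow : Flow g′) (g′≡g : ∀ e → S e ≡ false → g′ e ≡ g e)
                     {q} (q-flow : Flow q) (q-off : ∀ e → e₁ ≢ e → S e ≡ false → q e ≡ 0F)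
                     k (good₁ : double (g′ e₁ ∙ times k (q e₁)) ≢ b e₁) (good₂ : double (g′ e₂ ∙ times k (q e₂)) ≢ b e₂)
                     {h} (h-flow : Flow h) (h-off : ∀ e → inside X e ≡ false → h e ≡ 0F)
                     (h-good : ∀ e → inside X e ≡ true → ψ e ≡ 0F → double (h e) ≢ b e ∙ (double (g′ e ∙ times k (q e))) ⁻¹) where
        h₁ : Fin m → Fin 6
        h₁ e = g′ e ∙ times k (q e)
        zeros : ∀ e → ψ e ∙ χ e ≡ 0F → ψ e ≡ 0F × χ e ≡ 0F
        zeros e p = let (x , y) = ∨-false⁻ {supp ψ e} (trans (sym (nonzero-∙ (ψ e) (χ e) (apart e))) (cong nonzero p)) in
          nonzero-false _ x , nonzero-false _ y
        outer : ∀ e → inside X′ e ≡ true → inside X e ≡ false → χ e ≡ 0F → double (h₁ e) ≢ b e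
        outer e e∈X′ e∉X χ≡0 with e₁ ≟ e | e₂ ≟ e
        ... | yes refl | _ = good₁
        ... | no _ | yes refl = good₂
        ... | no e₁≢e | no e₂≢e = λ eq → double-avoid (b e) (trans (cong double (sym value)) eq)
          where
          e∉S : S e ≡ false
          e∉S = cong₂ _∨_ e∉X (cong₂ _∨_ (cong nonzero χ≡0) (≢⇒== e₂≢e))
          value : h₁ e ≡ avoid (b e)
          value = trans (cong₂ _∙_ (trans (g′≡g e e∉S) (cong (λ c → if c then avoid (b e) else 0F) e∈X′))
            (trans (cong (times k) (q-off e e₁≢e e∉S)) (times-zero k))) (∙-identityʳ _)
        good : ∀ e → inside X′ e ≡ true → ψ e ∙ χ e ≡ 0F → double (h₁ e ∙ h e) ≢ b e
        good e e∈X′ z with inside X e in eq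
        ... | true = λ r → h-good e eq (proj₁ (zeros e z)) (double-shift (b e) (h₁ e) (h e) r)
        ... | false = λ r → outer e e∈X′ eq (proj₂ (zeros e z))
                        (trans (cong double (sym (trans (cong (h₁ e ∙_) (h-off e eq)) (∙-identityʳ (h₁ e))))) r)

        combined : Solution b
        combined =
          (λ e → h₁ e ∙ h e)
          , Flow-∙ h₁ h (Flow-∙ g′ (λ e → times k (q e)) g′-flow (Flow-times k q q-flow)) h-flow
          , (λ e p → cong₂ _∙_ (cong₂ _∙_ (trans (g′≡g e (off-X′⇒off-S e p)) (cong (λ c → if c then avoid (b e) else 0F) p))
                (trans (cong (times k) (q-off e (λ { refl → false≢true p (cross∈X′ j₁ x₁∈X u₁∈N) }) (off-X′⇒off-S e p))) (times-zero k)))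
              (h-off e (¬-not λ r → false≢true p (insideX⇒X′ e r))))
          , good

      solution : Solution b
      solution =
        let (g′ , g′-flow , g′≡g) = completed
            (q , q-flow , unit₁ , unit₂ , q-off) = circuit
            (k , good₁ , good₂) = avoidBoth (b e₁) (b e₂) (g′ e₁) (g′ e₂) (q e₁) (q e₂) unit₁ unit₂
            -- Nothing is known about `g′` and `q` on edges inside `X`; shifting the forbidden
            -- values by what these flows contribute lets the previous stage compensate.
            (h , h-flow , h-off , h-good) = solve (λ e → b e ∙ (double (g′ e ∙ times k (q e))) ⁻¹)
        in Combine.combined {g′} g′-flow g′≡g {q} q-flow q-off k good₁ good₂ {h} h-flow h-off h-good

    enlarged : Center X′
    enlarged = record
      { root∈X = ∨-trueˡ root∈X
      ; ψ = λ e → ψ e ∙ χ e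
      ; signs = λ e → Sign-∙ _ _ (apart e) (signs e) (Trail.signs closed e)
      ; ψ-flow = Flow-∙ ψ χ ψ-flow λ v → trans (Trail.∂ψ closed v) (ends-self u₂ 1F v)
      ; supp⊆X = λ e p → [ (λ p → insideX⇒X′ e (supp⊆X e p)) , (λ p → insideN⇒X′ e (Trail.supp⊆N closed e p)) ]′
          (∨-true⁻ {supp ψ e} (trans (sym (nonzero-∙ (ψ e) (χ e) (apart e))) p))
      ; connected = toRoot S⊆X′
      ; solve = solution
      }

  everywhere : CutsAtLeast 3 → Fin n → ∃[ X ] Center X × (∀ v → X v ≡ true)
  everywhere cuts r = go (r ==_) (singleton r) (<-wellFounded _)
    where
    go : ∀ X → Center X → Acc _<_ (# (not ∘ X)) → ∃[ X ] Center X × (∀ v → X v ≡ true)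
    enlarge : ∀ X (C : Center X) → Attached s t X → Acc _<_ (# (not ∘ X)) → ∃[ X ] Center X × (∀ v → X v ≡ true)
    go X C rec with any? (λ v → X v ≟ᵇ false)
    ... | no full = X , C , λ v → ¬-not λ p → full (v , p)
    ... | yes (w , w∉X) = enlarge X C (attached s t cuts X (Center.root∈X C) w∉X) rec
    enlarge X C A (acc rec) = go X′ enlarged (rec (#-< {f = not ∘ X′} {not ∘ X}
        (λ v p → cong not (proj₁ (nor⁻ {X v} p)))
        (Attached.u₂ A) (cong not (∨-trueʳ u₂∈N)) (cong not (Attached.N∩X A _ u₂∈N))))
      where open Enlarge C A

-- Flows over ℤ₆

module SixFlows where

  triple : Fin 6 → Fin 6
  triple a = a ∙ a ∙ a

  half : Fin 2 → Fin 6
  half 0F = 0F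
  half 1F = 3F

  half-hom : IsGroupHomomorphism (AbelianGroup.rawGroup ℤ₂) (AbelianGroup.rawGroup ℤ₆) half
  half-hom = isHomomorphism ℤ₂ ℤ₆ half (cong half)
    (from-yes (all? λ a → all? λ b → half (AbelianGroup._∙_ ℤ₂ a b) ≟ (half a ∙ half b)))
    refl
    (from-yes (all? λ a → half (AbelianGroup._⁻¹ ℤ₂ a) ≟ (half a ⁻¹)))

  half-injective : ∀ {a b} → half a ≡ half b → a ≡ b
  half-injective {a} {b} = from-yes (all? λ a → all? λ b → (half a ≟ half b) →-dec (a ≟ b)) a b

  -- Modulo 3 both `triple p` and `half a` vanish, whereas `double y`, an even nonzero residue, does
  -- not.
  translate-nonzero : ∀ p y → nonzero (double y) ≡ true → ∀ a → (triple p ∙ double y) ∙ half a ≢ 0F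
  translate-nonzero = from-yes (all? λ p → all? λ y → (nonzero (double y) ≟ᵇ true) →-dec
    all? λ a → ¬? (((triple p ∙ double y) ∙ half a) ≟ 0F))

  -- If `p` is ±1, then `triple p` is 3 and the sum is odd; if `p` is 0, only `double y` is left.
  sum-nonzero : ∀ p y → Sign p → (p ≡ 0F → double y ≢ 0F) → triple p ∙ double y ≢ 0F
  sum-nonzero = from-yes (all? λ p → all? λ y → Sign? p →-dec
    (((p ≟ 0F) →-dec ¬? (double y ≟ 0F)) →-dec ¬? ((triple p ∙ double y) ≟ 0F)))

  shift-nonzero : ∀ p h k → (p ≡ 0F → double h ≢ 0F) → p ≡ 0F → double (h ∙ times k p) ≢ 0F
  shift-nonzero p h k nz p≡0 = subst (λ a → double a ≢ 0F)
    (sym (trans (cong (λ q → h ∙ times k q) p≡0) (trans (cong (h ∙_) (times-zero k)) (∙-identityʳ h)))) (nz p≡0)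

  #nonzero : Fin 6 → Fin 6 → ℕ
  #nonzero p h = bit (nonzero p) + (bit (nonzero (double (h ∙ times 0F p))) + (bit (nonzero (double (h ∙ times 1F p)))
                   + bit (nonzero (double (h ∙ times 2F p)))))

  -- For `p = 0` the count is 0 + 3, the three doubles being equal and nonzero. For `p = ±1` it is 1
  -- + 2, the doubles running through 0, 2 and 4 in some order.
  #nonzero≡3 : ∀ p h → Sign p → (p ≡ 0F → double h ≢ 0F) → #nonzero p h ≡ 3
  #nonzero≡3 = from-yes (all? λ p → all? λ h → Sign? p →-dec (((p ≟ 0F) →-dec ¬? (double h ≟ 0F)) →-dec (#nonzero p h ℕ≟ 3)))

  -- Parity inside ℤ₆: the value is 0 for even and 3 for odd numbers.
  threefold : ℕ → Fin 6
  threefold zero = 0F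
  threefold (suc k) = 3F ∙ threefold k

  threefold-+ : ∀ a b → threefold (a + b) ≡ threefold a ∙ threefold b
  threefold-+ zero b = sym (Z₆.identityˡ _)
  threefold-+ (suc a) b = trans (cong (3F ∙_) (threefold-+ a b)) (sym (Z₆.assoc 3F (threefold a) (threefold b)))

  -- Since 3 = -3 in ℤ₆, signs and orientations disappear, and the boundary of 3ψ only records the
  -- parity of the degree in supp ψ.
  TripleEnds : Fin 6 → Bool → Bool → Set
  TripleEnds p a b = (if a then triple p else 0F) ∙ (if b then triple p else 0F) ⁻¹
                     ≡ threefold (bit (nonzero p ∧ a) + bit (nonzero p ∧ b))

  triple-ends : ∀ p a b → Sign p → TripleEnds p a b
  triple-ends = from-yes (all? λ p → allᵇ? λ a → allᵇ? λ b → Sign? p →-dec TripleEnds? p a b)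
    where
    TripleEnds? : ∀ p a b → Dec (TripleEnds p a b)
    TripleEnds? p a b = _ ≟ _

  module _ {n m : ℕ} (G : OrientedGraph n m) (3-connected : EdgeConnected G 3) where
    open OrientedGraph G renaming (initial to s; terminal to t)
    open FlowsOf ℤ₆ G
    open Edges s t
    open Centers s t
    open Sum Z₆.commutativeMonoid using (sum; sum-cong-≗)

    cuts : CutsAtLeast 3
    cuts = EdgeConnected⇒CutsAtLeast G 3-connected

    module _ {ψ : Fin m → Fin 6} (signs : ∀ e → Sign (ψ e)) (ψ-flow : Flow ψ) where

      ∂-triple : ∀ v → ∂ (triple ∘ ψ) v ≡ threefold (degree (supp ψ) v)
      ∂-triple v = trans (sum-cong-≗ λ e → triple-ends (ψ e) (s e == v) (t e == v) (signs e)) (sum-threefold λ e → bit (supp ψ e ∧ (s e == v)) + bit (supp ψ e ∧ (t e == v)))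
        where
        sum-threefold : (f : Fin k → ℕ) → sum (threefold ∘ f) ≡ threefold (sumℕ f)
        sum-threefold {zero} f = refl
        sum-threefold {suc k} f = trans (cong (threefold (f zero) ∙_) (sum-threefold (f ∘ suc))) (sym (threefold-+ (f zero) (sumℕ (f ∘ suc))))

      triple-flow : Flow (triple ∘ ψ)
      triple-flow = Flow-∙ (λ e → ψ e ∙ ψ e) ψ (Flow-∙ ψ ψ ψ-flow ψ-flow) ψ-flow

      degree≢3 : ∀ v → degree (supp ψ) v ≢ 3
      degree≢3 v eq = odd (trans (cong threefold (sym eq)) (trans (sym (∂-triple v)) (triple-flow v)))
        where
        odd : threefold 3 ≢ 0F
        odd ()

      -- Where `G` has degree at least 4, comparing the two degrees is enough. Where it has degree
      -- 3, parity excludes degree 3 in the support and leaves at most 2.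
      degree-bound : ∀ v → degree (supp ψ) v + 4 ≤ 2 * degree (everything G) v
      degree-bound v = bound _ _ (degree≢3 v) sub (minDegree G (proj₁ 3-connected) cuts v)
        where
        sub : degree (supp ψ) v ≤ degree (everything G) v
        sub = sumℕ-mono λ e → +-mono-≤ (bit-mono λ p → proj₂ (∧-true⁻ {supp ψ e} p)) (bit-mono λ p → proj₂ (∧-true⁻ {supp ψ e} p))
        bound : ∀ c d → c ≢ 3 → c ≤ d → 3 ≤ d → c + 4 ≤ 2 * d
        bound c d c≢3 c≤d 3≤d with 4 ≤? d
        ... | yes 4≤d = ≤-trans (+-mono-≤ c≤d 4≤d) (≤-reflexive (cong (d +_) (sym (+-identityʳ d))))
        ... | no 4≰d with ≤-antisym (s≤s⁻¹ (≰⇒> 4≰d)) 3≤d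
        ...   | refl = +-monoˡ-≤ 4 (s≤s⁻¹ (≤∧≢⇒< c≤d c≢3))

      #supp : # (supp ψ) + 2 * n ≤ 2 * m
      #supp = *-cancelˡ-≤ 2 (begin
        2 * (# (supp ψ) + 2 * n)                               ≡⟨ *-distribˡ-+ 2 (# (supp ψ)) (2 * n) ⟩
        2 * # (supp ψ) + 2 * (2 * n)                           ≡⟨ cong (2 * # (supp ψ) +_) (trans (sym (*-assoc 2 2 n)) (*-comm 4 n)) ⟩
        2 * # (supp ψ) + n * 4                                 ≡⟨ cong₂ _+_ (sum-degree (supp ψ)) (sumℕ-const n) ⟨
        sumℕ (degree (supp ψ)) + sumℕ {n} (λ _ → 4)            ≡⟨ sumℕ-distrib-+ (degree (supp ψ)) (λ _ → 4) ⟨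
        sumℕ (λ v → degree (supp ψ) v + 4)                     ≤⟨ sumℕ-mono degree-bound ⟩
        sumℕ (λ v → 2 * degree (everything G) v)               ≡⟨ sumℕ-*ˡ 2 (degree (everything G)) ⟩
        2 * sumℕ (degree (everything G))                       ≡⟨ cong (2 *_) (sum-degree (everything G)) ⟩
        2 * (2 * # (everything G))                             ≡⟨ cong (λ x → 2 * (2 * x)) (#-all (everything G) λ _ → refl) ⟩
        2 * (2 * m)                                            ∎)
        where open ≤-Reasoning

      module _ {h : Fin m → Fin 6} (h-flow : Flow h) (h-good : ∀ e → ψ e ≡ 0F → double (h e) ≢ 0F) where

        shifted : Fin 3 → Fin m → Fin 6
        shifted k e = h e ∙ times k (ψ e)

        free : Fin 3 → Fin m → Bool
        free k e = nonzero (double (shifted k e))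

        -- Together with |supp ψ| the three counts add up to exactly 3m, and |supp ψ| ≤ 2m - 2n.
        #free : m + 2 * n ≤ # (free 0F) + (# (free 1F) + # (free 2F))
        #free = +-cancelˡ-≤ (# (supp ψ)) _ _ (begin
          # (supp ψ) + (m + 2 * n)                                      ≡⟨ shape (# (supp ψ)) m n ⟩
          m + (# (supp ψ) + 2 * n)                                      ≤⟨ +-monoʳ-≤ m #supp ⟩
          m + 2 * m                                                     ≡⟨ *-comm 3 m ⟩
          m * 3                                                         ≡⟨ sumℕ-const m ⟨
          sumℕ {m} (λ _ → 3)                                            ≡⟨ sumℕ-cong (λ e → #nonzero≡3 (ψ e) (h e) (signs e) (h-good e)) ⟨
          sumℕ (λ e → bit (supp ψ e) + (bit (free 0F e) + (bit (free 1F e) + bit (free 2F e))))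
            ≡⟨ sumℕ-distrib-+ (bit ∘ supp ψ) (λ e → bit (free 0F e) + (bit (free 1F e) + bit (free 2F e))) ⟩
          # (supp ψ) + sumℕ (λ e → bit (free 0F e) + (bit (free 1F e) + bit (free 2F e)))
            ≡⟨ cong (# (supp ψ) +_) (sumℕ-distrib-+ (bit ∘ free 0F) (λ e → bit (free 1F e) + bit (free 2F e))) ⟩
          # (supp ψ) + (# (free 0F) + sumℕ (λ e → bit (free 1F e) + bit (free 2F e)))
            ≡⟨ cong (λ x → # (supp ψ) + (# (free 0F) + x)) (#-+# (free 1F) (free 2F)) ⟩
          # (supp ψ) + (# (free 0F) + (# (free 1F) + # (free 2F)))      ∎)
          where
          open ≤-Reasoning
          shape : ∀ c m n → c + (m + 2 * n) ≡ m + (c + 2 * n)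
          shape = solve-∀

        flowsFor : ∀ k → m + 2 * n ≤ 3 * # (free k) → ∃[ N ] 2 ^ m ≤ N ^ 3 * 2 ^ n × HasAtLeast (NowhereZeroFlows ℤ₆ G) N
        flowsFor k le = conclude (manyFlows ℤ₆ G half half-hom half-injective (λ e → triple (ψ e) ∙ double (shifted k e))
          (Flow-∙ (triple ∘ ψ) (double ∘ shifted k) triple-flow (Flow-∙ (shifted k) (shifted k) shifted-flow shifted-flow))
          (free k) (λ e p a → translate-nonzero (ψ e) (shifted k e) p a)
          (λ e _ → sum-nonzero (ψ e) (shifted k e) (signs e) (shift-nonzero (ψ e) (h e) k (h-good e))))
          where
          shifted-flow : Flow (shifted k)
          shifted-flow = Flow-∙ h (λ e → times k (ψ e)) h-flow (Flow-times k ψ ψ-flow)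
          shape : ∀ n → n + 2 * n ≡ 3 * n
          shape = solve-∀
          conclude : ∃[ N ] 2 ^ # (free k) ≤ N * 2 ^ n × HasAtLeast (NowhereZeroFlows ℤ₆ G) N →
                     ∃[ N ] 2 ^ m ≤ N ^ 3 * 2 ^ n × HasAtLeast (NowhereZeroFlows ℤ₆ G) N
          conclude (N , bound , flows) = N , cubeBound (# (free k)) N n m n (2 * n) bound le (shape n) , flows

    manySixFlows : ∃[ N ] 2 ^ m ≤ N ^ 3 * 2 ^ n × HasAtLeast (NowhereZeroFlows ℤ₆ G) N
    manySixFlows = fromCenter (everywhere cuts (proj₁ (#-pos {n} (λ _ → true)
        (subst (1 ≤_) (sym (#-all {n} (λ _ → true) λ _ → refl)) (≤-trans (s≤s z≤n) (proj₁ 3-connected))))))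
      where
      fromCenter : ∃[ X ] Center X × (∀ v → X v ≡ true) → ∃[ N ] 2 ^ m ≤ N ^ 3 * 2 ^ n × HasAtLeast (NowhereZeroFlows ℤ₆ G) N
      fromCenter (X , C , full) =
        -- Forbidding 0 everywhere yields 2h ≠ 0 wherever ψ vanishes.
        let (h , h-flow , _ , h-good) = solve (λ _ → 0F)
            good = λ e → h-good e (∧-true (full (s e)) (full (t e)))
            (k , le) = largest (λ k → # (free signs ψ-flow h-flow good k)) (m + 2 * n) (#free signs ψ-flow h-flow good)
        in flowsFor signs ψ-flow h-flow good k le
        where open Center C

theorem1p6 : (n m : ℕ) (G : OrientedGraph n m) →
    (EdgeConnected G 3 →
    ∃[ N ] 2 ^ m ≤ N ^ 3 * 2 ^ n × HasAtLeast (NowhereZeroFlows ℤ₆ G) N)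
    × (EdgeConnected G 4 →
    ∃[ N ] 2 ^ n ≤ N ^ 3 × HasAtLeast (NowhereZeroFlows ℤ₂×ℤ₂ G) N)
theorem1p6 n m G = SixFlows.manySixFlows G , FourFlows.manyFourFlows G
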